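{- A permutation $\pi\in S_n$ is perfect (i.e. has a perfect tangle solving it) if and only if it admits a balanced marking.
   Context: Tangles: $S_n$ is the set of permutations of $\{1,\dots,n\}$, $\pi(p)$ the element at position $p$; we write $\pi=[\dots a\dots b\dots]$ if $a$ occurs at an earlier position than $b$. The swap $\sigma(i)$ exchanges the elements at positions $i,i+1$. Two permutations are adjacent if one is obtained from the other by swaps $\sigma(p_1),\dots,\sigma(p_k)$ ($k\ge0$) with pairwise $|p_i-p_j|\ge2$. A tangle is a finite sequence $\pi_0,\dots,\pi_m$ with consecutive permutations adjacent; it solves $\pi$ if $\pi_0=\pi$ and $\pi_m$ is the identity (by convention $\pi_0=\pi_1$, $\pi_{m-1}=\pi_m$). In the drawing, element $x$ at time $t$ is at $(p,-t)$ where $\pi_t(p)=x$, and path $x$ is the polyline through these points. A segment is a maximal straight piece of a path; a non-vertical segment is an L-segment if, traversed downward, it moves left, and an R-segment if it moves right. A tangle solving $\pi$ is simple if no two paths cross more than once (equivalently it has the minimum number of crossings), and perfect if it is simple and each path has at most one L-segment and at most one R-segment. Markings: an inversion of $\pi$ is a pair $(a,b)$ with $a>b$ and $\pi=[\dots a\dots b\dots]$. Element $i$ is right if it appears in some inversion $(i,j)$, left if it appears in some inversion $(j,i)$; left-straight if left but not right; right-straight if right but not left; a switchback if both. A marking is a function $M$ from $\{1,\dots,n\}$ to strings in letters $L,R$; it is a marking for $\pi$ if $M(i)=L$ for left-straight $i$, $M(i)=R$ for right-straight $i$, $M(i)\in\{LR,RL\}$ for switchbacks, and $M(i)=\emptyset$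 (empty string) otherwise. A quadruple $(a,b,c,d)$ is a rec in $\pi$ if $\pi=[\dots a\dots b\dots c\dots d\dots]$ and $\min\{a,b\}>\max\{c,d\}$. Given a marking $M$, $e$ is a left switchback of the rec if $M(e)=RL$, $\pi=[\dots a\dots e\dots b\dots]$, and $e$ lies strictly between $c$ and $d$ in value; $e$ is a right switchback if $M(e)=LR$, $\pi=[\dots c\dots e\dots d\dots]$, and $e$ lies strictly between $a$ and $b$ in value. The rec is regular if $a<b$ and $c<d$, irregular otherwise; balanced under $M$ if it has equally many left and right switchbacks; empty if it has no switchbacks. A marking $M$ for $\pi$ is balanced if every regular rec of $\pi$ is balanced and every irregular rec is empty under $M$. -}

module Defs where

open import Data.Nat using (ℕ; zero; suc; _<_; _≤_; _<ᵇ_; _≡ᵇ_; _⊓_; _⊔_)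
open import Data.Bool using (Bool; true; false; _∧_; _∨_; T)
open import Data.List using (List; []; _∷_; length; map; upTo; head; drop)
open import Data.Bool.ListAction using (any)
open import Data.List.Relation.Unary.All using (All)
open import Data.List.Relation.Unary.AllPairs using (AllPairs)
open import Data.Maybe using (Maybe; just)
open import Data.Product using (Σ; ∃; _×_)
open import Data.Sum using (_⊎_)
open import Relation.Nullary using (¬_)
open import Relation.Binary.PropositionalEquality using (_≡_)

-- Permutations of {1,…,n} are lists of naturals (position p ↦ element,
-- positions 0-based); the identity of S_n is [1,2,…,n].

range : ℕ → List ℕ
range n = map suc (upTo n)

At : List ℕ → ℕ → ℕ → Set
At π p x = head (drop p π) ≡ just x

before : List ℕ → ℕ → ℕ → Bool
before []       a b = false
before (x ∷ xs) a b = ((x ≡ᵇ a) ∧ any (λ y → y ≡ᵇ b) xs) ∨ before xs a b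

Before : List ℕ → ℕ → ℕ → Set
Before π a b = T (before π a b)

swapAt : ℕ → List ℕ → List ℕ
swapAt zero    (x ∷ y ∷ xs) = y ∷ x ∷ xs
swapAt zero    xs           = xs
swapAt (suc i) []           = []
swapAt (suc i) (x ∷ xs)     = x ∷ swapAt i xs

applySwaps : List ℕ → List ℕ → List ℕ
applySwaps []       π = π
applySwaps (p ∷ ps) π = swapAt p (applySwaps ps π)

ObtainedBySwaps : List ℕ → List ℕ → Set
ObtainedBySwaps π π' =
  Σ (List ℕ) λ ps →
    All (λ p → suc p < length π) ps ×
    AllPairs (λ p q → suc p < q ⊎ suc q < p) ps ×
    π' ≡ applySwaps ps π

Adjacent : List ℕ → List ℕ → Set
Adjacent π π' = ObtainedBySwaps π π' ⊎ ObtainedBySwaps π' π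

record Tangle : Set where
  field
    len  : ℕ
    perm : ℕ → List ℕ          -- only perm 0 … perm len are relevant
    adj  : ∀ t → t < len → Adjacent (perm t) (perm (suc t))
open Tangle public

Solves : ℕ → Tangle → List ℕ → Set
Solves n τ π = perm τ 0 ≡ π × perm τ (len τ) ≡ range n

-- path x moves left / right during step t → t+1 (downward traversal)
MovesLeft : Tangle → ℕ → ℕ → Set
MovesLeft τ x t = Σ ℕ λ p → Σ ℕ λ p' →
  At (perm τ t) p x × At (perm τ (suc t)) p' x × p' < p

MovesRight : Tangle → ℕ → ℕ → Set
MovesRight τ x t = Σ ℕ λ p → Σ ℕ λ p' →
  At (perm τ t) p x × At (perm τ (suc t)) p' x × p < p'

MaxRun : (ℕ → Set) → ℕ → ℕ → ℕ → Set
MaxRun Mv m s e =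
  s ≤ e × e < m ×
  (∀ t → s ≤ t → t ≤ e → Mv t) ×
  (∀ s' → suc s' ≡ s → ¬ Mv s') ×
  (suc e < m → ¬ Mv (suc e))

LSegment : Tangle → ℕ → ℕ → ℕ → Set
LSegment τ x = MaxRun (MovesLeft τ x) (len τ)

RSegment : Tangle → ℕ → ℕ → ℕ → Set
RSegment τ x = MaxRun (MovesRight τ x) (len τ)

AtMostOneL : Tangle → ℕ → Set
AtMostOneL τ x = ∀ s e s' e' → LSegment τ x s e → LSegment τ x s' e' → s ≡ s' × e ≡ e'

AtMostOneR : Tangle → ℕ → Set
AtMostOneR τ x = ∀ s e s' e' → RSegment τ x s e → RSegment τ x s' e' → s ≡ s' × e ≡ e'

CrossAt : Tangle → ℕ → ℕ → ℕ → Set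
CrossAt τ t x y =
  (Before (perm τ t) x y × Before (perm τ (suc t)) y x) ⊎
  (Before (perm τ t) y x × Before (perm τ (suc t)) x y)

Simple : Tangle → Set
Simple τ = ∀ x y t₁ t₂ → t₁ < t₂ → t₂ < len τ →
  CrossAt τ t₁ x y → ¬ CrossAt τ t₂ x y

PerfectTangle : Tangle → Set
PerfectTangle τ = Simple τ × (∀ x → AtMostOneL τ x × AtMostOneR τ x)

Perfect : ℕ → List ℕ → Set
Perfect n π = Σ Tangle λ τ → Solves n τ π × PerfectTangle τ

data Dir : Set where
  L R : Dir

Marking : Set
Marking = ℕ → List Dir

Inversion : List ℕ → ℕ → ℕ → Set
Inversion π a b = b < a × Before π a b

IsRight : List ℕ → ℕ → Set
IsRight π i = Σ ℕ λ j → Inversion π i j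

IsLeft : List ℕ → ℕ → Set
IsLeft π i = Σ ℕ λ j → Inversion π j i

MarkingFor : ℕ → List ℕ → Marking → Set
MarkingFor n π M = ∀ i → 1 ≤ i → i ≤ n →
  ((IsLeft π i × ¬ IsRight π i) → M i ≡ L ∷ []) ×
  ((IsRight π i × ¬ IsLeft π i) → M i ≡ R ∷ []) ×
  ((IsLeft π i × IsRight π i) → (M i ≡ L ∷ R ∷ [] ⊎ M i ≡ R ∷ L ∷ [])) ×
  ((¬ IsLeft π i × ¬ IsRight π i) → M i ≡ [])

Rec : List ℕ → ℕ → ℕ → ℕ → ℕ → Set
Rec π a b c d = Before π a b × Before π b c × Before π c d × (c ⊔ d) < (a ⊓ b)

isRL : List Dir → Bool
isRL (R ∷ L ∷ []) = true
isRL _            = false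

isLR : List Dir → Bool
isLR (L ∷ R ∷ []) = true
isLR _            = false

strictlyBetween : ℕ → ℕ → ℕ → Bool
strictlyBetween e u v = ((u <ᵇ e) ∧ (e <ᵇ v)) ∨ ((v <ᵇ e) ∧ (e <ᵇ u))

leftSB : List ℕ → Marking → ℕ → ℕ → ℕ → ℕ → ℕ → Bool
leftSB π M a b c d e = isRL (M e) ∧ before π a e ∧ before π e b ∧ strictlyBetween e c d

rightSB : List ℕ → Marking → ℕ → ℕ → ℕ → ℕ → ℕ → Bool
rightSB π M a b c d e = isLR (M e) ∧ before π c e ∧ before π e d ∧ strictlyBetween e a b

countB : (ℕ → Bool) → List ℕ → ℕ
countB f []       = 0
countB f (x ∷ xs) with f x
... | true  = suc (countB f xs)
... | false = countB f xs

Regular : ℕ → ℕ → ℕ → ℕ → Set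
Regular a b c d = a < b × c < d

-- number of left / right switchbacks (switchbacks are elements of π, each occurring once)
BalancedRec : List ℕ → Marking → ℕ → ℕ → ℕ → ℕ → Set
BalancedRec π M a b c d = countB (leftSB π M a b c d) π ≡ countB (rightSB π M a b c d) π

EmptyRec : List ℕ → Marking → ℕ → ℕ → ℕ → ℕ → Set
EmptyRec π M a b c d = ∀ e → ¬ T (leftSB π M a b c d e) × ¬ T (rightSB π M a b c d e)

BalancedMarking : List ℕ → Marking → Set
BalancedMarking π M = ∀ a b c d → Rec π a b c d →
  (Regular a b c d → BalancedRec π M a b c d) ×
  (¬ Regular a b c d → EmptyRec π M a b c d)

{-# OPTIONS --safe #-}
-- Call a an R-element and b an L-element of an inversion (a , b), a being the element that moves right
-- when the two cross.  In a perfect tangle the R-segment of a lies on a line time − position = const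
-- and the L-segment of b on a line time + position = const.  The marking alone determines which
-- elements are to the left of the crossing of a and b, hence its position p a b, so a rec (a,b,c,d)
-- gives p a c + p b d = p a d + p b c, and the two sides of this equation differ exactly by the numbers
-- of left and right switchbacks of the rec.
--
-- Conversely, from a balanced marking one has to find constants x a, y b with y b − x a = 2 p a b for
-- all inversions.  The recs are the 4-cycles of the graph of inversions, and they suffice for the
-- existence of such potentials.  The crossing times x a + p a b then define the tangle, provided p is
-- monotone along each segment.  This can only fail at a pattern 4231 whose elements 2 and 3 are marked
-- RL and LR; in a balanced marking such 2 and 3 lie in the same recs, so their marks can be exchanged.
module Submission where

open import Defs
open import Data.Bool using (Bool; true; false; _∧_; _∨_; not; T; T?; if_then_else_)
import Data.Bool as Bool
open import Data.Bool.ListAction using (any)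
open import Data.Bool.Properties using (∨-identityʳ; ∧-zeroʳ; T-∧; T-∨)
open import Data.Empty using (⊥; ⊥-elim)
open import Data.List using (List; []; _∷_; _++_; length; map)
open import Data.List.Membership.Propositional using (_∈_; find; lose)
open import Data.List.Membership.Propositional.Properties using (∈-∃++; ∈-map⁻; ∈-upTo⁻)
open import Data.List.Relation.Binary.Permutation.Propositional
  using (_↭_; ↭-refl; ↭-sym; ↭-trans; prep; swap; ↭⇒↭ₛ)
open import Data.List.Relation.Binary.Permutation.Propositional.Properties
  using (∈-resp-↭; All-resp-↭; shift; map⁺)
open import Data.List.Relation.Binary.Pointwise using (Pointwise-≡⇒≡)
open import Data.List.Relation.Unary.All using (All; []; _∷_)
import Data.List.Relation.Unary.All as All
import Data.List.Relation.Unary.All.Properties as All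
open import Data.List.Relation.Unary.AllPairs using (AllPairs; []; _∷_)
import Data.List.Relation.Unary.AllPairs as AllPairs
import Data.List.Relation.Unary.AllPairs.Properties as AllPairs
open import Data.List.Relation.Unary.Any using (Any; here; there; any?)
import Data.List.Relation.Unary.Any as Any
open import Data.List.Relation.Unary.Any.Properties using (any⁺; any⁻)
open import Data.List.Relation.Unary.Linked using (Linked)
import Data.List.Relation.Unary.Linked as Linked
open import Data.List.Relation.Unary.Linked.Properties using (AllPairs⇒Linked)
open import Data.List.Relation.Unary.Sorted.TotalOrder.Properties using (↗↭↗⇒≋)
open import Data.List.Relation.Unary.Unique.Propositional using (Unique)
open import Data.Nat using (ℕ; zero; suc; _+_; _*_; _∸_; _<_; _≤_; _<ᵇ_; _≡ᵇ_; z≤n; s≤s; z<s; s<s; _≟_; _<?_)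
open import Data.List.Membership.DecPropositional _≟_ using (_∈?_)
open import Data.Nat.Induction using (<-wellFounded)
open import Data.Nat.ListAction using (sum)
open import Data.Nat.ListAction.Properties using (sum-↭)
open import Data.Nat.Properties
open import Data.Nat.Tactic.RingSolver using (solve-∀)
open import Data.Product using (Σ; ∃; _×_; _,_; proj₁; proj₂)
open import Data.Sum using (_⊎_; inj₁; inj₂; [_,_]′)
import Data.Sum as Sum
open import Function.Base using (_∘_; flip)
open import Function.Bundles using (Equivalence; _⇔_; mk⇔)
open import Induction.WellFounded using (Acc; acc)
open import Level using (0ℓ)
open import Relation.Binary.Core using (Rel)
open import Relation.Binary.Definitions using (Tri; tri<; tri≈; tri>; Trichotomous; Transitive)
open import Relation.Binary.PropositionalEquality
open import Relation.Nullary using (¬_; Dec; yes; no; does)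
open import Relation.Nullary.Decidable using (_×-dec_; map′; dec-true; dec-false; isYes)

-- Booleans, sums over lists and positions in lists

-- Why the marking determines crossing positions: if an element e is not inverted with both a and b,
-- its side of their crossing follows from the inversions alone. Otherwise a, b, e are pairwise
-- inverted, and the mark of the middle one decides between the two possible orders of the three
-- crossings.
--
-- The identity relating `p` to switchbacks holds for every marking and serves both directions. Read
-- off a tangle, it gives balance for a regular rec; for a rec with exactly one descending pair it
-- says that a sum of naturals is 0, hence that the rec is empty. If both pairs descend, it only
-- equates two counts, and emptiness needs a further argument: the marking of a tangle has no bad
-- 4231.
--
-- The factor 2 arises from eliminating time between time - position and time + position. As all
-- quantities are natural numbers, equations are cross-added instead of subtracted, and potentials
-- are shifted upwards where a difference might be negative.

⟦_⟧ : Bool → ℕ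
⟦ true ⟧  = 1
⟦ false ⟧ = 0

true-or-false : ∀ b → b ≡ true ⊎ b ≡ false
true-or-false true  = inj₁ refl
true-or-false false = inj₂ refl

true≢false : ∀ {b} → b ≡ true → b ≡ false → ⊥
true≢false refl ()

T⇒≡ : ∀ {b} → T b → b ≡ true
T⇒≡ {true} _ = refl

≡⇒T : ∀ {b} → b ≡ true → T b
≡⇒T refl = _

¬T⇒≡ : ∀ {b} → ¬ T b → b ≡ false
¬T⇒≡ {true}  ¬b = ⊥-elim (¬b _)
¬T⇒≡ {false} _  = refl

≡⇒¬T : ∀ {b} → b ≡ false → ¬ T b
≡⇒¬T refl ()

T-bool-ext : ∀ {b c} → (T b → T c) → (T c → T b) → b ≡ c
T-bool-ext {true}  {true}  _ _ = refl
T-bool-ext {true}  {false} f _ = ⊥-elim (f _)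
T-bool-ext {false} {true}  _ g = ⊥-elim (g _)
T-bool-ext {false} {false} _ _ = refl

∧-T : ∀ {b c} → T b → T c → T (b ∧ c)
∧-T p q = Equivalence.from T-∧ (p , q)

T-∧⁻ : ∀ {b c} → T (b ∧ c) → T b × T c
T-∧⁻ = Equivalence.to T-∧

T-∨⁻ : ∀ {b c} → T (b ∨ c) → T b ⊎ T c
T-∨⁻ = Equivalence.to T-∨

T-∨ˡ : ∀ {b c} → T b → T (b ∨ c)
T-∨ˡ p = Equivalence.from T-∨ (inj₁ p)

T-∨ʳ : ∀ {b c} → T c → T (b ∨ c)
T-∨ʳ {b} p = Equivalence.from (T-∨ {b}) (inj₂ p)

<⇒<ᵇ≡true : ∀ {m n} → m < n → (m <ᵇ n) ≡ true
<⇒<ᵇ≡true m<n = T⇒≡ (<⇒<ᵇ m<n)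

≤⇒<ᵇ≡false : ∀ {m n} → n ≤ m → (m <ᵇ n) ≡ false
≤⇒<ᵇ≡false {m} {n} n≤m = ¬T⇒≡ (λ p → <⇒≱ (<ᵇ⇒< m n p) n≤m)

countB-sum : ∀ f xs → countB f xs ≡ sum (map (⟦_⟧ ∘ f) xs)
countB-sum f [] = refl
countB-sum f (x ∷ xs) with f x
... | true  = cong suc (countB-sum f xs)
... | false = countB-sum f xs

Σ⟨_⟩ : List ℕ → (ℕ → ℕ) → ℕ
Σ⟨ xs ⟩ f = sum (map f xs)

Σ-cong : ∀ {f g} xs → (∀ e → e ∈ xs → f e ≡ g e) → Σ⟨ xs ⟩ f ≡ Σ⟨ xs ⟩ g
Σ-cong []       h = refl
Σ-cong (x ∷ xs) h = cong₂ _+_ (h x (here refl)) (Σ-cong xs (λ e p → h e (there p)))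

+-interchange : ∀ a b c d → (a + b) + (c + d) ≡ (a + c) + (b + d)
+-interchange a b c d = begin
  (a + b) + (c + d) ≡⟨ +-assoc a b (c + d) ⟩
  a + (b + (c + d)) ≡⟨ cong (a +_) (+-assoc b c d) ⟨
  a + ((b + c) + d) ≡⟨ cong (λ z → a + (z + d)) (+-comm b c) ⟩
  a + ((c + b) + d) ≡⟨ cong (a +_) (+-assoc c b d) ⟩
  a + (c + (b + d)) ≡⟨ +-assoc a c (b + d) ⟨
  (a + c) + (b + d) ∎
  where open ≡-Reasoning

Σ-+ : ∀ f g xs → Σ⟨ xs ⟩ (λ e → f e + g e) ≡ Σ⟨ xs ⟩ f + Σ⟨ xs ⟩ g
Σ-+ f g []       = refl
Σ-+ f g (x ∷ xs) = trans (cong (f x + g x +_) (Σ-+ f g xs)) (+-interchange (f x) (g x) _ _)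

Σ-mono : ∀ {f g} xs → (∀ e → e ∈ xs → f e ≤ g e) → Σ⟨ xs ⟩ f ≤ Σ⟨ xs ⟩ g
Σ-mono []       h = z≤n
Σ-mono (x ∷ xs) h = +-mono-≤ (h x (here refl)) (Σ-mono xs (λ e p → h e (there p)))

Σ-mono-< : ∀ {f g} xs → (∀ e → e ∈ xs → f e ≤ g e) → ∀ x → x ∈ xs → f x < g x → Σ⟨ xs ⟩ f < Σ⟨ xs ⟩ g
Σ-mono-< (_ ∷ xs) h x (here refl) fx<gx =
  +-mono-<-≤ fx<gx (Σ-mono xs (λ e p → h e (there p)))
Σ-mono-< (y ∷ xs) h x (there x∈xs) fx<gx =
  +-mono-≤-< (h y (here refl)) (Σ-mono-< xs (λ e p → h e (there p)) x x∈xs fx<gx)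

Σ-zero : ∀ {f} xs → (∀ e → e ∈ xs → f e ≡ 0) → Σ⟨ xs ⟩ f ≡ 0
Σ-zero []       h = refl
Σ-zero (x ∷ xs) h = cong₂ _+_ (h x (here refl)) (Σ-zero xs (λ e p → h e (there p)))

Σ-zero⁻ : ∀ {f} xs → Σ⟨ xs ⟩ f ≡ 0 → ∀ e → e ∈ xs → f e ≡ 0
Σ-zero⁻ {f} (x ∷ xs) h e (here refl) = m+n≡0⇒m≡0 (f x) h
Σ-zero⁻ {f} (x ∷ xs) h e (there p)   = Σ-zero⁻ xs (m+n≡0⇒n≡0 (f x) h) e p

Σ-⟦⟧-witness : ∀ (f : ℕ → Bool) xs → Σ⟨ xs ⟩ (λ e → ⟦ f e ⟧) ≢ 0 → ∃ λ e → e ∈ xs × f e ≡ true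
Σ-⟦⟧-witness f [] nonzero = ⊥-elim (nonzero refl)
Σ-⟦⟧-witness f (x ∷ xs) nonzero with f x in eq
... | true  = x , here refl , eq
... | false with e , e∈ , t ← Σ-⟦⟧-witness f xs nonzero = e , there e∈ , t

Σ-↭ : ∀ f {xs ys} → xs ↭ ys → Σ⟨ xs ⟩ f ≡ Σ⟨ ys ⟩ f
Σ-↭ f p = sum-↭ (map⁺ f p)

∈-split : ∀ {x : ℕ} {xs} → x ∈ xs → ∃ λ ys → xs ↭ x ∷ ys
∈-split x∈xs with ys , zs , refl ← ∈-∃++ x∈xs = ys ++ zs , shift _ ys zs

Unique-resp-↭ : ∀ {xs ys : List ℕ} → xs ↭ ys → Unique xs → Unique ys
Unique-resp-↭ p = S.Unique-resp-↭ (↭⇒↭ₛ p)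
  where import Data.List.Relation.Binary.Permutation.Setoid.Properties (setoid ℕ) as S

∈-tail : ∀ {x y : ℕ} {xs} → x ≢ y → y ∈ x ∷ xs → y ∈ xs
∈-tail x≢y (here refl) = ⊥-elim (x≢y refl)
∈-tail x≢y (there p)   = p

-- Cross addition replaces the statement that the two sums differ by the change at `x` and `y`
-- alone.
Σ-update : ∀ f g {xs x y} → Unique xs → x ∈ xs → y ∈ xs → x ≢ y →
  (∀ e → e ≢ x → e ≢ y → f e ≡ g e) →
  Σ⟨ xs ⟩ f + (g x + g y) ≡ Σ⟨ xs ⟩ g + (f x + f y)
Σ-update f g {xs} {x} {y} u x∈ y∈ x≢y f≗g
  with ys , p ← ∈-split x∈
  with zs , q ← ∈-split (∈-tail x≢y (∈-resp-↭ p y∈))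
  with r ← ↭-trans p (prep x q)
  with (x≢y′ ∷ x∉) ∷ (y∉ ∷ _) ← Unique-resp-↭ r u = begin
    Σ⟨ xs ⟩ f + (g x + g y)               ≡⟨ cong (_+ (g x + g y)) (Σ-↭ f r) ⟩
    (f x + (f y + Σ⟨ zs ⟩ f)) + (g x + g y) ≡⟨ cong (λ s → (f x + (f y + s)) + (g x + g y))
                                                 (Σ-cong zs (λ e e∈ → f≗g e (λ { refl → All.lookup x∉ e∈ refl }) (λ { refl → All.lookup y∉ e∈ refl }))) ⟩
    (f x + (f y + Σ⟨ zs ⟩ g)) + (g x + g y) ≡⟨ lemma (f x) (f y) (Σ⟨ zs ⟩ g) (g x) (g y) ⟩
    (g x + (g y + Σ⟨ zs ⟩ g)) + (f x + f y) ≡⟨ cong (_+ (f x + f y)) (Σ-↭ g r) ⟨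
    Σ⟨ xs ⟩ g + (f x + f y)               ∎
  where
  open ≡-Reasoning
  open import Data.Nat.Tactic.RingSolver using (solve-∀)
  lemma : ∀ a b s c d → (a + (b + s)) + (c + d) ≡ (c + (d + s)) + (a + b)
  lemma = solve-∀

-- Elements outside the list are placed after it, in increasing order, so that pos is injective on ℕ.
pos : List ℕ → ℕ → ℕ
pos []       x = x
pos (y ∷ ys) x with y ≟ x
... | yes _ = 0
... | no  _ = suc (pos ys x)

pos-here : ∀ x xs → pos (x ∷ xs) x ≡ 0
pos-here x xs with x ≟ x
... | yes _   = refl
... | no x≢x = ⊥-elim (x≢x refl)

pos-there : ∀ {x y} xs → x ≢ y → pos (x ∷ xs) y ≡ suc (pos xs y)
pos-there {x} {y} xs x≢y with x ≟ y
... | yes x≡y = ⊥-elim (x≢y x≡y)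
... | no _    = refl

pos-injective : ∀ xs {x y} → pos xs x ≡ pos xs y → x ≡ y
pos-injective []       eq = eq
pos-injective (z ∷ xs) {x} {y} eq with z ≟ x | z ≟ y
... | yes refl | yes refl = refl
... | no _     | no _     = pos-injective xs (suc-injective eq)

∈⇒pos<length : ∀ {x xs} → x ∈ xs → pos xs x < length xs
∈⇒pos<length {x} {y ∷ xs} x∈ with y ≟ x
... | yes _   = s≤s z≤n
... | no y≢x = s≤s (∈⇒pos<length (∈-tail y≢x x∈))

pos<length⇒∈ : ∀ xs {x} → pos xs x < length xs → x ∈ xs
pos<length⇒∈ (y ∷ xs) {x} lt with y ≟ x
... | yes refl = here refl
... | no _     = there (pos<length⇒∈ xs (≤-pred lt))

pos<⇒∈ : ∀ xs {x y} → pos xs x < pos xs y → y ∈ xs → x ∈ xs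
pos<⇒∈ xs lt y∈ = pos<length⇒∈ xs (<-trans lt (∈⇒pos<length y∈))

any-≡⁻ : ∀ b xs → T (any (λ y → y ≡ᵇ b) xs) → b ∈ xs
any-≡⁻ b xs p = Any.map (λ {y} q → sym (≡ᵇ⇒≡ y b q)) (any⁻ _ xs p)

any-≡⁺ : ∀ b xs → b ∈ xs → T (any (λ y → y ≡ᵇ b) xs)
any-≡⁺ b xs p = any⁺ _ (Any.map (λ {y} q → ≡⇒≡ᵇ y b (sym q)) p)

Before⇒∈ : ∀ xs {a b} → Before xs a b → a ∈ xs × b ∈ xs
Before⇒∈ (x ∷ xs) {a} {b} p with T-∨⁻ {(x ≡ᵇ a) ∧ any (λ y → y ≡ᵇ b) xs} p
... | inj₁ q with q₁ , q₂ ← T-∧⁻ {x ≡ᵇ a} q = here (sym (≡ᵇ⇒≡ x a q₁)) , there (any-≡⁻ b xs q₂)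
... | inj₂ q with a∈ , b∈ ← Before⇒∈ xs {a} {b} q = there a∈ , there b∈

Before⇒pos< : ∀ {xs a b} → Unique xs → Before xs a b → pos xs a < pos xs b
Before⇒pos< {x ∷ xs} {a} {b} (x∉ ∷ u) p with T-∨⁻ {(x ≡ᵇ a) ∧ any (λ y → y ≡ᵇ b) xs} p
... | inj₁ q with q₁ , q₂ ← T-∧⁻ {x ≡ᵇ a} q with refl ← ≡ᵇ⇒≡ x a q₁
  rewrite pos-here x xs | pos-there xs (All.lookup x∉ (any-≡⁻ b xs q₂)) = z<s
Before⇒pos< {x ∷ xs} {a} {b} (x∉ ∷ u) p | inj₂ q with a∈ , b∈ ← Before⇒∈ xs {a} {b} q
  rewrite pos-there xs (All.lookup x∉ a∈) | pos-there xs (All.lookup x∉ b∈) = s<s (Before⇒pos< {xs} u q)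

pos<⇒Before : ∀ xs {a b} → b ∈ xs → pos xs a < pos xs b → Before xs a b
pos<⇒Before (x ∷ xs) {a} {b} b∈ lt with x ≟ a | x ≟ b
... | yes refl | no x≢b = T-∨ˡ {(x ≡ᵇ x) ∧ any (λ y → y ≡ᵇ b) xs}
                            (∧-T {x ≡ᵇ x} (≡⇒≡ᵇ x x refl) (any-≡⁺ b xs (∈-tail x≢b b∈)))
... | no x≢a   | no x≢b = T-∨ʳ {(x ≡ᵇ a) ∧ any (λ y → y ≡ᵇ b) xs} (pos<⇒Before xs (∈-tail x≢b b∈) (≤-pred lt))

∈⇒At-pos : ∀ xs {x} → x ∈ xs → At xs (pos xs x) x
∈⇒At-pos (y ∷ xs) {x} x∈ with y ≟ x
... | yes refl = refl
... | no y≢x  = ∈⇒At-pos xs (∈-tail y≢x x∈)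

At⇒∈ : ∀ xs p {x} → At xs p x → x ∈ xs
At⇒∈ (y ∷ xs) zero    refl = here refl
At⇒∈ (y ∷ xs) (suc p) at   = there (At⇒∈ xs p at)
At⇒∈ []       (suc p) ()

At⇒pos : ∀ {xs} p {x} → Unique xs → At xs p x → pos xs x ≡ p
At⇒pos {y ∷ xs} zero    u refl = pos-here y xs
At⇒pos {y ∷ xs} (suc p) {x} (y∉ ∷ u) at
  rewrite pos-there xs (All.lookup y∉ (At⇒∈ xs p at)) = cong suc (At⇒pos p u at)
At⇒pos {[]} (suc p) u ()

-- Brings an index into the form of `p`, a count of the elements to the left.
pos-count : ∀ {xs x} → Unique xs → x ∈ xs → pos xs x ≡ Σ⟨ xs ⟩ (λ e → ⟦ pos xs e <ᵇ pos xs x ⟧)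
pos-count {y ∷ xs} {x} (y∉ ∷ u) x∈ with y ≟ x
... | yes refl = sym (Σ-zero (y ∷ xs) (λ _ _ → refl))
... | no y≢x = begin
  suc (pos xs x)                                 ≡⟨ cong suc (pos-count u (∈-tail y≢x x∈)) ⟩
  suc (Σ⟨ xs ⟩ (λ e → ⟦ pos xs e <ᵇ pos xs x ⟧)) ≡⟨ cong₂ (λ b s → ⟦ b <ᵇ suc (pos xs x) ⟧ + s) (sym (pos-here y xs))
      (Σ-cong xs (λ e e∈ → cong (λ b → ⟦ b <ᵇ suc (pos xs x) ⟧) (sym (pos-there xs (All.lookup y∉ e∈))))) ⟩
  Σ⟨ y ∷ xs ⟩ (λ e → ⟦ pos (y ∷ xs) e <ᵇ suc (pos xs x) ⟧) ∎
  where open ≡-Reasoning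

pos-count-↭ : ∀ {xs ys x} → xs ↭ ys → Unique xs → x ∈ xs → pos ys x ≡ Σ⟨ xs ⟩ (λ e → ⟦ pos ys e <ᵇ pos ys x ⟧)
pos-count-↭ p u x∈ = trans (pos-count (Unique-resp-↭ p u) (∈-resp-↭ p x∈)) (Σ-↭ _ (↭-sym p))

-- Two linear orders and a marking

-- Two strict linear orders ⊲ (position) and ≺ (value) together with the set of elements whose
-- marking is LR.  Everything is invariant under the symmetry reversing both orders and negating lr,
-- which exchanges left and right switchbacks.
module TwoOrders
  (_⊲_ _≺_ : Rel ℕ 0ℓ)
  (⊲-trans : Transitive _⊲_) (⊲-cmp : Trichotomous _≡_ _⊲_)
  (≺-trans : Transitive _≺_) (≺-cmp : Trichotomous _≡_ _≺_)
  (Member : ℕ → Set)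
  where

  ⊲-asym : ∀ {x y} → x ⊲ y → y ⊲ x → ⊥
  ⊲-asym {x} {y} p q with ⊲-cmp x y
  ... | tri< _ _ ¬q = ¬q q
  ... | tri≈ ¬p _ _ = ¬p p
  ... | tri> ¬p _ _ = ¬p p

  ≺-asym : ∀ {x y} → x ≺ y → y ≺ x → ⊥
  ≺-asym {x} {y} p q with ≺-cmp x y
  ... | tri< _ _ ¬q = ¬q q
  ... | tri≈ ¬p _ _ = ¬p p
  ... | tri> ¬p _ _ = ¬p p

  record Rect (a b c d : ℕ) : Set where
    constructor rect
    field
      a∈ : Member a
      b∈ : Member b
      c∈ : Member c
      d∈ : Member d
      a⊲b : a ⊲ b
      b⊲c : b ⊲ c
      c⊲d : c ⊲ d
      c≺a : c ≺ a
      d≺a : d ≺ a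
      c≺b : c ≺ b
      d≺b : d ≺ b

  -- The left slot of a rec (a,b,c,d) is Slot a b c d, its right slot is Slot c d a b.
  Slot : ℕ → ℕ → ℕ → ℕ → ℕ → Set
  Slot a b c d e = a ⊲ e × e ⊲ b × (c ≺ e × e ≺ d ⊎ d ≺ e × e ≺ c)

  Irregular : ℕ → ℕ → ℕ → ℕ → Set
  Irregular a b c d = b ≺ a ⊎ d ≺ c

  module WithMarking (lr : ℕ → Bool) where

    -- No crossing times fit this pattern. On the L-segment of `z`, `y` is met before `x` because
    -- these two are not inverted, `x` before `w` because `x` is marked RL, and `w` before `y`
    -- because `y` is marked LR.
    record Bad (w x y z : ℕ) : Set where
      constructor bad
      field
        w∈ : Member w
        x∈ : Member x
        y∈ : Member y
        z∈ : Member z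
        w⊲x : w ⊲ x
        x⊲y : x ⊲ y
        y⊲z : y ⊲ z
        z≺x : z ≺ x
        x≺y : x ≺ y
        y≺w : y ≺ w
        rl-x : lr x ≡ false
        lr-y : lr y ≡ true

    module Repair
      (emptyˡ : ∀ {a b c d e} → Rect a b c d → Irregular a b c d → Member e → Slot a b c d e → lr e ≡ true)
      (emptyʳ : ∀ {a b c d e} → Rect a b c d → Irregular a b c d → Member e → Slot c d a b e → lr e ≡ false)
      {w x y z : ℕ} (β : Bad w x y z)
      where
      open Bad β

      -- Otherwise `x` lies strictly between `z` and `c` in value. The rec formed by `w`, `y` and
      -- the pair `c`, `z` is irregular since `y ≺ w`, and `x`, marked RL, would occupy its left
      -- slot.
      after-y : ∀ {c} → Member c → y ⊲ c → c ≺ y → c ≺ x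
      after-y {c} c∈ y⊲c c≺y with ≺-cmp c x
      ... | tri< c≺x _ _ = c≺x
      ... | tri≈ _ refl _ = ⊥-elim (⊲-asym x⊲y y⊲c)
      ... | tri> _ _ x≺c = ⊥-elim (true≢false (helper (⊲-cmp c z)) rl-x)
        where
        z≺y = ≺-trans z≺x x≺y
        z≺w = ≺-trans z≺y y≺w
        c≺w = ≺-trans c≺y y≺w
        w⊲y = ⊲-trans w⊲x x⊲y
        helper : Tri (c ⊲ z) (c ≡ z) (z ⊲ c) → lr x ≡ true
        helper (tri< c⊲z _ _) = emptyˡ (rect w∈ y∈ c∈ z∈ w⊲y y⊲c c⊲z c≺w z≺w c≺y z≺y) (inj₁ y≺w) x∈
                                       (w⊲x , x⊲y , inj₂ (z≺x , x≺c))
        helper (tri≈ _ refl _) = ⊥-elim (≺-asym z≺x x≺c)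
        helper (tri> _ _ z⊲c) = emptyˡ (rect w∈ y∈ z∈ c∈ w⊲y y⊲z z⊲c z≺w c≺w z≺y c≺y) (inj₁ y≺w) x∈
                                       (w⊲x , x⊲y , inj₁ (z≺x , x≺c))

      -- A larger `b` gives the rec (w, b, y, z), irregular since `z ≺ y`, with `x` in its left
      -- slot.
      between-≺y : ∀ {b} → Member b → x ⊲ b → b ⊲ y → b ≺ y
      between-≺y {b} b∈ x⊲b b⊲y with ≺-cmp b y
      ... | tri< b≺y _ _ = b≺y
      ... | tri≈ _ refl _ = ⊥-elim (⊲-asym b⊲y b⊲y)
      ... | tri> _ _ y≺b = ⊥-elim (true≢false
            (emptyˡ (rect w∈ b∈ y∈ z∈ (⊲-trans w⊲x x⊲b) b⊲y y⊲z y≺w (≺-trans z≺y y≺w) y≺b (≺-trans z≺y y≺b))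
                    (inj₂ z≺y) x∈ (w⊲x , x⊲b , inj₂ (z≺x , x≺y)))
            rl-x)
        where z≺y = ≺-trans z≺x x≺y

      -- The mirror image of `between-≺y`: a smaller `c` gives the irregular rec (w, x, c, z) with
      -- `y`, marked LR, in its right slot.
      x≺between : ∀ {c} → Member c → x ⊲ c → c ⊲ y → x ≺ c
      x≺between {c} c∈ x⊲c c⊲y with ≺-cmp x c
      ... | tri< x≺c _ _ = x≺c
      ... | tri≈ _ refl _ = ⊥-elim (⊲-asym x⊲c x⊲c)
      ... | tri> _ _ c≺x = ⊥-elim (true≢false lr-y
            (emptyʳ (rect w∈ x∈ c∈ z∈ w⊲x x⊲c (⊲-trans c⊲y y⊲z) (≺-trans c≺x x≺w) (≺-trans z≺x x≺w) c≺x z≺x)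
                    (inj₁ x≺w) y∈ (c⊲y , y⊲z , inj₂ (x≺y , y≺w))))
        where x≺w = ≺-trans x≺y y≺w

      -- If `b` does not come after `y`, the three bounds above or the emptiness of irregular recs
      -- exclude `x` from the slot. In value, `after-y` leaves nothing behind `y` that could
      -- separate `x` from `y`.
      slot-x⇒y : ∀ {a b c d} → Rect a b c d → Slot a b c d x → Slot a b c d y
      slot-x⇒y {a} {b} {c} {d} ρ σ@(a⊲x , x⊲b , btw) = ⊲-trans a⊲x x⊲y , y⊲b , btw′
        where
        open Rect ρ
        cases : c ≺ x × x ≺ d ⊎ d ≺ x × x ≺ c → y ⊲ b
        cases s with ⊲-cmp y b | s
        ... | tri< p _ _ | _ = p
        ... | tri≈ _ refl _ | inj₁ (c≺x , x≺d) = ⊥-elim (≺-asym x≺d (after-y d∈ (⊲-trans b⊲c c⊲d) d≺b))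
        ... | tri≈ _ refl _ | inj₂ (d≺x , x≺c) = ⊥-elim (≺-asym x≺c (after-y c∈ b⊲c c≺b))
        ... | tri> _ _ b⊲y | inj₂ (d≺x , x≺c) =
          ⊥-elim (true≢false (emptyˡ ρ (inj₂ (≺-trans d≺x x≺c)) x∈ σ) rl-x)
        -- This rec may be regular, so emptiness says nothing; the place of `d` relative to `y`
        -- decides which bound is violated.
        ... | tri> _ _ b⊲y | inj₁ (c≺x , x≺d) = ⊥-elim (helper (⊲-cmp d y))
          where
          d≺y = ≺-trans d≺b (between-≺y b∈ x⊲b b⊲y)
          helper : Tri (d ⊲ y) (d ≡ y) (y ⊲ d) → ⊥
          helper (tri< d⊲y _ _)  = ≺-asym c≺x (x≺between c∈ (⊲-trans x⊲b b⊲c) (⊲-trans c⊲d d⊲y))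
          helper (tri≈ _ refl _) = ≺-asym d≺y d≺y
          helper (tri> _ _ y⊲d)  = ≺-asym x≺d (after-y d∈ y⊲d d≺y)
        y⊲b = cases btw
        above : ∀ {v} → Member v → y ⊲ v → x ≺ v → y ≺ v
        above {v} v∈ y⊲v x≺v with ≺-cmp y v
        ... | tri< p _ _ = p
        ... | tri≈ _ refl _ = ⊥-elim (⊲-asym y⊲v y⊲v)
        ... | tri> _ _ v≺y = ⊥-elim (≺-asym x≺v (after-y v∈ y⊲v v≺y))
        btw′ : c ≺ y × y ≺ d ⊎ d ≺ y × y ≺ c
        btw′ = Sum.map (λ (c≺x , x≺d) → ≺-trans c≺x x≺y , above d∈ (⊲-trans y⊲b (⊲-trans b⊲c c⊲d)) x≺d)
                       (λ (d≺x , x≺c) → ≺-trans d≺x x≺y , above c∈ (⊲-trans y⊲b b⊲c) x≺c) btw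

      slot-y⇒x : ∀ {a b c d} → Rect a b c d → Slot a b c d y → Slot a b c d x
      slot-y⇒x {a} {b} {c} {d} ρ (a⊲y , y⊲b , btw) = a⊲x , ⊲-trans x⊲y y⊲b , btw′
        where
        open Rect ρ
        y⊲c = ⊲-trans y⊲b b⊲c
        y≺a : y ≺ a
        y≺a = [ (λ (_ , y≺d) → ≺-trans y≺d d≺a) , (λ (_ , y≺c) → ≺-trans y≺c c≺a) ]′ btw
        a⊲x : a ⊲ x
        a⊲x with ⊲-cmp a x
        ... | tri< p _ _ = p
        ... | tri≈ _ refl _ = ⊥-elim (≺-asym x≺y y≺a)
        ... | tri> _ _ x⊲a = ⊥-elim (≺-asym y≺a (between-≺y a∈ x⊲a a⊲y))
        btw′ : c ≺ x × x ≺ d ⊎ d ≺ x × x ≺ c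
        btw′ = Sum.map (λ (c≺y , y≺d) → after-y c∈ y⊲c c≺y , ≺-trans x≺y y≺d)
                       (λ (d≺y , y≺c) → after-y d∈ (⊲-trans y⊲c c⊲d) d≺y , ≺-trans x≺y y≺c) btw

    -- b is crossed before b′ by the R-segment of any element inverted with both.
    _⊏_ : ℕ → ℕ → Set
    b ⊏ b′ = (b ⊲ b′ × (b ≺ b′ ⊎ lr b ≡ true)) ⊎ (b′ ⊲ b × b ≺ b′ × lr b′ ≡ false)

    ⊏-asym : ∀ {x y} → x ⊏ y → y ⊏ x → ⊥
    ⊏-asym (inj₁ (p , _)) (inj₁ (q , _)) = ⊲-asym p q
    ⊏-asym (inj₁ (p , inj₁ q)) (inj₂ (_ , r , _)) = ≺-asym q r
    ⊏-asym (inj₁ (p , inj₂ q)) (inj₂ (_ , _ , r)) = true≢false q r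
    ⊏-asym (inj₂ (_ , r , _)) (inj₁ (p , inj₁ q)) = ≺-asym q r
    ⊏-asym (inj₂ (_ , _ , r)) (inj₁ (p , inj₂ q)) = true≢false q r
    ⊏-asym (inj₂ (p , _)) (inj₂ (q , _)) = ⊲-asym p q

    ⊏-total : ∀ {x y} → x ≢ y → x ⊏ y ⊎ y ⊏ x
    ⊏-total {x} {y} x≢y with ⊲-cmp x y | ≺-cmp x y
    ... | tri≈ _ x≡y _ | _ = ⊥-elim (x≢y x≡y)
    ... | _ | tri≈ _ x≡y _ = ⊥-elim (x≢y x≡y)
    ... | tri< p _ _ | tri< q _ _ = inj₁ (inj₁ (p , inj₁ q))
    ... | tri> _ _ p | tri> _ _ q = inj₂ (inj₁ (p , inj₁ q))
    ... | tri< p _ _ | tri> _ _ q with true-or-false (lr x)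
    ...   | inj₁ r = inj₁ (inj₁ (p , inj₂ r))
    ...   | inj₂ r = inj₂ (inj₂ (p , q , r))
    ⊏-total {x} {y} x≢y | tri> _ _ p | tri< q _ _ with true-or-false (lr y)
    ...   | inj₁ r = inj₂ (inj₁ (p , inj₂ r))
    ...   | inj₂ r = inj₁ (inj₂ (p , q , r))

    ⊏-≢ : ∀ {x y} → x ⊏ y → x ≢ y
    ⊏-≢ p refl = ⊏-asym p p

    -- A cyclic triple of ⊏ is a pattern 231 with the first two elements marked RL and LR.
    module OnLine (Q : ℕ → Set)
      (acyclic : ∀ {x y z} → Q x → Q y → Q z → x ⊲ y → y ⊲ z → z ≺ x → x ≺ y → lr x ≡ false → lr y ≡ true → ⊥)
      where

      no-cycle₁ : ∀ {x y z} → Q x → Q y → Q z → x ⊲ y → y ⊲ z → x ⊏ y → y ⊏ z → z ⊏ x → ⊥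
      no-cycle₁ qx qy qz xy yz p q (inj₁ (zx , _)) = ⊲-asym (⊲-trans xy yz) zx
      no-cycle₁ qx qy qz xy yz (inj₂ (yx , _)) q r = ⊲-asym xy yx
      no-cycle₁ qx qy qz xy yz p (inj₂ (zy , _)) r = ⊲-asym yz zy
      no-cycle₁ qx qy qz xy yz (inj₁ (_ , inj₂ lx)) q (inj₂ (_ , _ , rx)) = true≢false lx rx
      no-cycle₁ qx qy qz xy yz (inj₁ (_ , inj₁ x≺y)) (inj₁ (_ , inj₁ y≺z)) (inj₂ (_ , z≺x , rx)) =
        ≺-asym z≺x (≺-trans x≺y y≺z)
      no-cycle₁ qx qy qz xy yz (inj₁ (_ , inj₁ x≺y)) (inj₁ (_ , inj₂ ly)) (inj₂ (_ , z≺x , rx)) =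
        acyclic qx qy qz xy yz z≺x x≺y rx ly

      no-cycle₂ : ∀ {x y z} → x ⊲ y → y ⊲ z → x ⊏ z → z ⊏ y → y ⊏ x → ⊥
      no-cycle₂ xy yz p q (inj₁ (yx , _)) = ⊲-asym xy yx
      no-cycle₂ xy yz p (inj₁ (zy , _)) r = ⊲-asym yz zy
      no-cycle₂ xy yz (inj₂ (zx , _)) q r = ⊲-asym (⊲-trans xy yz) zx
      no-cycle₂ xy yz (inj₁ (_ , inj₂ lx)) q (inj₂ (_ , _ , rx)) = true≢false lx rx
      no-cycle₂ xy yz (inj₁ (_ , inj₁ x≺z)) (inj₂ (_ , z≺y , _)) (inj₂ (_ , y≺x , rx)) =
        ≺-asym x≺z (≺-trans z≺y y≺x)

      -- Since `⊏` is total on distinct elements, a failure of transitivity is a 3-cycle. Rotated to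
      -- start with its first element in position order, it has one of the two orientations excluded
      -- above.
      ⊏-trans : ∀ {x y z} → Q x → Q y → Q z → x ⊏ y → y ⊏ z → x ⊏ z
      ⊏-trans {x} {y} {z} qx qy qz p q with ⊲-cmp x z
      ... | tri≈ _ refl _ = ⊥-elim (⊏-asym p q)
      ... | tri< x⊲z x≢z _ with ⊏-total x≢z
      ...   | inj₁ r = r
      ...   | inj₂ r with ⊲-cmp x y | ⊲-cmp y z
      ...     | tri≈ _ refl _ | _ = ⊥-elim (⊏-≢ p refl)
      ...     | _ | tri≈ _ refl _ = ⊥-elim (⊏-≢ q refl)
      ...     | tri< x⊲y _ _ | tri< y⊲z _ _ = ⊥-elim (no-cycle₁ qx qy qz x⊲y y⊲z p q r)
      ...     | tri< x⊲y _ _ | tri> _ _ z⊲y = ⊥-elim (no-cycle₂ x⊲z z⊲y p q r)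
      ...     | tri> _ _ y⊲x | _            = ⊥-elim (no-cycle₂ y⊲x x⊲z q r p)
      ⊏-trans {x} {y} {z} qx qy qz p q | tri> _ x≢z z⊲x with ⊏-total x≢z
      ...   | inj₁ r = r
      ...   | inj₂ r with ⊲-cmp x y | ⊲-cmp y z
      ...     | tri≈ _ refl _ | _ = ⊥-elim (⊏-≢ p refl)
      ...     | _ | tri≈ _ refl _ = ⊥-elim (⊏-≢ q refl)
      ...     | tri< x⊲y _ _ | _            = ⊥-elim (no-cycle₁ qz qx qy z⊲x x⊲y r p q)
      ...     | tri> _ _ y⊲x | tri< y⊲z _ _ = ⊥-elim (no-cycle₁ qy qz qx y⊲z z⊲x q r p)
      ...     | tri> _ _ y⊲x | tri> _ _ z⊲y = ⊥-elim (no-cycle₂ z⊲y y⊲x r p q)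

-- Positions of crossings

flip-cmp : ∀ {_<_ : ℕ → ℕ → Set} → Trichotomous _≡_ _<_ → Trichotomous _≡_ (flip _<_)
flip-cmp cmp x y with cmp x y
... | tri< a b c = tri> c b a
... | tri≈ a b c = tri≈ c b a
... | tri> a b c = tri< c b a

module Position (π : List ℕ) where

  P : ℕ → ℕ
  P = pos π

  infix 4 _⊲_
  _⊲_ : ℕ → ℕ → Set
  x ⊲ y = P x < P y

  ⊲-cmp : Trichotomous _≡_ _⊲_
  ⊲-cmp x y with <-cmp (P x) (P y)
  ... | tri< a b c = tri< a (b ∘ cong P) c
  ... | tri≈ a b c = tri≈ a (pos-injective π b) c
  ... | tri> a b c = tri> a (b ∘ cong P) c

  open TwoOrders _⊲_ _<_ <-trans ⊲-cmp <-trans <-cmp (_∈ π) public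

  ⊲⇒≢ : ∀ {x y} → x ⊲ y → x ≢ y
  ⊲⇒≢ p refl = <-irrefl refl p

  ⊲⇒∈ : ∀ {a b} → a ⊲ b → b ∈ π → a ∈ π
  ⊲⇒∈ = pos<⇒∈ π

  record Inv (a b : ℕ) : Set where
    constructor inv
    field
      earlier : a ⊲ b
      greater : b < a
      member  : b ∈ π

  -- Only the ascending half of `Slot`: the descending half is `sl a b d c`, so that one of the two
  -- is always empty and no case distinction enters the definition of the counts.
  sl : ℕ → ℕ → ℕ → ℕ → ℕ → Bool
  sl a b c d e = ((P a <ᵇ P e) ∧ (P e <ᵇ P b)) ∧ ((c <ᵇ e) ∧ (e <ᵇ d))

  sl-inside : ∀ {a b e} c d → a ⊲ e → e ⊲ b → sl a b c d e ≡ ((c <ᵇ e) ∧ (e <ᵇ d))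
  sl-inside c d p q rewrite <⇒<ᵇ≡true p | <⇒<ᵇ≡true q = refl

  sl-left : ∀ {a e} b c d → P e ≤ P a → sl a b c d e ≡ false
  sl-left b c d p rewrite ≤⇒<ᵇ≡false p = refl

  sl-right : ∀ {b e} a c d → P b ≤ P e → sl a b c d e ≡ false
  sl-right {b} {e} a c d p rewrite ≤⇒<ᵇ≡false p | ∧-zeroʳ (P a <ᵇ P e) = refl

  sl⁻ : ∀ {a b c d e} → T (sl a b c d e) → a ⊲ e × e ⊲ b × c < e × e < d
  sl⁻ {a} {b} {c} {d} {e} t
    with t₁ , t₂ ← T-∧⁻ {(P a <ᵇ P e) ∧ (P e <ᵇ P b)} t
    with p , q ← T-∧⁻ {P a <ᵇ P e} t₁
    with r , s ← T-∧⁻ {c <ᵇ e} t₂ = <ᵇ⇒< _ _ p , <ᵇ⇒< _ _ q , <ᵇ⇒< _ _ r , <ᵇ⇒< _ _ s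

  sl⁺ : ∀ {a b c d e} → a ⊲ e → e ⊲ b → c < e → e < d → T (sl a b c d e)
  sl⁺ {a} {b} {c} {d} {e} p q r s =
    ∧-T {(P a <ᵇ P e) ∧ (P e <ᵇ P b)} (∧-T {P a <ᵇ P e} (<⇒<ᵇ p) (<⇒<ᵇ q)) (∧-T {c <ᵇ e} (<⇒<ᵇ r) (<⇒<ᵇ s))

  sl-descending : ∀ {a b c d e} → d ≤ c → sl a b c d e ≡ false
  sl-descending d≤c = ¬T⇒≡ (λ t → let _ , _ , c<e , e<d = sl⁻ t in <⇒≱ (<-trans c<e e<d) d≤c)

  module Marked (lr : ℕ → Bool) where

    open WithMarking lr public

    -- ℓ a b e says that e is to the left of the crossing of a and b, for an inversion (a , b).
    ℓ : ℕ → ℕ → ℕ → Bool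
    ℓ a b e = ((P e <ᵇ P a) ∧ ((e <ᵇ a) ∨ not (lr a)))
            ∨ ((((P a <ᵇ P e) ∧ (P e <ᵇ P b)) ∧ ((e <ᵇ b) ∨ ((e <ᵇ a) ∧ lr e)))
            ∨ ((P b <ᵇ P e) ∧ ((e <ᵇ b) ∧ not (lr b))))

    p : ℕ → ℕ → ℕ
    p a b = Σ⟨ π ⟩ (λ e → ⟦ ℓ a b e ⟧)

    ℓ-before : ∀ {a b e} → e ⊲ a → a ⊲ b → ℓ a b e ≡ ((e <ᵇ a) ∨ not (lr a))
    ℓ-before {a} {b} {e} e⊲a a⊲b
      rewrite <⇒<ᵇ≡true e⊲a | ≤⇒<ᵇ≡false (<⇒≤ e⊲a) | ≤⇒<ᵇ≡false (<⇒≤ (<-trans e⊲a a⊲b)) = ∨-identityʳ _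

    ℓ-here : ∀ {a b} → a ⊲ b → ℓ a b a ≡ false
    ℓ-here {a} {b} a⊲b rewrite ≤⇒<ᵇ≡false (≤-refl {P a}) | ≤⇒<ᵇ≡false (<⇒≤ a⊲b) = refl

    ℓ-between : ∀ {a b e} → a ⊲ e → e ⊲ b → ℓ a b e ≡ ((e <ᵇ b) ∨ ((e <ᵇ a) ∧ lr e))
    ℓ-between a⊲e e⊲b
      rewrite ≤⇒<ᵇ≡false (<⇒≤ a⊲e) | <⇒<ᵇ≡true a⊲e | <⇒<ᵇ≡true e⊲b | ≤⇒<ᵇ≡false (<⇒≤ e⊲b) = ∨-identityʳ _

    ℓ-there : ∀ {a b} → a ⊲ b → ℓ a b b ≡ false
    ℓ-there {a} {b} a⊲b rewrite ≤⇒<ᵇ≡false (≤-refl {P b}) | ≤⇒<ᵇ≡false (<⇒≤ a⊲b) | ∧-zeroʳ (P a <ᵇ P b) = refl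

    ℓ-after : ∀ {a b e} → a ⊲ b → b ⊲ e → ℓ a b e ≡ ((e <ᵇ b) ∧ not (lr b))
    ℓ-after {a} {b} {e} a⊲b b⊲e
      rewrite ≤⇒<ᵇ≡false (<⇒≤ (<-trans a⊲b b⊲e)) | ≤⇒<ᵇ≡false (<⇒≤ b⊲e) | <⇒<ᵇ≡true b⊲e
            | ∧-zeroʳ (P a <ᵇ P e) = refl

    -- For a regular rec (a,b,c,d), Λ a b c d counts the left switchbacks and Ρ c d a b the right ones.
    Λ Ρ : ℕ → ℕ → ℕ → ℕ → ℕ
    Λ a b c d = Σ⟨ π ⟩ (λ e → ⟦ sl a b c d e ∧ not (lr e) ⟧)
    Ρ a b c d = Σ⟨ π ⟩ (λ e → ⟦ sl a b c d e ∧ lr e ⟧)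

    -- Both value orders of each pair appear, so that one identity covers regular and irregular recs
    -- alike.
    RecIdentity : ℕ → ℕ → ℕ → ℕ → ℕ → Set
    RecIdentity a b c d e =
      (⟦ ℓ a c e ⟧ + ⟦ ℓ b d e ⟧) + (⟦ sl a b c d e ∧ not (lr e) ⟧ + ⟦ sl c d b a e ∧ lr e ⟧) ≡
      (⟦ ℓ a d e ⟧ + ⟦ ℓ b c e ⟧) + (⟦ sl c d a b e ∧ lr e ⟧ + ⟦ sl a b d c e ∧ not (lr e) ⟧)

    between-ab : ∀ {a b c d e} → Rect a b c d → a ⊲ e → e ⊲ b →
      ⟦ (e <ᵇ c) ∨ ((e <ᵇ a) ∧ lr e) ⟧ + ⟦ ((c <ᵇ e) ∧ (e <ᵇ d)) ∧ not (lr e) ⟧ ≡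
      ⟦ (e <ᵇ d) ∨ ((e <ᵇ a) ∧ lr e) ⟧ + ⟦ ((d <ᵇ e) ∧ (e <ᵇ c)) ∧ not (lr e) ⟧
    between-ab {a} {b} {c} {d} {e} ρ a⊲e e⊲b with <-cmp e c | <-cmp e d
    ... | tri≈ _ refl _ | _ = ⊥-elim (<-asym e⊲b (Rect.b⊲c ρ))
    ... | _ | tri≈ _ refl _ = ⊥-elim (<-asym e⊲b (<-trans (Rect.b⊲c ρ) (Rect.c⊲d ρ)))
    ... | tri< e<c _ _ | tri< e<d _ _
      rewrite <⇒<ᵇ≡true e<c | ≤⇒<ᵇ≡false (<⇒≤ e<c) | <⇒<ᵇ≡true e<d | ≤⇒<ᵇ≡false (<⇒≤ e<d) = refl
    ... | tri> _ _ c<e | tri> _ _ d<e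
      rewrite <⇒<ᵇ≡true c<e | ≤⇒<ᵇ≡false (<⇒≤ c<e) | <⇒<ᵇ≡true d<e | ≤⇒<ᵇ≡false (<⇒≤ d<e) = refl
    ... | tri< e<c _ _ | tri> _ _ d<e
      rewrite <⇒<ᵇ≡true e<c | ≤⇒<ᵇ≡false (<⇒≤ e<c) | <⇒<ᵇ≡true d<e | ≤⇒<ᵇ≡false (<⇒≤ d<e)
            | <⇒<ᵇ≡true (<-trans e<c (Rect.c≺a ρ)) with lr e
    ...   | true  = refl
    ...   | false = refl
    between-ab {a} {b} {c} {d} {e} ρ a⊲e e⊲b | tri> _ _ c<e | tri< e<d _ _
      rewrite <⇒<ᵇ≡true c<e | ≤⇒<ᵇ≡false (<⇒≤ c<e) | <⇒<ᵇ≡true e<d | ≤⇒<ᵇ≡false (<⇒≤ e<d)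
            | <⇒<ᵇ≡true (<-trans e<d (Rect.d≺a ρ)) with lr e
    ...   | true  = refl
    ...   | false = refl

    -- If `e` is below neither `c` nor `d`, the sides agree term by term. If it is below one of
    -- them, it is below both `a` and `b`, and the two terms merely change places.
    between-bc : ∀ {a b c d e} → Rect a b c d →
      ⟦ (e <ᵇ c) ∨ ((e <ᵇ a) ∧ lr e) ⟧ + ⟦ (e <ᵇ d) ∨ ((e <ᵇ b) ∧ lr e) ⟧ ≡
      ⟦ (e <ᵇ d) ∨ ((e <ᵇ a) ∧ lr e) ⟧ + ⟦ (e <ᵇ c) ∨ ((e <ᵇ b) ∧ lr e) ⟧
    between-bc {a} {b} {c} {d} {e} ρ with e <? c | e <? d
    ... | no e≮c | no e≮d
      rewrite ≤⇒<ᵇ≡false (≮⇒≥ e≮c) | ≤⇒<ᵇ≡false (≮⇒≥ e≮d) = refl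
    ... | yes e<c | _
      rewrite <⇒<ᵇ≡true e<c | <⇒<ᵇ≡true (<-trans e<c (Rect.c≺a ρ)) | <⇒<ᵇ≡true (<-trans e<c (Rect.c≺b ρ)) =
        +-comm 1 ⟦ (e <ᵇ d) ∨ lr e ⟧
    ... | no e≮c | yes e<d
      rewrite <⇒<ᵇ≡true e<d | ≤⇒<ᵇ≡false (≮⇒≥ e≮c)
            | <⇒<ᵇ≡true (<-trans e<d (Rect.d≺a ρ)) | <⇒<ᵇ≡true (<-trans e<d (Rect.d≺b ρ)) = +-comm _ 1

    between-cd : ∀ {a b c d e} → Rect a b c d → c ⊲ e → e ⊲ d →
      ⟦ (e <ᵇ d) ∨ ((e <ᵇ b) ∧ lr e) ⟧ + ⟦ ((b <ᵇ e) ∧ (e <ᵇ a)) ∧ lr e ⟧ ≡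
      ⟦ (e <ᵇ d) ∨ ((e <ᵇ a) ∧ lr e) ⟧ + ⟦ ((a <ᵇ e) ∧ (e <ᵇ b)) ∧ lr e ⟧
    between-cd {a} {b} {c} {d} {e} ρ c⊲e e⊲d with lr e
    ... | false rewrite ∧-zeroʳ (e <ᵇ a) | ∧-zeroʳ (e <ᵇ b)
                      | ∧-zeroʳ ((b <ᵇ e) ∧ (e <ᵇ a)) | ∧-zeroʳ ((a <ᵇ e) ∧ (e <ᵇ b)) = refl
    ... | true with <-cmp e a | <-cmp e b
    ...   | tri≈ _ refl _ | _ = ⊥-elim (<-asym c⊲e (<-trans (Rect.a⊲b ρ) (Rect.b⊲c ρ)))
    ...   | _ | tri≈ _ refl _ = ⊥-elim (<-asym c⊲e (Rect.b⊲c ρ))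
    ...   | tri< e<a _ _ | tri< e<b _ _
      rewrite <⇒<ᵇ≡true e<a | ≤⇒<ᵇ≡false (<⇒≤ e<a) | <⇒<ᵇ≡true e<b | ≤⇒<ᵇ≡false (<⇒≤ e<b) = refl
    ...   | tri> _ _ a<e | tri> _ _ b<e
      rewrite <⇒<ᵇ≡true a<e | ≤⇒<ᵇ≡false (<⇒≤ a<e) | <⇒<ᵇ≡true b<e | ≤⇒<ᵇ≡false (<⇒≤ b<e) = refl
    ...   | tri< e<a _ _ | tri> _ _ b<e
      rewrite <⇒<ᵇ≡true e<a | ≤⇒<ᵇ≡false (<⇒≤ e<a) | <⇒<ᵇ≡true b<e | ≤⇒<ᵇ≡false (<⇒≤ b<e)
            | ≤⇒<ᵇ≡false (<⇒≤ (<-trans (Rect.d≺b ρ) b<e)) = refl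
    ...   | tri> _ _ a<e | tri< e<b _ _
      rewrite <⇒<ᵇ≡true a<e | ≤⇒<ᵇ≡false (<⇒≤ a<e) | <⇒<ᵇ≡true e<b | ≤⇒<ᵇ≡false (<⇒≤ e<b)
            | ≤⇒<ᵇ≡false (<⇒≤ (<-trans (Rect.d≺a ρ) a<e)) = refl

    arith₁ : ∀ y x s x′ s′ → x + s ≡ x′ + s′ → (x + y) + (s + 0) ≡ (x′ + y) + (0 + s′)
    arith₁ y x s x′ s′ eq = trans (lemma x y s) (trans (cong (_+ y) eq) (sym (lemma′ x′ y s′)))
      where
      lemma : ∀ x y s → (x + y) + (s + 0) ≡ (x + s) + y
      lemma = solve-∀
      lemma′ : ∀ x y s → (x + y) + (0 + s) ≡ (x + s) + y
      lemma′ = solve-∀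

    arith₂ : ∀ y x s x′ s′ → x + s ≡ x′ + s′ → (y + x) + (0 + s) ≡ (x′ + y) + (s′ + 0)
    arith₂ y x s x′ s′ eq = trans (lemma x y s) (trans (cong (_+ y) eq) (sym (lemma′ x′ y s′)))
      where
      lemma : ∀ x y s → (y + x) + (0 + s) ≡ (x + s) + y
      lemma = solve-∀
      lemma′ : ∀ x y s → (x + y) + (s + 0) ≡ (x + s) + y
      lemma′ = solve-∀

    -- Before `a` each `ℓ` depends only on the R-element and behind `d` only on the L-element, so
    -- the terms match in pairs. Between `a` and `b` replacing `c` by `d` matters just when `e` is
    -- in the left slot and marked RL; between `c` and `d` replacing `b` by `a` matters just when it
    -- is in the right slot and marked LR.
    rec-identity-at : ∀ {a b c d} → Rect a b c d → ∀ e → RecIdentity a b c d e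
    rec-identity-at {a} {b} {c} {d} ρ e = locate (⊲-cmp e a) (⊲-cmp e b) (⊲-cmp e c) (⊲-cmp e d)
      where
      open Rect ρ
      a⊲c = <-trans a⊲b b⊲c
      a⊲d = <-trans a⊲c c⊲d
      b⊲d = <-trans b⊲c c⊲d
      Tri⊲ : ℕ → ℕ → Set
      Tri⊲ x y = Tri (x ⊲ y) (x ≡ y) (y ⊲ x)
      locate : Tri⊲ e a → Tri⊲ e b → Tri⊲ e c → Tri⊲ e d → RecIdentity a b c d e
      locate (tri< e⊲a _ _) _ _ _
        rewrite ℓ-before e⊲a a⊲c | ℓ-before e⊲a a⊲d
              | ℓ-before (<-trans e⊲a a⊲b) b⊲c | ℓ-before (<-trans e⊲a a⊲b) b⊲d
              | sl-left b c d (<⇒≤ e⊲a) | sl-left b d c (<⇒≤ e⊲a)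
              | sl-left d a b (<⇒≤ (<-trans e⊲a a⊲c)) | sl-left d b a (<⇒≤ (<-trans e⊲a a⊲c)) = refl
      locate (tri≈ _ refl _) _ _ _
        rewrite ℓ-here a⊲c | ℓ-here a⊲d | ℓ-before a⊲b b⊲c | ℓ-before a⊲b b⊲d
              | sl-left {a} b c d ≤-refl | sl-left {a} b d c ≤-refl
              | sl-left d a b (<⇒≤ a⊲c) | sl-left d b a (<⇒≤ a⊲c) = refl
      locate (tri> _ _ a⊲e) (tri< e⊲b _ _) _ _
        rewrite ℓ-between a⊲e (<-trans e⊲b b⊲c) | ℓ-between a⊲e (<-trans e⊲b b⊲d)
              | ℓ-before e⊲b b⊲c | ℓ-before e⊲b b⊲d
              | sl-inside c d a⊲e e⊲b | sl-inside d c a⊲e e⊲b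
              | sl-left d a b (<⇒≤ (<-trans e⊲b b⊲c)) | sl-left d b a (<⇒≤ (<-trans e⊲b b⊲c)) =
          arith₁ ⟦ (e <ᵇ b) ∨ not (lr b) ⟧ ⟦ (e <ᵇ c) ∨ ((e <ᵇ a) ∧ lr e) ⟧ _ ⟦ (e <ᵇ d) ∨ ((e <ᵇ a) ∧ lr e) ⟧ _
            (between-ab ρ a⊲e e⊲b)
      locate _ (tri≈ _ refl _) _ _
        rewrite ℓ-between a⊲b b⊲c | ℓ-between a⊲b b⊲d | ℓ-here b⊲c | ℓ-here b⊲d
              | sl-right {b} a c d ≤-refl | sl-right {b} a d c ≤-refl
              | sl-left d a b (<⇒≤ b⊲c) | sl-left d b a (<⇒≤ b⊲c)
              | ≤⇒<ᵇ≡false (<⇒≤ c≺b) | ≤⇒<ᵇ≡false (<⇒≤ d≺b) = refl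
      locate _ (tri> _ _ b⊲e) (tri< e⊲c _ _) _
        rewrite ℓ-between (<-trans a⊲b b⊲e) e⊲c | ℓ-between (<-trans a⊲b b⊲e) (<-trans e⊲c c⊲d)
              | ℓ-between b⊲e e⊲c | ℓ-between b⊲e (<-trans e⊲c c⊲d)
              | sl-right a c d (<⇒≤ b⊲e) | sl-right a d c (<⇒≤ b⊲e)
              | sl-left d a b (<⇒≤ e⊲c) | sl-left d b a (<⇒≤ e⊲c) = cong (_+ 0) (between-bc {e = e} ρ)
      locate _ _ (tri≈ _ refl _) _
        rewrite ℓ-there a⊲c | ℓ-between a⊲c c⊲d | ℓ-there b⊲c | ℓ-between b⊲c c⊲d
              | sl-right a c d (<⇒≤ b⊲c) | sl-right a d c (<⇒≤ b⊲c)
              | sl-left {c} d a b ≤-refl | sl-left {c} d b a ≤-refl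
              | <⇒<ᵇ≡true c≺a | <⇒<ᵇ≡true c≺b = cong (_+ 0) (+-comm 0 _)
      locate _ _ (tri> _ _ c⊲e) (tri< e⊲d _ _)
        rewrite ℓ-after a⊲c c⊲e | ℓ-between (<-trans a⊲c c⊲e) e⊲d
              | ℓ-after b⊲c c⊲e | ℓ-between (<-trans b⊲c c⊲e) e⊲d
              | sl-right a c d (<⇒≤ (<-trans b⊲c c⊲e)) | sl-right a d c (<⇒≤ (<-trans b⊲c c⊲e))
              | sl-inside a b c⊲e e⊲d | sl-inside b a c⊲e e⊲d =
          arith₂ ⟦ (e <ᵇ c) ∧ not (lr c) ⟧ ⟦ (e <ᵇ d) ∨ ((e <ᵇ b) ∧ lr e) ⟧ _ ⟦ (e <ᵇ d) ∨ ((e <ᵇ a) ∧ lr e) ⟧ _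
            (between-cd ρ c⊲e e⊲d)
      locate _ _ _ (tri≈ _ refl _)
        rewrite ℓ-after a⊲c c⊲d | ℓ-there a⊲d | ℓ-after b⊲c c⊲d | ℓ-there b⊲d
              | sl-right a c d (<⇒≤ b⊲d) | sl-right a d c (<⇒≤ b⊲d)
              | sl-right {d} c a b ≤-refl | sl-right {d} c b a ≤-refl = cong (_+ 0) (+-comm _ 0)
      locate _ _ _ (tri> _ _ d⊲e)
        rewrite ℓ-after a⊲c (<-trans c⊲d d⊲e) | ℓ-after a⊲d d⊲e
              | ℓ-after b⊲c (<-trans c⊲d d⊲e) | ℓ-after b⊲d d⊲e
              | sl-right a c d (<⇒≤ (<-trans b⊲d d⊲e)) | sl-right a d c (<⇒≤ (<-trans b⊲d d⊲e))
              | sl-right c a b (<⇒≤ d⊲e) | sl-right c b a (<⇒≤ d⊲e) = cong (_+ 0) (+-comm ⟦ (e <ᵇ c) ∧ not (lr c) ⟧ _)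

    rec-identity : ∀ {a b c d} → Rect a b c d →
      (p a c + p b d) + (Λ a b c d + Ρ c d b a) ≡ (p a d + p b c) + (Ρ c d a b + Λ a b d c)
    rec-identity {a} {b} {c} {d} ρ = begin
      (p a c + p b d) + (Λ a b c d + Ρ c d b a) ≡⟨ Σ-+⁴ _ _ _ _ ⟨
      Σ⟨ π ⟩ _                                  ≡⟨ Σ-cong π (λ e _ → rec-identity-at ρ e) ⟩
      Σ⟨ π ⟩ _                                  ≡⟨ Σ-+⁴ _ _ _ _ ⟩
      (p a d + p b c) + (Ρ c d a b + Λ a b d c) ∎
      where
      open ≡-Reasoning
      Σ-+⁴ : ∀ f g h k → Σ⟨ π ⟩ (λ e → (f e + g e) + (h e + k e)) ≡ (Σ⟨ π ⟩ f + Σ⟨ π ⟩ g) + (Σ⟨ π ⟩ h + Σ⟨ π ⟩ k)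
      Σ-+⁴ f g h k = trans (Σ-+ _ _ π) (cong₂ _+_ (Σ-+ f g π) (Σ-+ h k π))

    Λ-descending : ∀ {a b c d} → d ≤ c → Λ a b c d ≡ 0
    Λ-descending {a} {b} d≤c = Σ-zero π (λ e _ → cong (λ s → ⟦ s ∧ not (lr e) ⟧) (sl-descending {a} {b} d≤c))

    Ρ-descending : ∀ {a b c d} → d ≤ c → Ρ a b c d ≡ 0
    Ρ-descending {a} {b} d≤c = Σ-zero π (λ e _ → cong (λ s → ⟦ s ∧ lr e ⟧) (sl-descending {a} {b} d≤c))

    record Balanced : Set where
      field
        regular : ∀ {a b c d} → Rect a b c d → a < b → c < d → Λ a b c d ≡ Ρ c d a b
        emptyˡ : ∀ {a b c d e} → Rect a b c d → Irregular a b c d → e ∈ π → Slot a b c d e → lr e ≡ true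
        emptyʳ : ∀ {a b c d e} → Rect a b c d → Irregular a b c d → e ∈ π → Slot c d a b e → lr e ≡ false

    module _ (bal : Balanced) where
      open Balanced bal

      additive : ∀ {a b c d} → Rect a b c d → p a c + p b d ≡ p a d + p b c
      additive {a} {b} {c} {d} ρ = by-cases (<-cmp a b) (<-cmp c d)
        where
        identity = rec-identity ρ
        cancel : ∀ {u v} s {s′} → s ≡ s′ → u + s ≡ v + s′ → u ≡ v
        cancel s refl eq = +-cancelʳ-≡ s _ _ eq
        irregular : Irregular a b c d → p a c + p b d ≡ p a d + p b c
        irregular i = cancel (Λ a b c d + Ρ c d b a)
          (trans (cong₂ _+_ Λ₁ Ρ₁) (sym (cong₂ _+_ Ρ₂ Λ₂))) identity
          where
          vanish : ∀ {s b} → (T s → b ≡ false) → ⟦ s ∧ b ⟧ ≡ 0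
          vanish {false} f = refl
          vanish {true}  f = cong ⟦_⟧ (f _)
          Λ₁ : Λ a b c d ≡ 0
          Λ₁ = Σ-zero π (λ e e∈ → vanish (λ t → let q , r , s , u = sl⁻ {a} {b} {c} {d} t in
                 cong not (emptyˡ ρ i e∈ (q , r , inj₁ (s , u)))))
          Λ₂ : Λ a b d c ≡ 0
          Λ₂ = Σ-zero π (λ e e∈ → vanish (λ t → let q , r , s , u = sl⁻ {a} {b} {d} {c} t in
                 cong not (emptyˡ ρ i e∈ (q , r , inj₂ (s , u)))))
          Ρ₁ : Ρ c d b a ≡ 0
          Ρ₁ = Σ-zero π (λ e e∈ → vanish (λ t → let q , r , s , u = sl⁻ {c} {d} {b} {a} t in
                 emptyʳ ρ i e∈ (q , r , inj₂ (s , u))))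
          Ρ₂ : Ρ c d a b ≡ 0
          Ρ₂ = Σ-zero π (λ e e∈ → vanish (λ t → let q , r , s , u = sl⁻ {c} {d} {a} {b} t in
                 emptyʳ ρ i e∈ (q , r , inj₁ (s , u))))
        by-cases : Tri (a < b) (a ≡ b) (b < a) → Tri (c < d) (c ≡ d) (d < c) → p a c + p b d ≡ p a d + p b c
        by-cases (tri≈ _ refl _) _ = ⊥-elim (<-irrefl refl (Rect.a⊲b ρ))
        by-cases _ (tri≈ _ refl _) = ⊥-elim (<-irrefl refl (Rect.c⊲d ρ))
        by-cases (tri> _ _ b<a) _ = irregular (inj₁ b<a)
        by-cases _ (tri> _ _ d<c) = irregular (inj₂ d<c)
        by-cases (tri< a<b _ _) (tri< c<d _ _) = cancel (Λ a b c d + Ρ c d b a)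
          (cong₂ _+_ (regular ρ a<b c<d) (trans (Ρ-descending {c} {d} (<⇒≤ a<b)) (sym (Λ-descending {a} {b} (<⇒≤ c<d))))) identity

-- Removing bad patterns

any∈? : ∀ {A : ℕ → Set} → (∀ x → Dec (A x)) → ∀ xs → Dec (∃ λ x → x ∈ xs × A x)
any∈? A? xs = map′ find (λ (x , x∈ , a) → lose x∈ a) (any? A? xs)

module GoodMarking (π : List ℕ) (unique : Unique π) where
  open Position π
  open Marked

  swapped : (ℕ → Bool) → ℕ → ℕ → ℕ → Bool
  swapped lr x y e = if does (e ≟ x) then true else (if does (e ≟ y) then false else lr e)

  swapped-x : ∀ lr x y → swapped lr x y x ≡ true
  swapped-x lr x y rewrite dec-true (x ≟ x) refl = refl

  swapped-y : ∀ lr {x y} → x ≢ y → swapped lr x y y ≡ false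
  swapped-y lr {x} {y} x≢y rewrite dec-false (y ≟ x) (x≢y ∘ sym) | dec-true (y ≟ y) refl = refl

  swapped-other : ∀ lr {x y e} → e ≢ x → e ≢ y → swapped lr x y e ≡ lr e
  swapped-other lr {x} {y} {e} e≢x e≢y rewrite dec-false (e ≟ x) e≢x | dec-false (e ≟ y) e≢y = refl

  module Swap {lr : ℕ → Bool} (bal : Balanced lr) {w x y z : ℕ} (β : Bad lr w x y z) where
    open Balanced bal
    open Bad lr β

    lr′ : ℕ → Bool
    lr′ = swapped lr x y

    x≢y : x ≢ y
    x≢y = <⇒≢ x≺y

    -- The reversal maps 4231 to itself, exchanging 2 with 3 and RL with LR. So the repair lemmas,
    -- applied to `z`, `y`, `x`, `w`, yield the statements about right slots.
    module Mirror = TwoOrders (flip _⊲_) (flip _<_) (flip <-trans) (flip-cmp ⊲-cmp) (flip <-trans) (flip-cmp <-cmp) (_∈ π)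

    mirror-rect : ∀ {a b c d} → Rect a b c d → Mirror.Rect d c b a
    mirror-rect (rect a∈ b∈ c∈ d∈ p q r s t u v) = Mirror.rect d∈ c∈ b∈ a∈ r q p v t u s

    unmirror-rect : ∀ {a b c d} → Mirror.Rect d c b a → Rect a b c d
    unmirror-rect (Mirror.rect d∈ c∈ b∈ a∈ r q p v t u s) = rect a∈ b∈ c∈ d∈ p q r s t u v

    mirror-slot : ∀ {a b c d e} → Slot c d a b e → Mirror.Slot d c b a e
    mirror-slot (p , q , r) = q , p , Sum.map (λ (s , t) → t , s) (λ (s , t) → t , s) r

    unmirror-slot : ∀ {a b c d e} → Mirror.Slot d c b a e → Slot c d a b e
    unmirror-slot (p , q , r) = q , p , Sum.map (λ (s , t) → t , s) (λ (s , t) → t , s) r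

    module Original = Repair lr emptyˡ emptyʳ β

    module Mirrored = Mirror.WithMarking.Repair (not ∘ lr)
      (λ ρ i e∈ σ → cong not (emptyʳ (unmirror-rect ρ) (Sum.swap i) e∈ (unmirror-slot σ)))
      (λ ρ i e∈ σ → cong not (emptyˡ (unmirror-rect ρ) (Sum.swap i) e∈ (unmirror-slot σ)))
      (Mirror.WithMarking.bad z∈ y∈ x∈ w∈ y⊲z x⊲y w⊲x y≺w x≺y z≺x (cong not lr-y) (cong not rl-x))

    slotʳ-y⇒x : ∀ {a b c d} → Rect a b c d → Slot c d a b y → Slot c d a b x
    slotʳ-y⇒x ρ σ = unmirror-slot (Mirrored.slot-x⇒y (mirror-rect ρ) (mirror-slot σ))

    slotʳ-x⇒y : ∀ {a b c d} → Rect a b c d → Slot c d a b x → Slot c d a b y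
    slotʳ-x⇒y ρ σ = unmirror-slot (Mirrored.slot-y⇒x (mirror-rect ρ) (mirror-slot σ))

    slot⇒sl : ∀ {a b c d e} → c < d → Slot a b c d e → T (sl a b c d e)
    slot⇒sl {a} {b} {c} {d} {e} c<d (p , q , inj₁ (r , s)) = sl⁺ {a} {b} {c} {d} {e} p q r s
    slot⇒sl c<d (p , q , inj₂ (r , s)) = ⊥-elim (<-asym c<d (<-trans r s))

    sl⇒slot : ∀ {a b c d e} → T (sl a b c d e) → Slot a b c d e
    sl⇒slot {a} {b} {c} {d} t with p , q , r , s ← sl⁻ {a} {b} {c} {d} t = p , q , inj₁ (r , s)

    sl-x≡y : ∀ {a b c d} → Rect a b c d → c < d → sl a b c d x ≡ sl a b c d y
    sl-x≡y {a} {b} {c} {d} ρ c<d = T-bool-ext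
      (λ t → slot⇒sl c<d (Original.slot-x⇒y ρ (sl⇒slot {a} {b} {c} {d} t)))
      (λ t → slot⇒sl c<d (Original.slot-y⇒x ρ (sl⇒slot {a} {b} {c} {d} t)))

    slʳ-x≡y : ∀ {a b c d} → Rect a b c d → a < b → sl c d a b x ≡ sl c d a b y
    slʳ-x≡y {a} {b} {c} {d} ρ a<b = T-bool-ext
      (λ t → slot⇒sl a<b (slotʳ-x⇒y ρ (sl⇒slot {c} {d} {a} {b} t)))
      (λ t → slot⇒sl a<b (slotʳ-y⇒x ρ (sl⇒slot {c} {d} {a} {b} t)))

    Σ-unchanged : ∀ (s : ℕ → Bool) (h : Bool → Bool) → s x ≡ s y →
      Σ⟨ π ⟩ (λ e → ⟦ s e ∧ h (lr′ e) ⟧) ≡ Σ⟨ π ⟩ (λ e → ⟦ s e ∧ h (lr e) ⟧)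
    Σ-unchanged s h sx≡sy = +-cancelʳ-≡ (f x + f y) _ _
      (trans (Σ-update f′ f unique x∈ y∈ x≢y (λ e e≢x e≢y → cong (λ b → ⟦ s e ∧ h b ⟧) (swapped-other lr e≢x e≢y)))
             (cong (Σ⟨ π ⟩ f +_) swap-values))
      where
      f f′ : ℕ → ℕ
      f e = ⟦ s e ∧ h (lr e) ⟧
      f′ e = ⟦ s e ∧ h (lr′ e) ⟧
      swap-values : f′ x + f′ y ≡ f x + f y
      swap-values rewrite swapped-x lr x y | swapped-y lr x≢y | rl-x | lr-y | sx≡sy = +-comm ⟦ s y ∧ h true ⟧ _

    balanced′ : Balanced lr′
    balanced′ = record { regular = regular′ ; emptyˡ = emptyˡ′ ; emptyʳ = emptyʳ′ }
      where
      regular′ : ∀ {a b c d} → Rect a b c d → a < b → c < d → Λ lr′ a b c d ≡ Ρ lr′ c d a b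
      regular′ {a} {b} {c} {d} ρ a<b c<d = trans (Σ-unchanged (sl a b c d) not (sl-x≡y ρ c<d))
        (trans (regular ρ a<b c<d) (sym (Σ-unchanged (sl c d a b) (λ b → b) (slʳ-x≡y ρ a<b))))
      emptyˡ′ : ∀ {a b c d e} → Rect a b c d → Irregular a b c d → e ∈ π → Slot a b c d e → lr′ e ≡ true
      emptyˡ′ {e = e} ρ i e∈ σ with e ≟ x | e ≟ y
      ... | yes refl | _ = swapped-x lr x y
      -- `y` cannot be in this slot at all: it would bring `x` along, whose old mark RL is forbidden
      -- there.
      ... | no _  | yes refl = ⊥-elim (true≢false (emptyˡ ρ i x∈ (Original.slot-y⇒x ρ σ)) rl-x)
      ... | no e≢x | no e≢y = trans (swapped-other lr e≢x e≢y) (emptyˡ ρ i e∈ σ)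
      emptyʳ′ : ∀ {a b c d e} → Rect a b c d → Irregular a b c d → e ∈ π → Slot c d a b e → lr′ e ≡ false
      emptyʳ′ {e = e} ρ i e∈ σ with e ≟ x | e ≟ y
      ... | yes refl | _ = ⊥-elim (true≢false lr-y (emptyʳ ρ i y∈ (slotʳ-x⇒y ρ σ)))
      ... | no _  | yes refl = swapped-y lr x≢y
      ... | no e≢x | no e≢y = trans (swapped-other lr e≢x e≢y) (emptyʳ ρ i e∈ σ)

  -- A termination measure: an exchange hands the mark LR from `y` down to the smaller `x`.
  weight : (ℕ → Bool) → ℕ
  weight lr = Σ⟨ π ⟩ (λ e → ⟦ lr e ⟧ * e)

  weight-decreases : ∀ {lr w x y z} (bal : Balanced lr) (β : Bad lr w x y z) → weight (swapped lr x y) < weight lr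
  weight-decreases {lr} {w} {x} {y} {z} bal β = +-cancelʳ-< y _ _ (begin-strict
      weight lr′ + y                              ≡⟨ cong (weight lr′ +_) values ⟨
      weight lr′ + (⟦ lr x ⟧ * x + ⟦ lr y ⟧ * y)   ≡⟨ Σ-update _ _ unique x∈ y∈ x≢y
                                                       (λ e e≢x e≢y → cong (λ b → ⟦ b ⟧ * e) (swapped-other lr e≢x e≢y)) ⟩
      weight lr + (⟦ lr′ x ⟧ * x + ⟦ lr′ y ⟧ * y)  ≡⟨ cong (weight lr +_) values′ ⟩
      weight lr + x                               <⟨ +-monoʳ-< (weight lr) x≺y ⟩
      weight lr + y                               ∎)
    where
    open ≤-Reasoning
    open Swap bal β using (lr′; x≢y)
    open Bad lr β
    values : ⟦ lr x ⟧ * x + ⟦ lr y ⟧ * y ≡ y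
    values rewrite rl-x | lr-y = +-identityʳ y
    values′ : ⟦ lr′ x ⟧ * x + ⟦ lr′ y ⟧ * y ≡ x
    values′ rewrite swapped-x lr x y | swapped-y lr x≢y = trans (+-identityʳ (x + 0)) (+-identityʳ x)

  bad? : ∀ lr → Dec (∃ λ w → ∃ λ x → ∃ λ y → ∃ λ z → Bad lr w x y z)
  bad? lr = map′
    (λ { (w , w∈ , x , x∈ , y , y∈ , z , z∈ , w⊲x , x⊲y , y⊲z , z≺x , x≺y , y≺w , r , l) →
         w , x , y , z , bad w∈ x∈ y∈ z∈ w⊲x x⊲y y⊲z z≺x x≺y y≺w r l })
    (λ { (w , x , y , z , bad w∈ x∈ y∈ z∈ w⊲x x⊲y y⊲z z≺x x≺y y≺w r l) →
         w , w∈ , x , x∈ , y , y∈ , z , z∈ , w⊲x , x⊲y , y⊲z , z≺x , x≺y , y≺w , r , l })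
    (any∈? (λ w → any∈? (λ x → any∈? (λ y → any∈? (λ z →
      (P w <? P x) ×-dec (P x <? P y) ×-dec (P y <? P z) ×-dec (z <? x) ×-dec (x <? y) ×-dec (y <? w)
      ×-dec (lr x Bool.≟ false) ×-dec (lr y Bool.≟ true)) π) π) π) π)

  good-marking : ∀ {lr} → Balanced lr → ∃ λ lr′ → Balanced lr′ × (∀ {w x y z} → ¬ Bad lr′ w x y z)
  good-marking {lr} bal = go lr bal (<-wellFounded (weight lr))
    where
    go : ∀ lr → Balanced lr → Acc _<_ (weight lr) → ∃ λ lr′ → Balanced lr′ × (∀ {w x y z} → ¬ Bad lr′ w x y z)
    go lr bal (acc rs) with bad? lr
    ... | no ¬β = lr , bal , λ {w} {x} {y} {z} β → ¬β (w , x , y , z , β)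
    ... | yes (w , x , y , z , β) = go (swapped lr x y) (Swap.balanced′ bal β) (rs (weight-decreases bal β))

-- Adjacent permutations

-- The flags mark the positions taking part in a swap.
data Swaps : List Bool → List ℕ → List ℕ → Set where
  []   : Swaps [] [] []
  keep : ∀ {fs xs ys} x → Swaps fs xs ys → Swaps (false ∷ fs) (x ∷ xs) (x ∷ ys)
  swap : ∀ {fs xs ys} x y → Swaps fs xs ys → Swaps (true ∷ true ∷ fs) (x ∷ y ∷ xs) (y ∷ x ∷ ys)

Swaps-refl : ∀ xs → ∃ λ fs → Swaps fs xs xs
Swaps-refl []       = [] , []
Swaps-refl (x ∷ xs) = _ , keep x (proj₂ (Swaps-refl xs))

Swaps-sym : ∀ {fs xs ys} → Swaps fs xs ys → Swaps fs ys xs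
Swaps-sym []           = []
Swaps-sym (keep x s)   = keep x (Swaps-sym s)
Swaps-sym (swap x y s) = swap y x (Swaps-sym s)

Swaps⇒↭ : ∀ {fs xs ys} → Swaps fs xs ys → xs ↭ ys
Swaps⇒↭ []           = ↭-refl
Swaps⇒↭ (keep x s)   = prep x (Swaps⇒↭ s)
Swaps⇒↭ (swap x y s) = _↭_.swap x y (Swaps⇒↭ s)

flag : List Bool → ℕ → Bool
flag []       _       = false
flag (f ∷ fs) zero    = f
flag (f ∷ fs) (suc q) = flag fs q

mark : ℕ → List Bool → List Bool
mark zero    (_ ∷ _ ∷ fs) = true ∷ true ∷ fs
mark zero    fs           = fs
mark (suc p) (f ∷ fs)     = f ∷ mark p fs
mark (suc p) []           = []

flag-mark : ∀ p fs q → flag (mark p fs) q ≡ true → flag fs q ≡ true ⊎ (q ≡ p ⊎ q ≡ suc p)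
flag-mark zero    (_ ∷ _ ∷ fs) zero          h = inj₂ (inj₁ refl)
flag-mark zero    (_ ∷ _ ∷ fs) (suc zero)    h = inj₂ (inj₂ refl)
flag-mark zero    (_ ∷ _ ∷ fs) (suc (suc q)) h = inj₁ h
flag-mark zero    (_ ∷ [])     q             h = inj₁ h
flag-mark (suc p) (f ∷ fs)     zero          h = inj₁ h
flag-mark (suc p) (f ∷ fs)     (suc q)       h =
  Sum.map₂ (Sum.map (cong suc) (cong suc)) (flag-mark p fs q h)

swapAt-Swaps : ∀ {fs xs ys} p → Swaps fs xs ys → suc p < length xs →
  flag fs p ≡ false → flag fs (suc p) ≡ false → Swaps (mark p fs) xs (swapAt p ys)
swapAt-Swaps zero    (keep x (keep y s))   lt f g = swap x y s
swapAt-Swaps zero    (keep x (swap _ _ _)) lt f ()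
swapAt-Swaps zero    (keep x [])           (s≤s ()) f g
swapAt-Swaps (suc p) (keep x s)            lt f g = keep x (swapAt-Swaps p s (≤-pred lt) f g)
swapAt-Swaps (suc (suc p)) (swap x y s)    lt f g = swap x y (swapAt-Swaps p s (≤-pred (≤-pred lt)) f g)

-- The head of the list is applied last, so the induction adds one swap to those already made.
-- Tracing each flag back to a member of `ps` turns the distance condition into the freeness of
-- cells `p` and `p + 1`.
applySwaps-Swaps : ∀ ps π → All (λ p → suc p < length π) ps →
  AllPairs (λ p q → suc p < q ⊎ suc q < p) ps →
  ∃ λ fs → Swaps fs π (applySwaps ps π) × (∀ q → flag fs q ≡ true → Any (λ p → q ≡ p ⊎ q ≡ suc p) ps)
applySwaps-Swaps [] π _ _ = _ , proj₂ (Swaps-refl π) , λ q h → ⊥-elim (true≢false h (unmarked π q))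
  where
  unmarked : ∀ xs q → flag (proj₁ (Swaps-refl xs)) q ≡ false
  unmarked []       q       = refl
  unmarked (x ∷ xs) zero    = refl
  unmarked (x ∷ xs) (suc q) = unmarked xs q
applySwaps-Swaps (p ∷ ps) π (lt ∷ lts) (apart ∷ aparts) with applySwaps-Swaps ps π lts aparts
... | fs , s , flags =
  mark p fs , swapAt-Swaps p s lt (free p (inj₁ refl)) (free (suc p) (inj₂ refl)) ,
  λ q h → [ there ∘ flags q , here ]′ (flag-mark p fs q h)
  where
  clash : ∀ q → (q ≡ p ⊎ q ≡ suc p) → ∀ {r} → suc p < r ⊎ suc r < p → q ≡ r ⊎ q ≡ suc r → ⊥
  clash q (inj₁ refl) (inj₁ lt) (inj₁ refl) = <-asym lt (n<1+n _)
  clash q (inj₁ refl) (inj₁ lt) (inj₂ refl) = <-asym lt (<-trans (n<1+n _) (n<1+n _))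
  clash q (inj₁ refl) (inj₂ lt) (inj₁ refl) = <-asym lt (n<1+n _)
  clash q (inj₁ refl) (inj₂ lt) (inj₂ refl) = <-irrefl refl lt
  clash q (inj₂ refl) (inj₁ lt) (inj₁ refl) = <-irrefl refl lt
  clash q (inj₂ refl) (inj₁ lt) (inj₂ refl) = <-asym lt (n<1+n _)
  clash q (inj₂ refl) (inj₂ lt) (inj₁ refl) = <-asym lt (<-trans (n<1+n _) (n<1+n _))
  clash q (inj₂ refl) (inj₂ lt) (inj₂ refl) = <-asym lt (n<1+n _)
  free : ∀ q → (q ≡ p ⊎ q ≡ suc p) → flag fs q ≡ false
  free q near with flag fs q in eq
  ... | false = refl
  ... | true with r , r∈ , q-at-r ← find (flags q eq) = ⊥-elim (clash q near (All.lookup apart r∈) q-at-r)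

Adjacent⇒Swaps : ∀ {xs ys} → Adjacent xs ys → ∃ λ fs → Swaps fs xs ys
Adjacent⇒Swaps (inj₁ (ps , lts , aparts , refl)) = let fs , s , _ = applySwaps-Swaps ps _ lts aparts in fs , s
Adjacent⇒Swaps (inj₂ (ps , lts , aparts , refl)) = let fs , s , _ = applySwaps-Swaps ps _ lts aparts in fs , Swaps-sym s

applySwaps-suc : ∀ ps x xs → applySwaps (map suc ps) (x ∷ xs) ≡ x ∷ applySwaps ps xs
applySwaps-suc []       x xs = refl
applySwaps-suc (p ∷ ps) x xs = cong (swapAt (suc p)) (applySwaps-suc ps x xs)

Swaps⇒ObtainedBySwaps : ∀ {fs xs ys} → Swaps fs xs ys → ObtainedBySwaps xs ys
Swaps⇒ObtainedBySwaps [] = [] , [] , [] , refl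
Swaps⇒ObtainedBySwaps (keep x s) with ps , lts , aparts , refl ← Swaps⇒ObtainedBySwaps s =
  map suc ps , All.map⁺ (All.map s≤s lts) ,
  AllPairs.map⁺ (AllPairs.map (Sum.map s≤s s≤s) aparts) , sym (applySwaps-suc ps x _)
Swaps⇒ObtainedBySwaps (swap {xs = xs} x y s) with ps , lts , aparts , refl ← Swaps⇒ObtainedBySwaps s =
  0 ∷ map suc (map suc ps) ,
  s≤s (s≤s z≤n) ∷ All.map⁺ (All.map⁺ (All.map (s≤s ∘ s≤s) lts)) ,
  All.map⁺ (All.map⁺ (All.map (λ _ → inj₁ (s≤s (s≤s z≤n))) lts)) ∷
    AllPairs.map⁺ (AllPairs.map⁺ (AllPairs.map (Sum.map (s≤s ∘ s≤s) (s≤s ∘ s≤s)) aparts)) ,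
  sym (cong (swapAt 0) (trans (applySwaps-suc (map suc ps) x (y ∷ xs)) (cong (x ∷_) (applySwaps-suc ps y xs))))

Cross : List ℕ → List ℕ → ℕ → ℕ → Set
Cross xs ys x y = pos xs x < pos xs y × pos ys y < pos ys x

data Place (z w x : ℕ) : Set where
  is-first  : x ≡ z → Place z w x
  is-second : x ≡ w → Place z w x
  is-other  : z ≢ x → w ≢ x → Place z w x

place : ∀ z w x → Place z w x
place z w x with z ≟ x | w ≟ x
... | yes z≡x | _       = is-first (sym z≡x)
... | no _    | yes w≡x = is-second (sym w≡x)
... | no z≢x  | no w≢x  = is-other z≢x w≢x

pos-second : ∀ {z w} xs → z ≢ w → pos (z ∷ w ∷ xs) w ≡ 1
pos-second {z} {w} xs z≢w = trans (pos-there (w ∷ xs) z≢w) (cong suc (pos-here w xs))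

pos-other : ∀ {z w x} xs → z ≢ x → w ≢ x → pos (z ∷ w ∷ xs) x ≡ suc (suc (pos xs x))
pos-other xs z≢x w≢x = trans (pos-there _ z≢x) (cong suc (pos-there xs w≢x))

-- Only neighbours exchange in one step. This is what gives all segments slope one, hence constant
-- time - position or time + position.
Swaps-cross : ∀ {fs xs ys x y} → Unique xs → Swaps fs xs ys → Cross xs ys x y →
  pos ys x ≡ suc (pos xs x) × pos xs y ≡ suc (pos xs x) × pos ys y ≡ pos xs x
Swaps-cross u [] (p , q) = ⊥-elim (<-asym p q)
Swaps-cross {xs = _ ∷ xs} {_ ∷ ys} {x} {y} (_ ∷ u) (keep z s) (p , q) with z ≟ x | z ≟ y
... | yes _ | yes _ = ⊥-elim (<-irrefl refl p)
... | no _  | no _ with a , b , c ← Swaps-cross u s (≤-pred p , ≤-pred q) = cong suc a , cong suc b , cong suc c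
Swaps-cross {xs = _ ∷ _ ∷ xs} {_ ∷ _ ∷ ys} {x} {y} ((z≢w ∷ _) ∷ _ ∷ u) (swap z w s) (p , q)
  with place z w x | place z w y
... | is-first refl | is-first refl = ⊥-elim (<-irrefl refl p)
... | is-second refl | is-second refl = ⊥-elim (<-irrefl refl p)
... | is-first refl | is-second refl
  rewrite pos-here z (w ∷ xs) | pos-second xs z≢w | pos-here w (z ∷ ys) | pos-second ys (z≢w ∘ sym) =
    refl , refl , refl
... | is-first refl | is-other a b rewrite pos-second ys (z≢w ∘ sym) | pos-other ys b a with s≤s () ← q
... | is-second refl | is-first refl rewrite pos-here z (w ∷ xs) with () ← p
... | is-second refl | is-other a b rewrite pos-here w (z ∷ ys) with () ← q
... | is-other a b | is-first refl rewrite pos-here z (w ∷ xs) with () ← p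
... | is-other a b | is-second refl rewrite pos-second xs z≢w | pos-other xs a b with s≤s () ← p
... | is-other a b | is-other c d
  rewrite pos-other xs a b | pos-other xs c d | pos-other ys b a | pos-other ys d c
  with e , f , g ← Swaps-cross u s (≤-pred (≤-pred p) , ≤-pred (≤-pred q)) =
    cong (suc ∘ suc) e , cong (suc ∘ suc) f , cong (suc ∘ suc) g

Moves : List ℕ → List ℕ → ℕ → Set
Moves xs ys x = pos ys x ≡ pos xs x ⊎ ((∃ λ y → y ∈ xs × Cross xs ys x y) ⊎ (∃ λ y → y ∈ xs × Cross xs ys y x))

Swaps-moves : ∀ {fs xs ys} → Unique xs → Swaps fs xs ys → ∀ x → Moves xs ys x
Swaps-moves u [] x = inj₁ refl
Swaps-moves {xs = _ ∷ xs} {_ ∷ ys} (z∉ ∷ u) (keep z s) x with z ≟ x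
... | yes refl = inj₁ refl
... | no z≢x with Swaps-moves u s x
...   | inj₁ same = inj₁ (cong suc same)
...   | inj₂ (inj₁ (y , y∈ , p , q)) = inj₂ (inj₁ (y , there y∈ ,
          subst (suc (pos xs x) <_) (sym (pos-there xs z≢y)) (s≤s p) , subst (_< suc (pos ys x)) (sym (pos-there ys z≢y)) (s≤s q)))
  where z≢y = All.lookup z∉ y∈
...   | inj₂ (inj₂ (y , y∈ , p , q)) = inj₂ (inj₂ (y , there y∈ ,
          subst (_< suc (pos xs x)) (sym (pos-there xs z≢y)) (s≤s p) , subst (suc (pos ys x) <_) (sym (pos-there ys z≢y)) (s≤s q)))
  where z≢y = All.lookup z∉ y∈
Swaps-moves {xs = _ ∷ _ ∷ xs} {_ ∷ _ ∷ ys} ((z≢w ∷ z∉) ∷ w∉ ∷ u) (swap z w s) x with place z w x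
... | is-first refl = inj₂ (inj₁ (w , there (here refl) ,
  subst₂ _<_ (sym (pos-here z (w ∷ xs))) (sym (pos-second xs z≢w)) z<s ,
  subst₂ _<_ (sym (pos-here w (z ∷ ys))) (sym (pos-second ys (z≢w ∘ sym))) z<s))
... | is-second refl = inj₂ (inj₂ (z , here refl ,
  subst₂ _<_ (sym (pos-here z (w ∷ xs))) (sym (pos-second xs z≢w)) z<s ,
  subst₂ _<_ (sym (pos-here w (z ∷ ys))) (sym (pos-second ys (z≢w ∘ sym))) z<s))
... | is-other a b with Swaps-moves u s x
...   | inj₁ same = inj₁ (trans (pos-other ys b a) (trans (cong (suc ∘ suc) same) (sym (pos-other xs a b))))
...   | inj₂ (inj₁ (y , y∈ , p , q)) = inj₂ (inj₁ (y , there (there y∈) ,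
          subst₂ _<_ (sym (pos-other xs a b)) (sym (pos-other xs c d)) (s<s (s<s p)) ,
          subst₂ _<_ (sym (pos-other ys d c)) (sym (pos-other ys b a)) (s<s (s<s q))))
  where c = All.lookup z∉ y∈ ; d = All.lookup w∉ y∈
...   | inj₂ (inj₂ (y , y∈ , p , q)) = inj₂ (inj₂ (y , there (there y∈) ,
          subst₂ _<_ (sym (pos-other xs c d)) (sym (pos-other xs a b)) (s<s (s<s p)) ,
          subst₂ _<_ (sym (pos-other ys b a)) (sym (pos-other ys d c)) (s<s (s<s q))))
  where c = All.lookup z∉ y∈ ; d = All.lookup w∉ y∈

-- Crossing times

module Timing (π : List ℕ) (unique : Unique π) (lr : ℕ → Bool) (t : ℕ → ℕ → ℕ) where
  open Position π
  open Marked lr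

  -- t a b is the time at which the inversion (a , b) is crossed; 312, 231 and 321 are the patterns
  -- formed by a, b, c.
  record Times : Set where
    field
      t312  : ∀ {a b c} → a ⊲ b → b ⊲ c → c ∈ π → b < c → c < a → t a b < t a c
      t231  : ∀ {a b c} → a ⊲ b → b ⊲ c → c ∈ π → c < a → a < b → t b c < t a c
      t321ˡ : ∀ {a b c} → a ⊲ b → b ⊲ c → c ∈ π → c < b → b < a → lr b ≡ true → t a b < t a c × t a c < t b c
      t321ʳ : ∀ {a b c} → a ⊲ b → b ⊲ c → c ∈ π → c < b → b < a → lr b ≡ false → t b c < t a c × t a c < t a b

  -- x is to the left of y at time s
  Ord : ℕ → ℕ → ℕ → Set
  Ord s x y = (x ⊲ y × (x < y ⊎ s ≤ t x y)) ⊎ (y ⊲ x × x < y × t y x < s)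

  Ord-asym : ∀ {s x y} → Ord s x y → Ord s y x → ⊥
  Ord-asym (inj₁ (p , _)) (inj₁ (q , _)) = <-asym p q
  Ord-asym (inj₁ (_ , inj₁ q)) (inj₂ (_ , r , _)) = <-asym q r
  Ord-asym (inj₁ (_ , inj₂ q)) (inj₂ (_ , _ , r)) = <⇒≱ r q
  Ord-asym (inj₂ (_ , r , _)) (inj₁ (_ , inj₁ q)) = <-asym q r
  Ord-asym (inj₂ (_ , _ , r)) (inj₁ (_ , inj₂ q)) = <⇒≱ r q
  Ord-asym (inj₂ (p , _)) (inj₂ (q , _)) = <-asym p q

  Ord-irrefl : ∀ {s x y} → Ord s x y → x ≢ y
  Ord-irrefl o refl = Ord-asym o o

  Ord-total : ∀ s {x y} → x ≢ y → Ord s x y ⊎ Ord s y x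
  Ord-total s {x} {y} x≢y with ⊲-cmp x y | <-cmp x y
  ... | tri≈ _ x≡y _ | _ = ⊥-elim (x≢y x≡y)
  ... | _ | tri≈ _ x≡y _ = ⊥-elim (x≢y x≡y)
  ... | tri< p _ _ | tri< q _ _ = inj₁ (inj₁ (p , inj₁ q))
  ... | tri> _ _ p | tri> _ _ q = inj₂ (inj₁ (p , inj₁ q))
  ... | tri< p _ _ | tri> _ _ q with <-≤-connex (t x y) s
  ...   | inj₁ lt = inj₂ (inj₂ (p , q , lt))
  ...   | inj₂ le = inj₁ (inj₁ (p , inj₂ le))
  Ord-total s {x} {y} x≢y | tri> _ _ p | tri< q _ _ with <-≤-connex (t y x) s
  ...   | inj₁ lt = inj₁ (inj₂ (p , q , lt))
  ...   | inj₂ le = inj₂ (inj₁ (p , inj₂ le))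

  Ord-cross : ∀ {s x y} → x ∈ π → y ∈ π → Ord s x y → Ord (suc s) y x → Inv x y × t x y ≡ s
  Ord-cross x∈ y∈ (inj₁ (p , inj₁ q)) (inj₁ (r , _)) = ⊥-elim (<-asym p r)
  Ord-cross x∈ y∈ (inj₁ (p , inj₁ q)) (inj₂ (_ , r , _)) = ⊥-elim (<-asym q r)
  Ord-cross x∈ y∈ (inj₁ (p , inj₂ q)) (inj₁ (r , _)) = ⊥-elim (<-asym p r)
  Ord-cross x∈ y∈ (inj₁ (p , inj₂ q)) (inj₂ (_ , r , u)) = inv p r y∈ , ≤-antisym (≤-pred u) q
  Ord-cross x∈ y∈ (inj₂ (p , q , r)) (inj₁ (_ , inj₁ u)) = ⊥-elim (<-asym q u)
  Ord-cross x∈ y∈ (inj₂ (p , q , r)) (inj₁ (_ , inj₂ u)) = ⊥-elim (<⇒≱ r (<⇒≤ u))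
  Ord-cross x∈ y∈ (inj₂ (p , q , r)) (inj₂ (u , _ , _)) = ⊥-elim (<-asym p u)

  Ord-before-cross : ∀ {x y} → Inv x y → Ord (t x y) x y
  Ord-before-cross (inv p q _) = inj₁ (p , inj₂ ≤-refl)

  Ord-after-cross : ∀ {x y} → Inv x y → Ord (suc (t x y)) y x
  Ord-after-cross (inv p q _) = inj₂ (p , q , ≤-refl)

  module _ (times : Times) where
    open Times times

    no-bad : ∀ {w x y z} → ¬ Bad w x y z
    no-bad (bad w∈ x∈ y∈ z∈ w⊲x x⊲y y⊲z z≺x x≺y y≺w rl-x lr-y) =
      <-asym (<-trans (t231 x⊲y y⊲z z∈ z≺x x≺y)
             (<-trans (proj₁ x-RL) (<-trans (proj₂ x-RL) (t312 w⊲x x⊲y y∈ x≺y y≺w))))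
             (<-trans (proj₁ y-LR) (proj₂ y-LR))
      where
      x-RL = t321ʳ w⊲x (<-trans x⊲y y⊲z) z∈ z≺x (<-trans x≺y y≺w) rl-x
      y-LR = t321ˡ (<-trans w⊲x x⊲y) y⊲z z∈ (<-trans z≺x x≺y) y≺w lr-y

    distinctʳ′ : ∀ {a b b′} → Inv a b → Inv a b′ → b ⊲ b′ → t a b ≢ t a b′
    distinctʳ′ {a} {b} {b′} (inv a⊲b b<a _) (inv _ b′<a b′∈) b⊲b′ with <-cmp b b′ | true-or-false (lr b)
    ... | tri≈ _ refl _ | _ = ⊥-elim (<-irrefl refl b⊲b′)
    ... | tri< b<b′ _ _ | _ = <⇒≢ (t312 a⊲b b⊲b′ b′∈ b<b′ b′<a)
    ... | tri> _ _ b′<b | inj₁ l = <⇒≢ (proj₁ (t321ˡ a⊲b b⊲b′ b′∈ b′<b b<a l))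
    ... | tri> _ _ b′<b | inj₂ r = ≢-sym (<⇒≢ (proj₂ (t321ʳ a⊲b b⊲b′ b′∈ b′<b b<a r)))

    distinctʳ : ∀ {a b b′} → Inv a b → Inv a b′ → t a b ≡ t a b′ → b ≡ b′
    distinctʳ {a} {b} {b′} i j eq with ⊲-cmp b b′
    ... | tri≈ _ b≡b′ _ = b≡b′
    ... | tri< p _ _ = ⊥-elim (distinctʳ′ i j p eq)
    ... | tri> _ _ p = ⊥-elim (distinctʳ′ j i p (sym eq))

    distinctˡ′ : ∀ {a a′ c} → Inv a c → Inv a′ c → a ⊲ a′ → t a c ≢ t a′ c
    distinctˡ′ {a} {a′} {c} (inv _ c<a c∈) (inv a′⊲c c<a′ _) a⊲a′ with <-cmp a a′ | true-or-false (lr a′)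
    ... | tri≈ _ refl _ | _ = ⊥-elim (<-irrefl refl a⊲a′)
    ... | tri< a<a′ _ _ | _ = ≢-sym (<⇒≢ (t231 a⊲a′ a′⊲c c∈ c<a a<a′))
    ... | tri> _ _ a′<a | inj₁ l = <⇒≢ (proj₂ (t321ˡ a⊲a′ a′⊲c c∈ c<a′ a′<a l))
    ... | tri> _ _ a′<a | inj₂ r = ≢-sym (<⇒≢ (proj₁ (t321ʳ a⊲a′ a′⊲c c∈ c<a′ a′<a r)))

    distinctˡ : ∀ {a a′ c} → Inv a c → Inv a′ c → t a c ≡ t a′ c → a ≡ a′
    distinctˡ {a} {a′} {c} i j eq with ⊲-cmp a a′
    ... | tri≈ _ a≡a′ _ = a≡a′
    ... | tri< p _ _ = ⊥-elim (distinctˡ′ i j p eq)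
    ... | tri> _ _ p = ⊥-elim (distinctˡ′ j i p (sym eq))

    -- With `distinctʳ` and `distinctˡ` it shows that pairs crossing at the same time are disjoint,
    -- so they can be swapped in a single step.
    distinctᵐ : ∀ {a b c} → Inv a b → Inv b c → t a b ≢ t b c
    distinctᵐ {b = b} (inv a⊲b b<a _) (inv b⊲c c<b c∈) with true-or-false (lr b)
    ... | inj₁ l = let p , q = t321ˡ a⊲b b⊲c c∈ c<b b<a l in <⇒≢ (<-trans p q)
    ... | inj₂ r = let p , q = t321ʳ a⊲b b⊲c c∈ c<b b<a r in ≢-sym (<⇒≢ (<-trans p q))

    -- The cycle means that `a` and `c` have crossed while neither of them has crossed `b`. In each
    -- pattern of `Times` one of those crossings comes before that of `a` and `c`.
    no-cycle₁ : ∀ {s a b c} → a ⊲ b → b ⊲ c → c ∈ π → Ord s a b → Ord s b c → Ord s c a → ⊥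
    no-cycle₁ a⊲b b⊲c c∈ (inj₂ (q , _)) _ _ = <-asym a⊲b q
    no-cycle₁ a⊲b b⊲c c∈ _ (inj₂ (q , _)) _ = <-asym b⊲c q
    no-cycle₁ a⊲b b⊲c c∈ _ _ (inj₁ (q , _)) = <-asym (<-trans a⊲b b⊲c) q
    no-cycle₁ a⊲b b⊲c c∈ (inj₁ (_ , inj₁ a<b)) (inj₁ (_ , inj₁ b<c)) (inj₂ (_ , c<a , _)) = <-asym c<a (<-trans a<b b<c)
    no-cycle₁ a⊲b b⊲c c∈ (inj₁ (_ , inj₁ a<b)) (inj₁ (_ , inj₂ le)) (inj₂ (_ , c<a , lt)) =
      <-asym (t231 a⊲b b⊲c c∈ c<a a<b) (<-≤-trans lt le)
    no-cycle₁ a⊲b b⊲c c∈ (inj₁ (_ , inj₂ le)) (inj₁ (_ , inj₁ b<c)) (inj₂ (_ , c<a , lt)) =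
      <-asym (t312 a⊲b b⊲c c∈ b<c c<a) (<-≤-trans lt le)
    no-cycle₁ {s} {a} {b} {c} a⊲b b⊲c c∈ (inj₁ (_ , inj₂ le)) (inj₁ (_ , inj₂ le′)) (inj₂ (_ , c<a , lt))
      with <-cmp a b | <-cmp b c
    ... | tri≈ _ refl _ | _ = <-irrefl refl a⊲b
    ... | _ | tri≈ _ refl _ = <-irrefl refl b⊲c
    ... | tri< a<b _ _ | _ = <-asym (t231 a⊲b b⊲c c∈ c<a a<b) (<-≤-trans lt le′)
    ... | _ | tri< b<c _ _ = <-asym (t312 a⊲b b⊲c c∈ b<c c<a) (<-≤-trans lt le)
    ... | tri> _ _ b<a | tri> _ _ c<b with true-or-false (lr b)
    ...   | inj₁ l = <-asym (proj₁ (t321ˡ a⊲b b⊲c c∈ c<b b<a l)) (<-≤-trans lt le)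
    ...   | inj₂ r = <-asym (proj₁ (t321ʳ a⊲b b⊲c c∈ c<b b<a r)) (<-≤-trans lt le′)

    -- Here `b` has crossed both `a` and `c`, which have not crossed each other; but in the pattern
    -- 321 the outer pair crosses between the other two.
    no-cycle₂ : ∀ {s a b c} → a ⊲ b → b ⊲ c → c ∈ π → Ord s a c → Ord s c b → Ord s b a → ⊥
    no-cycle₂ a⊲b b⊲c c∈ (inj₂ (q , _)) _ _ = <-asym (<-trans a⊲b b⊲c) q
    no-cycle₂ a⊲b b⊲c c∈ _ (inj₁ (q , _)) _ = <-asym b⊲c q
    no-cycle₂ a⊲b b⊲c c∈ _ _ (inj₁ (q , _)) = <-asym a⊲b q
    no-cycle₂ a⊲b b⊲c c∈ (inj₁ (_ , inj₁ a<c)) (inj₂ (_ , c<b , _)) (inj₂ (_ , b<a , _)) = <-asym a<c (<-trans c<b b<a)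
    no-cycle₂ {s} {a} {b} {c} a⊲b b⊲c c∈ (inj₁ (_ , inj₂ le)) (inj₂ (_ , c<b , lt)) (inj₂ (_ , b<a , lt′))
      with true-or-false (lr b)
    ... | inj₁ l = <-asym (proj₂ (t321ˡ a⊲b b⊲c c∈ c<b b<a l)) (<-≤-trans lt le)
    ... | inj₂ r = <-asym (proj₂ (t321ʳ a⊲b b⊲c c∈ c<b b<a r)) (<-≤-trans lt′ le)

    Ord-trans : ∀ {s x y z} → x ∈ π → y ∈ π → z ∈ π → Ord s x y → Ord s y z → Ord s x z
    Ord-trans {s} {x} {y} {z} x∈ y∈ z∈ p q with x ≟ z
    ... | yes refl = ⊥-elim (Ord-asym p q)
    ... | no x≢z with Ord-total s x≢z
    ...   | inj₁ o = o
    ...   | inj₂ r with ⊲-cmp x y | ⊲-cmp y z | ⊲-cmp x z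
    ...     | tri≈ _ refl _ | _ | _ = ⊥-elim (Ord-irrefl p refl)
    ...     | _ | tri≈ _ refl _ | _ = ⊥-elim (Ord-irrefl q refl)
    ...     | _ | _ | tri≈ _ refl _ = ⊥-elim (x≢z refl)
    ...     | tri< x⊲y _ _ | tri< y⊲z _ _ | _            = ⊥-elim (no-cycle₁ x⊲y y⊲z z∈ p q r)
    ...     | tri< x⊲y _ _ | tri> _ _ z⊲y | tri< x⊲z _ _ = ⊥-elim (no-cycle₂ x⊲z z⊲y y∈ p q r)
    ...     | tri< x⊲y _ _ | tri> _ _ z⊲y | tri> _ _ z⊲x = ⊥-elim (no-cycle₁ z⊲x x⊲y y∈ r p q)
    ...     | tri> _ _ y⊲x | tri< y⊲z _ _ | tri< x⊲z _ _ = ⊥-elim (no-cycle₂ y⊲x x⊲z z∈ q r p)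
    ...     | tri> _ _ y⊲x | tri< y⊲z _ _ | tri> _ _ z⊲x = ⊥-elim (no-cycle₁ y⊲z z⊲x x∈ q r p)
    ...     | tri> _ _ y⊲x | tri> _ _ z⊲y | _            = ⊥-elim (no-cycle₂ z⊲y y⊲x x∈ r p q)

    -- The case `e ≡ a` stands apart because `Ord` is irreflexive; `b` falls under the last case, as
    -- it is still to the right of `a` when their crossing begins.
    Side : ℕ → ℕ → ℕ → Set
    Side a b e = ℓ a b e ≡ true × Ord (t a b) e a ⊎ ℓ a b e ≡ false × (e ≡ a ⊎ Ord (t a b) a e)

    side : ∀ {a b} → Inv a b → ∀ e → e ∈ π → Side a b e
    side {a} {b} (inv a⊲b b<a b∈) e e∈ with ⊲-cmp e a | ⊲-cmp e b
    ... | tri≈ _ refl _ | _ = inj₂ (ℓ-here a⊲b , inj₁ refl)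
    ... | tri< e⊲a _ _ | _ with <-cmp e a | true-or-false (lr a)
    ...   | tri≈ _ refl _ | _ = ⊥-elim (<-irrefl refl e⊲a)
    ...   | tri< e<a _ _ | _ = inj₁ (trans (ℓ-before e⊲a a⊲b) (cong (_∨ not (lr a)) (<⇒<ᵇ≡true e<a)) , inj₁ (e⊲a , inj₁ e<a))
    ...   | tri> _ _ a<e | inj₁ l = inj₂ (trans (ℓ-before e⊲a a⊲b) (cong₂ (λ u v → u ∨ not v) (≤⇒<ᵇ≡false (<⇒≤ a<e)) l) ,
              inj₂ (inj₂ (e⊲a , a<e , (let p , q = t321ˡ e⊲a a⊲b b∈ b<a a<e l in <-trans p q))))
    ...   | tri> _ _ a<e | inj₂ r = inj₁ (trans (ℓ-before e⊲a a⊲b) (cong₂ (λ u v → u ∨ not v) (≤⇒<ᵇ≡false (<⇒≤ a<e)) r) ,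
              inj₁ (e⊲a , inj₂ (let p , q = t321ʳ e⊲a a⊲b b∈ b<a a<e r in <⇒≤ (<-trans p q))))
    side {a} {b} i@(inv a⊲b b<a b∈) e e∈ | tri> _ _ a⊲e | tri≈ _ refl _ =
      inj₂ (ℓ-there a⊲b , inj₂ (Ord-before-cross i))
    side {a} {b} (inv a⊲b b<a b∈) e e∈ | tri> _ _ a⊲e | tri< e⊲b _ _ with <-cmp e b | <-cmp e a | true-or-false (lr e)
    ... | tri≈ _ refl _ | _ | _ = ⊥-elim (<-irrefl refl e⊲b)
    ... | tri< e<b _ _ | _ | _ = inj₁ (trans (ℓ-between a⊲e e⊲b) (cong (_∨ ((e <ᵇ a) ∧ lr e)) (<⇒<ᵇ≡true e<b)) ,
            inj₂ (a⊲e , <-trans e<b b<a , t312 a⊲e e⊲b b∈ e<b b<a))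
    ... | _ | tri≈ _ refl _ | _ = ⊥-elim (<-irrefl refl a⊲e)
    ... | tri> _ _ b<e | tri< e<a _ _ | inj₁ l =
      inj₁ (trans (ℓ-between a⊲e e⊲b) (trans (cong₂ (λ u v → u ∨ (v ∧ lr e)) (≤⇒<ᵇ≡false (<⇒≤ b<e)) (<⇒<ᵇ≡true e<a)) l) ,
            inj₂ (a⊲e , e<a , proj₁ (t321ˡ a⊲e e⊲b b∈ b<e e<a l)))
    ... | tri> _ _ b<e | tri< e<a _ _ | inj₂ r =
      inj₂ (trans (ℓ-between a⊲e e⊲b) (trans (cong₂ (λ u v → u ∨ (v ∧ lr e)) (≤⇒<ᵇ≡false (<⇒≤ b<e)) (<⇒<ᵇ≡true e<a)) r) ,
            inj₂ (inj₁ (a⊲e , inj₂ (<⇒≤ (proj₂ (t321ʳ a⊲e e⊲b b∈ b<e e<a r))))))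
    ... | tri> _ _ b<e | tri> _ _ a<e | _ =
      inj₂ (trans (ℓ-between a⊲e e⊲b) (cong₂ (λ u v → u ∨ (v ∧ lr e)) (≤⇒<ᵇ≡false (<⇒≤ b<e)) (≤⇒<ᵇ≡false (<⇒≤ a<e))) ,
            inj₂ (inj₁ (a⊲e , inj₁ a<e)))
    side {a} {b} (inv a⊲b b<a b∈) e e∈ | tri> _ _ a⊲e | tri> _ _ b⊲e with <-cmp e b | <-cmp e a | true-or-false (lr b)
    ... | tri≈ _ refl _ | _ | _ = ⊥-elim (<-irrefl refl b⊲e)
    ... | tri< e<b _ _ | _ | inj₁ l =
      inj₂ (trans (ℓ-after a⊲b b⊲e) (cong₂ (λ u v → u ∧ not v) (<⇒<ᵇ≡true e<b) l) ,
            inj₂ (inj₁ (a⊲e , inj₂ (<⇒≤ (proj₁ (t321ˡ a⊲b b⊲e e∈ e<b b<a l))))))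
    ... | tri< e<b _ _ | _ | inj₂ r =
      inj₁ (trans (ℓ-after a⊲b b⊲e) (cong₂ (λ u v → u ∧ not v) (<⇒<ᵇ≡true e<b) r) ,
            inj₂ (a⊲e , <-trans e<b b<a , proj₂ (t321ʳ a⊲b b⊲e e∈ e<b b<a r)))
    ... | tri> _ _ b<e | tri≈ _ refl _ | _ = ⊥-elim (<-irrefl refl a⊲e)
    ... | tri> _ _ b<e | tri< e<a _ _ | _ =
      inj₂ (trans (ℓ-after a⊲b b⊲e) (cong (_∧ not (lr b)) (≤⇒<ᵇ≡false (<⇒≤ b<e))) ,
            inj₂ (inj₁ (a⊲e , inj₂ (<⇒≤ (t312 a⊲b b⊲e e∈ b<e e<a)))))
    ... | tri> _ _ b<e | tri> _ _ a<e | _ =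
      inj₂ (trans (ℓ-after a⊲b b⊲e) (cong (_∧ not (lr b)) (≤⇒<ᵇ≡false (<⇒≤ b<e))) , inj₂ (inj₁ (a⊲e , inj₁ a<e)))

    -- Stated for any arrangement sorted by `Ord`, so that it applies both to a tangle built from
    -- crossing times and to a given one.
    pos-at-cross : ∀ {σ a b} → π ↭ σ → Inv a b →
      (∀ {x y} → x ∈ π → y ∈ π → Ord (t a b) x y → pos σ x < pos σ y) → pos σ a ≡ p a b
    pos-at-cross {σ} {a} {b} π↭σ i@(inv a⊲b _ b∈) sorted =
      trans (pos-count-↭ π↭σ unique a∈) (Σ-cong π (λ e e∈ → cong ⟦_⟧ (agree e e∈ (side i e e∈))))
      where
      a∈ = ⊲⇒∈ a⊲b b∈
      agree : ∀ e → e ∈ π → Side a b e → (pos σ e <ᵇ pos σ a) ≡ ℓ a b e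
      agree e e∈ (inj₁ (eq , o)) = trans (<⇒<ᵇ≡true (sorted e∈ a∈ o)) (sym eq)
      agree e e∈ (inj₂ (eq , inj₁ refl)) = trans (≤⇒<ᵇ≡false (≤-refl {pos σ e})) (sym eq)
      agree e e∈ (inj₂ (eq , inj₂ o)) = trans (≤⇒<ᵇ≡false (<⇒≤ (sorted a∈ e∈ o))) (sym eq)

-- Potentials

not-true⇒ : ∀ {b} → not b ≡ true → b ≡ false
not-true⇒ {false} _ = refl

not-false⇒ : ∀ {b} → not b ≡ false → b ≡ true
not-false⇒ {true} _ = refl

Σ-⟦⟧≤length : ∀ (f : ℕ → Bool) xs → Σ⟨ xs ⟩ (λ e → ⟦ f e ⟧) ≤ length xs
Σ-⟦⟧≤length f []       = z≤n
Σ-⟦⟧≤length f (x ∷ xs) = +-mono-≤ (at-most-1 (f x)) (Σ-⟦⟧≤length f xs)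
  where
  at-most-1 : ∀ b → ⟦ b ⟧ ≤ 1
  at-most-1 true  = ≤-refl
  at-most-1 false = z≤n

⟦⟧-mono : ∀ {u v} → (T u → T v) → ⟦ u ⟧ ≤ ⟦ v ⟧
⟦⟧-mono {false} f = z≤n
⟦⟧-mono {true} {true} f = ≤-refl
⟦⟧-mono {true} {false} f = ⊥-elim (f _)

⟦⟧-mono-< : ∀ {u v} → u ≡ false → T v → ⟦ u ⟧ < ⟦ v ⟧
⟦⟧-mono-< {v = true} refl _ = s≤s z≤n

minimum : ∀ x xs → ∃ λ m → m ∈ x ∷ xs × (∀ e → e ∈ x ∷ xs → m ≤ e)
minimum x []       = x , here refl , λ { e (here refl) → ≤-refl }
minimum x (y ∷ ys) with minimum y ys
... | m , m∈ , least with ≤-total x m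
...   | inj₁ x≤m = x , here refl , λ { e (here refl) → ≤-refl ; e (there e∈) → ≤-trans x≤m (least e e∈) }
...   | inj₂ m≤x = m , there m∈ , λ { e (here refl) → m≤x ; e (there e∈) → least e e∈ }

AllPairs-pos< : ∀ {xs} → Unique xs → AllPairs (λ x y → pos xs x < pos xs y) xs
AllPairs-pos< []                 = []
AllPairs-pos< {x ∷ xs} (x∉ ∷ u) =
  All.map (λ {y} x≢y → subst₂ _<_ (sym (pos-here x xs)) (sym (pos-there xs x≢y)) z<s) x∉ ∷
  shiftPairs x∉ (AllPairs-pos< u)
  where
  shiftPairs : ∀ {zs} → All (x ≢_) zs → AllPairs (λ y z → pos xs y < pos xs z) zs →
    AllPairs (λ y z → pos (x ∷ xs) y < pos (x ∷ xs) z) zs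
  shiftPairs [] [] = []
  shiftPairs (x≢y ∷ x≢) (h ∷ hs) =
    All.zipWith (λ (x≢z , lt) → subst₂ _<_ (sym (pos-there xs x≢y)) (sym (pos-there xs x≢z)) (s<s lt)) (x≢ , h) ∷ shiftPairs x≢ hs

module Potential (π : List ℕ) (unique : Unique π) (lr : ℕ → Bool) where
  open Position π
  open Marked lr

  module _ (additive : ∀ {a b c d} → Rect a b c d → p a c + p b d ≡ p a d + p b c) where

    exchange : ∀ {a a′ c d} → Inv a c → Inv a d → Inv a′ c → Inv a′ d → c ⊲ d → p a c + p a′ d ≡ p a d + p a′ c
    exchange {a} {a′} {c} {d} (inv p₁ q r) (inv _ q′ r′) (inv s u _) (inv _ u′ _) c⊲d with ⊲-cmp a a′
    ... | tri≈ _ refl _ = +-comm (p a c) (p a d)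
    ... | tri< a⊲a′ _ _ = additive (rect (⊲⇒∈ p₁ r) (⊲⇒∈ s r) r r′ a⊲a′ s c⊲d q q′ u u′)
    ... | tri> _ _ a′⊲a = trans (+-comm (p a c) (p a′ d))
            (trans (sym (additive (rect (⊲⇒∈ s r) (⊲⇒∈ p₁ r) r r′ a′⊲a p₁ c⊲d u u′ q q′))) (+-comm (p a′ c) (p a d)))

    -- Without subtraction: `β b − 2 * p a b` is the same for all `b` inverted with `a`. This common
    -- value is, up to a shift, the constant of the R-line of `a`.
    Consistent : (ℕ → ℕ) → List ℕ → Set
    Consistent β xs = ∀ {a b b′} → b ∈ xs → b′ ∈ xs → Inv a b → Inv a b′ → β b + 2 * p a b′ ≡ β b′ + 2 * p a b

    update : ℕ → ℕ → (ℕ → ℕ) → ℕ → ℕ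
    update z v f e with e ≟ z
    ... | yes _ = v
    ... | no _  = f e

    update-same : ∀ z v f → update z v f z ≡ v
    update-same z v f with z ≟ z
    ... | yes _  = refl
    ... | no z≢z = ⊥-elim (z≢z refl)

    update-other : ∀ z v f {e} → z ≢ e → update z v f e ≡ f e
    update-other z v f {e} z≢e with e ≟ z
    ... | yes refl = ⊥-elim (z≢e refl)
    ... | no _     = refl

    potential : ∀ xs → AllPairs _⊲_ xs → All (_∈ π) xs → ∃ λ β → Consistent β xs
    potential [] _ _ = (λ _ → 0) , λ ()
    potential (z ∷ []) _ _ = (λ _ → 0) , λ { (here refl) (here refl) _ _ → refl }
    -- Every element inverted with z and with some element of xs is also inverted with the minimum m
    -- of xs, so that only the difference of the potentials of z and m has to be adjusted.
    potential (z ∷ xs@(y ∷ ys)) (z⊲ ∷ sorted) (z∈ ∷ xs∈) = extend (potential xs sorted xs∈) (minimum y ys)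
      where
      extend : (∃ λ β → Consistent β xs) → (∃ λ m → m ∈ xs × (∀ e → e ∈ xs → m ≤ e)) → ∃ λ β → Consistent β (z ∷ xs)
      extend (β , cons) (m , m∈ , least) = choose (any∈? (λ a → (P a <? P z) ×-dec (z <? a) ×-dec (m <? a)) π)
        where
        z⊲m = All.lookup z⊲ m∈
        m∈π = All.lookup xs∈ m∈
        inv-m : ∀ {a b} → Inv a z → b ∈ xs → Inv a b → Inv a m
        inv-m (inv a⊲z _ _) b∈ (inv _ b<a _) = inv (<-trans a⊲z z⊲m) (≤-<-trans (least _ b∈) b<a) m∈π
        z≢ : ∀ {b} → b ∈ xs → z ≢ b
        z≢ b∈ = ⊲⇒≢ (All.lookup z⊲ b∈)
        choose : Dec (∃ λ a → a ∈ π × P a < P z × z < a × m < a) → ∃ λ β → Consistent β (z ∷ xs)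
        choose (no none) = β′ , cons′
          where
          -- No element is inverted both with `z` and with a member of `xs`, so the value at `z` is
          -- free.
          β′ = update z 0 β
          unlinked : ∀ {a b} → Inv a z → b ∈ xs → Inv a b → ⊥
          unlinked i b∈ j with inv _ m<a _ ← inv-m i b∈ j | inv a⊲z z<a _ ← i =
            none (_ , ⊲⇒∈ a⊲z z∈ , a⊲z , z<a , m<a)
          cons′ : Consistent β′ (z ∷ xs)
          cons′ (here refl) (here refl) _ _ = refl
          cons′ (here refl) (there b′∈) i j = ⊥-elim (unlinked i b′∈ j)
          cons′ (there b∈) (here refl) i j = ⊥-elim (unlinked j b∈ i)
          cons′ (there b∈) (there b′∈) i j
            rewrite update-other z 0 β (z≢ b∈) | update-other z 0 β (z≢ b′∈) = cons b∈ b′∈ i j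
        choose (yes (a₀ , _ , a₀⊲z , z<a₀ , m<a₀)) = β′ , cons′
          where
          -- The value required at `z` is `β m + 2 * p a₀ z − 2 * p a₀ m`, which may be negative;
          -- instead all earlier values are raised by `2 * p a₀ m`.
          old : ℕ → ℕ
          old e = β e + 2 * p a₀ m
          new : ℕ
          new = β m + 2 * p a₀ z
          β′ = update z new old
          i₀ = inv a₀⊲z z<a₀ z∈
          j₀ = inv (<-trans a₀⊲z z⊲m) m<a₀ m∈π
          linked : ∀ {a b} → Inv a z → b ∈ xs → Inv a b → new + 2 * p a b ≡ old b + 2 * p a z
          linked {a} {b} i b∈ j = begin
            (β m + 2 * p a₀ z) + 2 * p a b            ≡⟨ shuffle₁ (β m) (p a₀ z) (p a b) ⟩
            (β m + 2 * p a b) + 2 * p a₀ z            ≡⟨ cong (_+ 2 * p a₀ z) (cons m∈ b∈ k j) ⟩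
            (β b + 2 * p a m) + 2 * p a₀ z            ≡⟨ shuffle₂ (β b) (p a m) (p a₀ z) ⟩
            β b + 2 * (p a₀ z + p a m)                ≡⟨ cong (λ s → β b + 2 * s) (exchange i₀ j₀ i k z⊲m) ⟩
            β b + 2 * (p a₀ m + p a z)                ≡⟨ shuffle₃ (β b) (p a₀ m) (p a z) ⟩
            (β b + 2 * p a₀ m) + 2 * p a z            ∎
            where
            open ≡-Reasoning
            k = inv-m i b∈ j
            shuffle₁ : ∀ u v w → (u + 2 * v) + 2 * w ≡ (u + 2 * w) + 2 * v
            shuffle₁ = solve-∀
            shuffle₂ : ∀ u v w → (u + 2 * v) + 2 * w ≡ u + 2 * (w + v)
            shuffle₂ = solve-∀
            shuffle₃ : ∀ u v w → u + 2 * (v + w) ≡ (u + 2 * v) + 2 * w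
            shuffle₃ = solve-∀
          cons′ : Consistent β′ (z ∷ xs)
          cons′ (here refl) (here refl) _ _ = refl
          cons′ (here refl) (there b′∈) i j
            rewrite update-same z new old | update-other z new old (z≢ b′∈) = linked i b′∈ j
          cons′ (there b∈) (here refl) i j
            rewrite update-same z new old | update-other z new old (z≢ b∈) = sym (linked j b∈ i)
          cons′ {a} {b} {b′} (there b∈) (there b′∈) i j
            rewrite update-other z new old (z≢ b∈) | update-other z new old (z≢ b′∈) =
              trans (shuffle (β b) (p a₀ m) (p a b′)) (trans (cong (_+ 2 * p a₀ m) (cons b∈ b′∈ i j))
                (sym (shuffle (β b′) (p a₀ m) (p a b))))
            where
            shuffle : ∀ u v w → (u + 2 * v) + 2 * w ≡ (u + 2 * w) + 2 * v
            shuffle = solve-∀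

    -- The R-segment of a is the line time − position = x a, the L-segment of b the line
    -- time + position = y b.
    record Lines : Set where
      field
        x y  : ℕ → ℕ
        meet : ∀ {a b} → Inv a b → x a + 2 * p a b ≡ y b

    lines : Lines
    lines = record { x = λ a → x a (partner? a) ; y = y ; meet = λ {a} → meet a (partner? a) }
      where
      β    = proj₁ (potential π (AllPairs-pos< unique) (All.tabulate (λ e∈ → e∈)))
      cons : Consistent β π
      cons = proj₂ (potential π (AllPairs-pos< unique) (All.tabulate (λ e∈ → e∈)))
      N    = length π
      y : ℕ → ℕ
      -- As `p a b` is at most `N`, this shift makes the truncated subtraction in `x` exact.
      y b = β b + 2 * N
      Partner : ℕ → Set
      Partner a = Dec (∃ λ b → b ∈ π × P a < P b × b < a)
      partner? : ∀ a → Partner a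
      partner? a = any∈? (λ b → (P a <? P b) ×-dec (b <? a)) π
      x : ∀ a → Partner a → ℕ
      x a (yes (b , _)) = y b ∸ 2 * p a b
      x a (no _)        = 0
      meet : ∀ a (d : Partner a) {b} → Inv a b → x a d + 2 * p a b ≡ y b
      meet a (no none) (inv q r b∈) = ⊥-elim (none (_ , b∈ , q , r))
      meet a (yes (b₀ , b₀∈ , q , r)) {b} i@(inv _ _ b∈) = +-cancelʳ-≡ (2 * p a b₀) _ _ (begin
        (y b₀ ∸ 2 * p a b₀) + 2 * p a b + 2 * p a b₀   ≡⟨ shuffle (y b₀ ∸ 2 * p a b₀) (p a b) (p a b₀) ⟩
        ((y b₀ ∸ 2 * p a b₀) + 2 * p a b₀) + 2 * p a b ≡⟨ cong (_+ 2 * p a b) (m∸n+n≡m bound) ⟩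
        β b₀ + 2 * N + 2 * p a b                       ≡⟨ shuffle (β b₀) N (p a b) ⟩
        β b₀ + 2 * p a b + 2 * N                       ≡⟨ cong (_+ 2 * N) (cons b₀∈ b∈ (inv q r b₀∈) i) ⟩
        β b + 2 * p a b₀ + 2 * N                       ≡⟨ shuffle (β b) (p a b₀) N ⟩
        y b + 2 * p a b₀                               ∎)
        where
        open ≡-Reasoning
        shuffle : ∀ u v w → u + 2 * v + 2 * w ≡ u + 2 * w + 2 * v
        shuffle = solve-∀
        bound : 2 * p a b₀ ≤ y b₀
        bound = ≤-trans (*-monoʳ-≤ 2 (Σ-⟦⟧≤length (ℓ a b₀) π)) (m≤n+m (2 * N) (β b₀))

  module _ (no-bad : ∀ {w x y z} → ¬ Bad w x y z) where

    acyclicʳ : ∀ {a x y z} → Inv a x → Inv a y → Inv a z → x ⊲ y → y ⊲ z → z < x → x < y →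
      lr x ≡ false → lr y ≡ true → ⊥
    acyclicʳ (inv a⊲x _ x∈) (inv a⊲y y<a y∈) (inv _ _ z∈) x⊲y y⊲z z<x x<y r l =
      no-bad (bad (⊲⇒∈ a⊲y y∈) x∈ y∈ z∈ a⊲x x⊲y y⊲z z<x x<y y<a r l)

    module RLine (a : ℕ) = OnLine (Inv a) acyclicʳ

    ℓ-right⁻ : ∀ {a b e} → Inv a b → a ⊲ e → T (ℓ a b e) → e < a × e ⊏ b
    ℓ-right⁻ {a} {b} {e} (inv a⊲b b<a _) a⊲e h with ⊲-cmp e b
    ... | tri≈ _ refl _ rewrite ℓ-there a⊲b = ⊥-elim h
    ... | tri> _ _ b⊲e rewrite ℓ-after a⊲b b⊲e with h₁ , h₂ ← T-∧⁻ {e <ᵇ b} h =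
      <-trans (<ᵇ⇒< e b h₁) b<a , inj₂ (b⊲e , <ᵇ⇒< e b h₁ , not-true⇒ (T⇒≡ h₂))
    ... | tri< e⊲b _ _ rewrite ℓ-between a⊲e e⊲b with T-∨⁻ {e <ᵇ b} h
    ...   | inj₁ h₁ = <-trans (<ᵇ⇒< e b h₁) b<a , inj₁ (e⊲b , inj₁ (<ᵇ⇒< e b h₁))
    ...   | inj₂ h₂ with h₃ , h₄ ← T-∧⁻ {e <ᵇ a} h₂ = <ᵇ⇒< e a h₃ , inj₁ (e⊲b , inj₂ (T⇒≡ h₄))

    ℓ-right⁺ : ∀ {a b e} → Inv a b → a ⊲ e → e < a → e ⊏ b → T (ℓ a b e)
    ℓ-right⁺ {a} {b} {e} _ a⊲e e<a (inj₁ (e⊲b , inj₁ e<b)) rewrite ℓ-between a⊲e e⊲b = T-∨ˡ {e <ᵇ b} (<⇒<ᵇ e<b)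
    ℓ-right⁺ {a} {b} {e} _ a⊲e e<a (inj₁ (e⊲b , inj₂ l)) rewrite ℓ-between a⊲e e⊲b =
      T-∨ʳ {e <ᵇ b} (∧-T {e <ᵇ a} (<⇒<ᵇ e<a) (≡⇒T l))
    ℓ-right⁺ {a} {b} {e} (inv a⊲b _ _) a⊲e e<a (inj₂ (b⊲e , e<b , r)) rewrite ℓ-after a⊲b b⊲e =
      ∧-T {e <ᵇ b} (<⇒<ᵇ e<b) (≡⇒T (cong not r))

    -- The elements left of the first crossing are among those left of the second. Those preceding
    -- `a` are the same for both; for the others this is transitivity of `⊏`, available because
    -- there is no bad pattern. The element `b` makes the inclusion strict.
    p-mono : ∀ {a b b′} → Inv a b → Inv a b′ → b ⊏ b′ → p a b < p a b′
    p-mono {a} {b} {b′} i@(inv a⊲b b<a b∈) j@(inv a⊲b′ _ _) b⊏b′ =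
      Σ-mono-< π (λ e e∈ → ⟦⟧-mono (implies e e∈)) b b∈
        (⟦⟧-mono-< (ℓ-there a⊲b) (ℓ-right⁺ j a⊲b b<a b⊏b′))
      where
      implies : ∀ e → e ∈ π → T (ℓ a b e) → T (ℓ a b′ e)
      implies e e∈ h with ⊲-cmp e a
      ... | tri< e⊲a _ _ = subst T (trans (ℓ-before e⊲a a⊲b) (sym (ℓ-before e⊲a a⊲b′))) h
      ... | tri≈ _ refl _ = ⊥-elim (≡⇒¬T (ℓ-here a⊲b) h)
      ... | tri> _ _ a⊲e with e<a , e⊏b ← ℓ-right⁻ i a⊲e h =
        ℓ-right⁺ j a⊲e e<a (RLine.⊏-trans a (inv a⊲e e<a e∈) i j e⊏b b⊏b′)

    -- On the L-segment of `c` the order of crossings is `⊏` for the reversed orders: `a ⊏ᴿ a′` says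
    -- that `c` meets `a` before `a′`.
    module Reversed = TwoOrders (flip _⊲_) (flip _<_) (flip <-trans) (flip-cmp ⊲-cmp) (flip <-trans) (flip-cmp <-cmp) (_∈ π)
    open Reversed.WithMarking (not ∘ lr) using () renaming (_⊏_ to _⊏ᴿ_)

    acyclicˡ : ∀ {c x y z} → Inv x c → Inv y c → Inv z c → y ⊲ x → z ⊲ y → x < z → y < x →
      not (lr x) ≡ false → not (lr y) ≡ true → ⊥
    acyclicˡ (inv x⊲c c<x c∈) (inv y⊲c c<y _) (inv z⊲c c<z _) y⊲x z⊲y x<z y<x r l =
      no-bad (bad (⊲⇒∈ z⊲c c∈) (⊲⇒∈ y⊲c c∈) (⊲⇒∈ x⊲c c∈) c∈ z⊲y y⊲x x⊲c c<y y<x x<z (not-true⇒ l) (not-false⇒ r))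

    module LLine (c : ℕ) = Reversed.WithMarking.OnLine (not ∘ lr) (λ a → Inv a c) acyclicˡ

    ℓ-left⁻ : ∀ {a c e} → Inv a c → e ⊲ c → c < e → T (ℓ a c e) → a ⊏ᴿ e
    ℓ-left⁻ {a} {c} {e} (inv a⊲c c<a _) e⊲c c<e h with ⊲-cmp e a
    ... | tri≈ _ refl _ rewrite ℓ-here a⊲c = ⊥-elim h
    ... | tri< e⊲a _ _ rewrite ℓ-before e⊲a a⊲c with T-∨⁻ {e <ᵇ a} h
    ...   | inj₁ h₁ = inj₁ (e⊲a , inj₁ (<ᵇ⇒< e a h₁))
    ...   | inj₂ h₂ = inj₁ (e⊲a , inj₂ (T⇒≡ h₂))
    ℓ-left⁻ {a} {c} {e} (inv a⊲c c<a _) e⊲c c<e h | tri> _ _ a⊲e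
      rewrite ℓ-between a⊲e e⊲c | ≤⇒<ᵇ≡false (<⇒≤ c<e) with h₃ , h₄ ← T-∧⁻ {e <ᵇ a} h =
        inj₂ (a⊲e , <ᵇ⇒< e a h₃ , cong not (T⇒≡ h₄))

    ℓ-left⁺ : ∀ {a c e} → Inv a c → e ⊲ c → a ⊏ᴿ e → T (ℓ a c e)
    ℓ-left⁺ {a} {c} {e} (inv a⊲c _ _) e⊲c (inj₁ (e⊲a , inj₁ e<a)) rewrite ℓ-before e⊲a a⊲c =
      T-∨ˡ {e <ᵇ a} (<⇒<ᵇ e<a)
    ℓ-left⁺ {a} {c} {e} (inv a⊲c _ _) e⊲c (inj₁ (e⊲a , inj₂ r)) rewrite ℓ-before e⊲a a⊲c =
      T-∨ʳ {e <ᵇ a} (≡⇒T r)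
    ℓ-left⁺ {a} {c} {e} (inv a⊲c _ _) e⊲c (inj₂ (a⊲e , e<a , l)) rewrite ℓ-between a⊲e e⊲c =
      T-∨ʳ {e <ᵇ c} (∧-T {e <ᵇ a} (<⇒<ᵇ e<a) (≡⇒T (not-false⇒ l)))

    ℓ-left-below : ∀ {a c e} → Inv a c → e ⊲ c → e < c → T (ℓ a c e)
    ℓ-left-below {a} {c} {e} (inv a⊲c c<a _) e⊲c e<c with ⊲-cmp e a
    ... | tri≈ _ refl _ = ⊥-elim (<-asym e<c c<a)
    ... | tri< e⊲a _ _ rewrite ℓ-before e⊲a a⊲c = T-∨ˡ {e <ᵇ a} (<⇒<ᵇ (<-trans e<c c<a))
    ... | tri> _ _ a⊲e rewrite ℓ-between a⊲e e⊲c = T-∨ˡ {e <ᵇ c} (<⇒<ᵇ e<c)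

    -- An element preceding `c` and below it is left of every crossing of `c`, one behind `c` is on
    -- the same side of all of them, and for the rest `ℓ` is the order `⊏ᴿ`. So going down the
    -- L-segment only removes elements from the left; `a′` itself is removed.
    p-antimono : ∀ {a a′ c} → Inv a c → Inv a′ c → a ⊏ᴿ a′ → p a′ c < p a c
    p-antimono {a} {a′} {c} i@(inv a⊲c c<a c∈) j@(inv a′⊲c c<a′ _) a⊏a′ =
      Σ-mono-< π (λ e e∈ → ⟦⟧-mono (implies e e∈)) a′ (⊲⇒∈ a′⊲c c∈)
        (⟦⟧-mono-< (ℓ-here a′⊲c) (ℓ-left⁺ i a′⊲c a⊏a′))
      where
      implies : ∀ e → e ∈ π → T (ℓ a′ c e) → T (ℓ a c e)
      implies e e∈ h with ⊲-cmp e c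
      ... | tri> _ _ c⊲e = subst T (trans (ℓ-after a′⊲c c⊲e) (sym (ℓ-after a⊲c c⊲e))) h
      ... | tri≈ _ refl _ = ⊥-elim (≡⇒¬T (ℓ-there a′⊲c) h)
      ... | tri< e⊲c _ _ with <-cmp e c
      ...   | tri< e<c _ _ = ℓ-left-below i e⊲c e<c
      ...   | tri≈ _ refl _ = ⊥-elim (<-irrefl refl e⊲c)
      ...   | tri> _ _ c<e = ℓ-left⁺ i e⊲c (LLine.⊏-trans c i j (inv e⊲c c<e c∈) a⊏a′ (ℓ-left⁻ j e⊲c c<e h))

    module FromLines (x y : ℕ → ℕ) (meet : ∀ {a b} → Inv a b → x a + 2 * p a b ≡ y b) where

      t : ℕ → ℕ → ℕ
      t a b = x a + p a b

      t-L : ∀ {a b} → Inv a b → t a b + p a b ≡ y b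
      t-L {a} {b} i = trans (double (x a) (p a b)) (meet i)
        where
        double : ∀ u v → u + v + v ≡ u + 2 * v
        double = solve-∀

      t-mono : ∀ {a b b′} → Inv a b → Inv a b′ → b ⊏ b′ → t a b < t a b′
      t-mono {a} i j b⊏b′ = +-monoʳ-< (x a) (p-mono i j b⊏b′)

      -- Time + position is fixed on the line of `c`, so a falling position forces a rising time.
      t-monoˡ : ∀ {a a′ c} → Inv a c → Inv a′ c → a ⊏ᴿ a′ → t a c < t a′ c
      t-monoˡ {a} {a′} {c} i j a⊏a′ = +-cancelʳ-< (p a c) _ _ (begin-strict
        t a c + p a c   ≡⟨ trans (t-L i) (sym (t-L j)) ⟩
        t a′ c + p a′ c <⟨ +-monoʳ-< (t a′ c) (p-antimono i j a⊏a′) ⟩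
        t a′ c + p a c  ∎)
        where open ≤-Reasoning

      open Timing π unique lr t

      times : Times
      times = record
        { t312 = λ a⊲b b⊲c c∈ b<c c<a →
            t-mono (inv a⊲b (<-trans b<c c<a) (⊲⇒∈ b⊲c c∈)) (inv (<-trans a⊲b b⊲c) c<a c∈) (inj₁ (b⊲c , inj₁ b<c))
        ; t231 = λ a⊲b b⊲c c∈ c<a a<b →
            t-monoˡ (inv b⊲c (<-trans c<a a<b) c∈) (inv (<-trans a⊲b b⊲c) c<a c∈) (inj₁ (a⊲b , inj₁ a<b))
        ; t321ˡ = λ a⊲b b⊲c c∈ c<b b<a l →
            t-mono (inv a⊲b b<a (⊲⇒∈ b⊲c c∈)) (inv (<-trans a⊲b b⊲c) (<-trans c<b b<a) c∈) (inj₁ (b⊲c , inj₂ l)) ,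
            t-monoˡ (inv (<-trans a⊲b b⊲c) (<-trans c<b b<a) c∈) (inv b⊲c c<b c∈) (inj₂ (a⊲b , b<a , cong not l))
        ; t321ʳ = λ a⊲b b⊲c c∈ c<b b<a r →
            t-monoˡ (inv b⊲c c<b c∈) (inv (<-trans a⊲b b⊲c) (<-trans c<b b<a) c∈) (inj₁ (a⊲b , inj₂ (cong not r))) ,
            t-mono (inv (<-trans a⊲b b⊲c) (<-trans c<b b<a) c∈) (inv a⊲b b<a (⊲⇒∈ b⊲c c∈)) (inj₂ (b⊲c , c<b , r))
        }

-- Segments of a tangle

-- The working form of "at most one segment": `Runs` derives the uniqueness of maximal runs from it,
-- and conversely it from uniqueness if moving is decidable.
Convex : (ℕ → Set) → ℕ → Set
Convex Mv m = ∀ {u v w} → u ≤ w → w ≤ v → v < m → Mv u → Mv v → Mv w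

AtMostOneRun : (ℕ → Set) → ℕ → Set
AtMostOneRun Mv m = ∀ s e s′ e′ → MaxRun Mv m s e → MaxRun Mv m s′ e′ → s ≡ s′ × e ≡ e′

module Runs (Mv : ℕ → Set) (m : ℕ) where

  convex⇒one-run : Convex Mv m → AtMostOneRun Mv m
  convex⇒one-run convex s e s′ e′ r r′ = ≤-antisym (start r r′) (start r′ r) , ≤-antisym (end r′ r) (end r r′)
    where
    start : ∀ {s e s′ e′} → MaxRun Mv m s e → MaxRun Mv m s′ e′ → s ≤ s′
    start {zero} _ _ = z≤n
    start {suc s} {e} {s′} {e′} (s≤e , e<m , in-run , first , _) (s′≤e′ , _ , in-run′ , _ , _) with <-≤-connex s s′
    ... | inj₁ s<s′ = s<s′
    ... | inj₂ s′≤s = ⊥-elim (first s refl (convex s′≤s (n≤1+n s) (≤-<-trans s≤e e<m) (in-run′ s′ ≤-refl s′≤e′) (in-run (suc s) ≤-refl s≤e)))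
    end : ∀ {s e s′ e′} → MaxRun Mv m s e → MaxRun Mv m s′ e′ → e′ ≤ e
    end {s} {e} {s′} {e′} (s≤e , _ , in-run , _ , last) (s′≤e′ , e′<m , in-run′ , _ , _) with <-≤-connex e e′
    ... | inj₂ e′≤e = e′≤e
    ... | inj₁ e<e′ = ⊥-elim (last (≤-<-trans e<e′ e′<m)
            (convex (n≤1+n e) e<e′ e′<m (in-run e s≤e ≤-refl) (in-run′ e′ s′≤e′ ≤-refl)))

  module _ (Mv? : ∀ {w} → w < m → Dec (Mv w)) where

    run-start : ∀ u → u < m → Mv u → ∃ λ s → s ≤ u × (∀ w → s ≤ w → w ≤ u → Mv w) × (∀ s′ → suc s′ ≡ s → ¬ Mv s′)
    run-start zero _ mv = 0 , z≤n , (λ { zero _ _ → mv }) , λ _ ()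
    run-start (suc u) lt mv with Mv? (<⇒≤ lt)
    ... | no ¬mv = suc u , ≤-refl , (λ w p q → subst Mv (≤-antisym p q) mv) , λ { _ refl → ¬mv }
    ... | yes mv′ with s , s≤u , all , first ← run-start u (<⇒≤ lt) mv′ = s , ≤-trans s≤u (n≤1+n u) , all′ , first
      where
      all′ : ∀ w → s ≤ w → w ≤ suc u → Mv w
      all′ w p q with m≤n⇒m<n∨m≡n q
      ... | inj₁ w<1+u = all w p (≤-pred w<1+u)
      ... | inj₂ refl = mv

    run-end : ∀ k u → u + suc k ≡ m → Mv u →
      ∃ λ e → u ≤ e × e < m × (∀ w → u ≤ w → w ≤ e → Mv w) × (suc e < m → ¬ Mv (suc e))
    run-end zero u eq mv = u , ≤-refl , ≤-reflexive u+1≡m , (λ w p q → subst Mv (≤-antisym p q) mv) ,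
      λ lt → ⊥-elim (<-irrefl u+1≡m lt)
      where u+1≡m = trans (+-comm 1 u) eq
    run-end (suc k) u eq mv with Mv? (subst (suc u <_) (trans (sym (+-suc u (suc k))) eq) (m<m+n (suc u) (s≤s z≤n)))
    ... | no ¬mv = u , ≤-refl , subst (u <_) eq (m<m+n u (s≤s z≤n)) , (λ w p q → subst Mv (≤-antisym p q) mv) , λ _ → ¬mv
    ... | yes mv′ with e , u<e , e<m , all , last ← run-end k (suc u) (trans (sym (+-suc u (suc k))) eq) mv′ =
      e , <⇒≤ u<e , e<m , all′ , last
      where
      all′ : ∀ w → u ≤ w → w ≤ e → Mv w
      all′ w p q with m≤n⇒m<n∨m≡n p
      ... | inj₁ u<w = all w u<w q
      ... | inj₂ refl = mv

    run-around : ∀ {u} → u < m → Mv u → ∃ λ s → ∃ λ e → s ≤ u × u ≤ e × MaxRun Mv m s e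
    run-around {u} u<m mv
      with s , s≤u , all , first ← run-start u u<m mv
      with e , u≤e , e<m , all′ , last ← run-end (m ∸ suc u) u (trans (+-suc u _) (m+[n∸m]≡n u<m)) mv =
        s , e , s≤u , u≤e , ≤-trans s≤u u≤e , e<m , all″ , first , last
      where
      all″ : ∀ w → s ≤ w → w ≤ e → Mv w
      all″ w p q = [ all w p , (λ u≤w → all′ w u≤w q) ]′ (≤-total w u)

    one-run⇒convex : AtMostOneRun Mv m → Convex Mv m
    one-run⇒convex unique u≤w w≤v v<m mu mv
      with s , e , s≤u , u≤e , run@(_ , _ , all , _) ← run-around (≤-<-trans (≤-trans u≤w w≤v) v<m) mu
      with s′ , e′ , s′≤v , v≤e′ , run′ ← run-around v<m mv
      with refl , refl ← unique s e s′ e′ run run′ = all _ (≤-trans s≤u u≤w) (≤-trans w≤v v≤e′)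

-- A bound f (w + 1) − f w ≤ g (w + 1) − g w on increments, written without subtraction.
module Increments (f g : ℕ → ℕ) (m : ℕ) (bounded : ∀ {w} → w < m → f (suc w) + g w ≤ f w + g (suc w)) where

  increment : ∀ k u → u + k ≤ m → f (u + k) + g u ≤ f u + g (u + k)
  increment zero u le rewrite +-identityʳ u = ≤-refl
  increment (suc k) u le rewrite +-suc u k = +-cancelʳ-≤ (f (u + k) + g (u + k)) _ _ (begin
    f (suc (u + k)) + g u + (f (u + k) + g (u + k))  ≡⟨ rearrange (f (suc (u + k))) (g u) (f (u + k)) (g (u + k)) ⟩
    (f (suc (u + k)) + g (u + k)) + (f (u + k) + g u)  ≤⟨ +-mono-≤ (bounded le) (increment k u (<⇒≤ le)) ⟩
    (f (u + k) + g (suc (u + k))) + (f u + g (u + k)) ≡⟨ rearrange′ (f (u + k)) (g (suc (u + k))) (f u) (g (u + k)) ⟩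
    f u + g (suc (u + k)) + (f (u + k) + g (u + k)) ∎)
    where
    open ≤-Reasoning
    rearrange : ∀ a b c d → a + b + (c + d) ≡ (a + d) + (c + b)
    rearrange = solve-∀
    rearrange′ : ∀ a b c d → (a + b) + (c + d) ≡ c + b + (a + d)
    rearrange′ = solve-∀

  increment-≤ : ∀ {u v} → u ≤ v → v ≤ m → f v + g u ≤ f u + g v
  increment-≤ {u} {v} u≤v v≤m = subst (λ z → f z + g u ≤ f u + g z) (m+[n∸m]≡n u≤v)
    (increment (v ∸ u) u (≤-trans (≤-reflexive (m+[n∸m]≡n u≤v)) v≤m))

  -- Equality over the whole interval leaves no slack in any step: a path found on one and the same
  -- line at both ends cannot leave it in between.
  tight : ∀ {u v w} → u ≤ w → w < v → v ≤ m → f v + g u ≡ f u + g v → f (suc w) + g w ≡ f w + g (suc w)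
  tight {u} {v} {w} u≤w w<v v≤m eq = ≤-antisym (bounded (<-≤-trans w<v v≤m)) (+-cancelʳ-≤ ((f u + g w) + (f (suc w) + g v)) _ _ (begin
    f w + g (suc w) + ((f u + g w) + (f (suc w) + g v))   ≡⟨ rearrange₁ (f w) (g (suc w)) (f u) (g w) (f (suc w)) (g v) ⟩
    (f u + g v) + (f w + (g (suc w) + (g w + f (suc w)))) ≡⟨ cong (_+ (f w + (g (suc w) + (g w + f (suc w))))) eq ⟨
    (f v + g u) + (f w + (g (suc w) + (g w + f (suc w)))) ≡⟨ rearrange₂ (f v) (g u) (f w) (g (suc w)) (g w) (f (suc w)) ⟩
    (f (suc w) + g w) + ((f w + g u) + (f v + g (suc w))) ≤⟨ +-monoʳ-≤ (f (suc w) + g w)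
                                                              (+-mono-≤ (increment-≤ u≤w (<⇒≤ (<-≤-trans w<v v≤m))) (increment-≤ w<v v≤m)) ⟩
    (f (suc w) + g w) + ((f u + g w) + (f (suc w) + g v)) ∎))
    where
    open ≤-Reasoning
    rearrange₁ : ∀ a b c d e h → a + b + ((c + d) + (e + h)) ≡ (c + h) + (a + (b + (d + e)))
    rearrange₁ = solve-∀
    rearrange₂ : ∀ a b c d e h → (a + b) + (c + (d + (e + h))) ≡ (h + e) + ((c + b) + (a + d))
    rearrange₂ = solve-∀

telescope : ∀ (f g : ℕ → ℕ) k u → (∀ w → u ≤ w → w < u + k → f (suc w) + g w ≡ f w + g (suc w)) →
  f (u + k) + g u ≡ f u + g (u + k)
telescope f g zero u h rewrite +-identityʳ u = refl
telescope f g (suc k) u h rewrite +-suc u k = +-cancelʳ-≡ (f (u + k) + g (u + k)) _ _ (begin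
  f (suc (u + k)) + g u + (f (u + k) + g (u + k))    ≡⟨ rearrange (f (suc (u + k))) (g u) (f (u + k)) (g (u + k)) ⟩
  (f (suc (u + k)) + g (u + k)) + (f (u + k) + g u)  ≡⟨ cong₂ _+_ (h (u + k) (m≤m+n u k) ≤-refl)
                                                         (telescope f g k u (λ w p q → h w p (<-trans q (n<1+n _)))) ⟩
  (f (u + k) + g (suc (u + k))) + (f u + g (u + k))  ≡⟨ rearrange′ (f (u + k)) (g (suc (u + k))) (f u) (g (u + k)) ⟩
  f u + g (suc (u + k)) + (f (u + k) + g (u + k)) ∎)
  where
  open ≡-Reasoning
  rearrange : ∀ a b c d → a + b + (c + d) ≡ (a + d) + (c + b)
  rearrange = solve-∀
  rearrange′ : ∀ a b c d → (a + b) + (c + d) ≡ c + b + (a + d)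
  rearrange′ = solve-∀

module TangleOf (π : List ℕ) (unique : Unique π) (τ : Tangle) (start : perm τ 0 ≡ π) where

  q : ℕ → ℕ → ℕ
  q s x = pos (perm τ s) x

  step : ∀ {s} → s < len τ → ∃ λ fs → Swaps fs (perm τ s) (perm τ (suc s))
  step {s} s<m = Adjacent⇒Swaps (adj τ s s<m)

  perm-↭ : ∀ s → s ≤ len τ → π ↭ perm τ s
  perm-↭ zero    _  = subst (π ↭_) (sym start) ↭-refl
  perm-↭ (suc s) le = ↭-trans (perm-↭ s (<⇒≤ le)) (Swaps⇒↭ (proj₂ (step le)))

  unique-at : ∀ {s} → s ≤ len τ → Unique (perm τ s)
  unique-at le = Unique-resp-↭ (perm-↭ _ le) unique

  ∈-at : ∀ {s x} → s ≤ len τ → x ∈ π → x ∈ perm τ s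
  ∈-at le = ∈-resp-↭ (perm-↭ _ le)

  ∈-back : ∀ {s x} → s ≤ len τ → x ∈ perm τ s → x ∈ π
  ∈-back le = ∈-resp-↭ (↭-sym (perm-↭ _ le))

  CrossesAt : ℕ → ℕ → ℕ → Set
  CrossesAt s x y = Cross (perm τ s) (perm τ (suc s)) x y

  cross-pos : ∀ {s x y} → s < len τ → CrossesAt s x y → q (suc s) x ≡ suc (q s x) × q s y ≡ suc (q s x) × q (suc s) y ≡ q s x
  cross-pos lt = Swaps-cross (unique-at (<⇒≤ lt)) (proj₂ (step lt))

  -- Two elements crossed by x during the same step would be at the same position.
  cross-uniqueʳ : ∀ {s x y y′} → s < len τ → CrossesAt s x y → CrossesAt s x y′ → y ≡ y′
  cross-uniqueʳ {s} lt c c′ = pos-injective (perm τ s) (trans (proj₁ (proj₂ (cross-pos lt c))) (sym (proj₁ (proj₂ (cross-pos lt c′)))))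

  cross-uniqueˡ : ∀ {s x x′ y} → s < len τ → CrossesAt s x y → CrossesAt s x′ y → x ≡ x′
  cross-uniqueˡ {s} lt c c′ = pos-injective (perm τ s) (trans (sym (proj₂ (proj₂ (cross-pos lt c)))) (proj₂ (proj₂ (cross-pos lt c′))))

  cross-one-way : ∀ {s x y z} → s < len τ → CrossesAt s x y → CrossesAt s y z → ⊥
  cross-one-way {s} {x} {y} lt c c′ = <-asym (subst (_< q s y) (sym (proj₂ (proj₂ (cross-pos lt c)))) (proj₁ c))
    (subst (q s y <_) (sym (proj₁ (cross-pos lt c′))) (n<1+n _))

  right⇒cross : ∀ {s x} → s < len τ → q s x < q (suc s) x → ∃ λ y → y ∈ π × CrossesAt s x y
  right⇒cross {s} {x} lt p with Swaps-moves (unique-at (<⇒≤ lt)) (proj₂ (step lt)) x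
  ... | inj₁ eq = ⊥-elim (<-irrefl (sym eq) p)
  ... | inj₂ (inj₁ (y , y∈ , c)) = y , ∈-back (<⇒≤ lt) y∈ , c
  ... | inj₂ (inj₂ (y , _ , c)) with a , b , d ← cross-pos lt c =
    ⊥-elim (<-asym p (subst₂ _<_ (sym d) (sym b) (n<1+n _)))

  left⇒cross : ∀ {s x} → s < len τ → q (suc s) x < q s x → ∃ λ y → y ∈ π × CrossesAt s y x
  left⇒cross {s} {x} lt p with Swaps-moves (unique-at (<⇒≤ lt)) (proj₂ (step lt)) x
  ... | inj₁ eq = ⊥-elim (<-irrefl eq p)
  ... | inj₂ (inj₂ (y , y∈ , c)) = y , ∈-back (<⇒≤ lt) y∈ , c
  ... | inj₂ (inj₁ (y , _ , c)) with a , _ ← cross-pos lt c =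
    ⊥-elim (<-asym p (subst (q s x <_) (sym a) (n<1+n _)))

  cross⇒right : ∀ {s x y} → s < len τ → CrossesAt s x y → q s x < q (suc s) x
  cross⇒right {s} {x} lt c = subst (q s x <_) (sym (proj₁ (cross-pos lt c))) (n<1+n _)

  cross⇒left : ∀ {s x y} → s < len τ → CrossesAt s x y → q (suc s) y < q s y
  cross⇒left lt c with _ , b , d ← cross-pos lt c = subst₂ _<_ (sym d) (sym b) (n<1+n _)

  right-step : ∀ {s} x → s < len τ → q s x < q (suc s) x → q (suc s) x + s ≡ q s x + suc s
  right-step {s} x lt p with _ , _ , c ← right⇒cross lt p = trans (cong (_+ s) (proj₁ (cross-pos lt c))) (sym (+-suc _ s))

  left-step : ∀ {s} x → s < len τ → q (suc s) x < q s x → q s x + s ≡ q (suc s) x + suc s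
  left-step {s} x lt p with _ , _ , c ← left⇒cross lt p with _ , b , d ← cross-pos lt c =
    trans (cong (_+ s) (trans b (cong suc (sym d)))) (sym (+-suc _ s))

  at-most-right : ∀ x {s} → s < len τ → q (suc s) x + s ≤ q s x + suc s
  at-most-right x {s} lt with <-≤-connex (q s x) (q (suc s) x)
  ... | inj₁ p = ≤-reflexive (right-step x lt p)
  ... | inj₂ p = +-mono-≤ p (n≤1+n s)

  at-most-left : ∀ x {s} → s < len τ → 0 + (q s x + s) ≤ 0 + (q (suc s) x + suc s)
  at-most-left x {s} lt with <-≤-connex (q (suc s) x) (q s x)
  ... | inj₁ p = ≤-reflexive (left-step x lt p)
  ... | inj₂ p = +-mono-≤ p (n≤1+n s)

  MovesRight⇒ : ∀ {s x} → s < len τ → MovesRight τ x s → q s x < q (suc s) x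
  MovesRight⇒ lt (p , p′ , at , at′ , p<p′) = subst₂ _<_ (sym (At⇒pos p (unique-at (<⇒≤ lt)) at)) (sym (At⇒pos p′ (unique-at lt) at′)) p<p′

  MovesLeft⇒ : ∀ {s x} → s < len τ → MovesLeft τ x s → q (suc s) x < q s x
  MovesLeft⇒ lt (p , p′ , at , at′ , p′<p) = subst₂ _<_ (sym (At⇒pos p′ (unique-at lt) at′)) (sym (At⇒pos p (unique-at (<⇒≤ lt)) at)) p′<p

  MovesRight-∈ : ∀ {s x} → s < len τ → MovesRight τ x s → x ∈ π
  MovesRight-∈ {s} lt (p , _ , at , _) = ∈-back (<⇒≤ lt) (At⇒∈ (perm τ s) p at)

  MovesLeft-∈ : ∀ {s x} → s < len τ → MovesLeft τ x s → x ∈ π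
  MovesLeft-∈ {s} lt (p , _ , at , _) = ∈-back (<⇒≤ lt) (At⇒∈ (perm τ s) p at)

  ⇒MovesRight : ∀ {s x} → x ∈ π → s < len τ → q s x < q (suc s) x → MovesRight τ x s
  ⇒MovesRight x∈ lt p = _ , _ , ∈⇒At-pos _ (∈-at (<⇒≤ lt) x∈) , ∈⇒At-pos _ (∈-at lt x∈) , p

  ⇒MovesLeft : ∀ {s x} → x ∈ π → s < len τ → q (suc s) x < q s x → MovesLeft τ x s
  ⇒MovesLeft x∈ lt p = _ , _ , ∈⇒At-pos _ (∈-at (<⇒≤ lt) x∈) , ∈⇒At-pos _ (∈-at lt x∈) , p

-- From crossing times to a tangle

AllPairs-range : ∀ n → AllPairs _<_ (range n)
AllPairs-range n = AllPairs.map⁺ (AllPairs.applyUpTo⁺₁ (λ i → i) n (λ i<j _ → s≤s i<j))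

increasing-unique : ∀ {xs ys} → AllPairs _<_ xs → AllPairs _<_ ys → xs ↭ ys → xs ≡ ys
increasing-unique p q r = Pointwise-≡⇒≡ (↗↭↗⇒≋ ≤-totalOrder (sorted p) (sorted q) (↭⇒↭ₛ r))
  where
  sorted : ∀ {xs} → AllPairs _<_ xs → Linked.Linked _≤_ xs
  sorted p = Linked.map <⇒≤ (AllPairs⇒Linked p)

sorted⇒pos< : ∀ {R : ℕ → ℕ → Set} → (∀ {x y} → R x y → R y x → ⊥) →
  ∀ {xs x y} → AllPairs R xs → x ∈ xs → y ∈ xs → R x y → pos xs x < pos xs y
sorted⇒pos< asym {z ∷ xs} {x} {y} (h ∷ s) x∈ y∈ r with z ≟ x | z ≟ y
... | yes refl | yes refl = ⊥-elim (asym r r)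
... | yes refl | no _     = z<s
... | no z≢x   | yes refl = ⊥-elim (asym r (All.lookup h (∈-tail z≢x x∈)))
... | no z≢x   | no z≢y   = s<s (sorted⇒pos< asym s (∈-tail z≢x x∈) (∈-tail z≢y y∈) r)

∈⇒≤Σ : ∀ (f : ℕ → ℕ) {xs e} → e ∈ xs → f e ≤ Σ⟨ xs ⟩ f
∈⇒≤Σ f {x ∷ xs} (here refl) = m≤m+n (f x) _
∈⇒≤Σ f {x ∷ xs} (there e∈)  = ≤-trans (∈⇒≤Σ f e∈) (m≤n+m _ (f x))

module Build (n : ℕ) (π : List ℕ) (π↭ : π ↭ range n) (unique : Unique π) (lr : ℕ → Bool) (t : ℕ → ℕ → ℕ)
  (times : Timing.Times π unique lr t) where
  open Position π
  open Marked lr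
  open Timing π unique lr t

  Meets : ℕ → ℕ → ℕ → Set
  Meets s x y = P x < P y × y < x × t x y ≡ s

  meets? : ∀ s x y → Dec (Meets s x y)
  meets? s x y = (P x <? P y) ×-dec (y <? x) ×-dec (t x y ≟ s)

  -- One pass from left to right. `sweepFrom s x` holds `x` back as a possible left partner, and
  -- after a swap both elements are passed over, so the swaps of a pass are disjoint.
  sweep : ℕ → List ℕ → List ℕ
  sweepFrom : ℕ → ℕ → List ℕ → List ℕ
  sweep s []       = []
  sweep s (x ∷ xs) = sweepFrom s x xs
  sweepFrom s x []       = x ∷ []
  sweepFrom s x (y ∷ zs) with meets? s x y
  ... | yes _ = y ∷ x ∷ sweep s zs
  ... | no _  = x ∷ sweepFrom s y zs

  sweep-Swaps : ∀ s xs → ∃ λ fs → Swaps fs xs (sweep s xs)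
  sweepFrom-Swaps : ∀ s x xs → ∃ λ fs → Swaps fs (x ∷ xs) (sweepFrom s x xs)
  sweep-Swaps s []       = _ , []
  sweep-Swaps s (x ∷ xs) = sweepFrom-Swaps s x xs
  sweepFrom-Swaps s x []       = _ , keep x []
  sweepFrom-Swaps s x (y ∷ zs) with meets? s x y
  ... | yes _ = _ , swap x y (proj₂ (sweep-Swaps s zs))
  ... | no _  = _ , keep x (proj₂ (sweepFrom-Swaps s y zs))

  sweep-↭ : ∀ s xs → xs ↭ sweep s xs
  sweep-↭ s xs = Swaps⇒↭ (proj₂ (sweep-Swaps s xs))

  sweep-sorted : ∀ s xs → All (_∈ π) xs → AllPairs (Ord s) xs → AllPairs (Ord (suc s)) (sweep s xs)
  sweepFrom-sorted : ∀ s x xs → All (_∈ π) (x ∷ xs) → AllPairs (Ord s) (x ∷ xs) → AllPairs (Ord (suc s)) (sweepFrom s x xs)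
  sweep-sorted s [] _ _ = []
  sweep-sorted s (x ∷ xs) = sweepFrom-sorted s x xs
  sweepFrom-sorted s x [] _ _ = [] ∷ []
  sweepFrom-sorted s x (y ∷ zs) (x∈ ∷ y∈ ∷ zs∈) ((x→y ∷ x→) ∷ (y→ ∷ sorted)) with meets? s x y
  ... | yes (x⊲y , y<x , refl) =
    (Ord-after-cross i ∷ All-resp-↭ (sweep-↭ s zs) (All.tabulate y→zs)) ∷
    All-resp-↭ (sweep-↭ s zs) (All.tabulate x→zs) ∷ sweep-sorted s zs zs∈ sorted
    where
    i = inv x⊲y y<x y∈
    y→zs : ∀ {z} → z ∈ zs → Ord (suc s) y z
    y→zs {z} z∈ with Ord-total (suc s) (Ord-irrefl (All.lookup y→ z∈))
    ... | inj₁ o = o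
    ... | inj₂ o with j , eq ← Ord-cross y∈ (All.lookup zs∈ z∈) (All.lookup y→ z∈) o =
      ⊥-elim (distinctᵐ times i j (sym eq))
    x→zs : ∀ {z} → z ∈ zs → Ord (suc s) x z
    x→zs {z} z∈ with Ord-total (suc s) (Ord-irrefl (All.lookup x→ z∈))
    ... | inj₁ o = o
    ... | inj₂ o with j , eq ← Ord-cross x∈ (All.lookup zs∈ z∈) (All.lookup x→ z∈) o =
      ⊥-elim (Ord-irrefl (All.lookup y→ z∈) (distinctʳ times i j (sym eq)))
  ... | no ¬meets = All-resp-↭ (sweep-↭ s (y ∷ zs)) (x→y′ ∷ All.tabulate x→zs) ∷
                    sweepFrom-sorted s y zs (y∈ ∷ zs∈) (y→ ∷ sorted)
    where
    x→y′ : Ord (suc s) x y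
    x→y′ with Ord-total (suc s) (Ord-irrefl x→y)
    ... | inj₁ o = o
    ... | inj₂ o with inv p q _ , eq ← Ord-cross x∈ y∈ x→y o = ⊥-elim (¬meets (p , q , eq))
    x→zs : ∀ {z} → z ∈ zs → Ord (suc s) x z
    x→zs {z} z∈ with Ord-total (suc s) (Ord-irrefl (All.lookup x→ z∈))
    ... | inj₁ o = o
    -- A pair due at time `s` must be adjacent: if `x` passed `z` but not the `y` between them, then
    -- `y` would pass `z` in the same step, against `distinctˡ`.
    ... | inj₂ o with z∈π ← All.lookup zs∈ z∈
      with i , eq ← Ord-cross x∈ z∈π (All.lookup x→ z∈) o
      with j , eq′ ← Ord-cross y∈ z∈π (All.lookup y→ z∈) (Ord-trans times z∈π x∈ y∈ o x→y′) =
        ⊥-elim (Ord-irrefl x→y (distinctˡ times i j (trans eq (sym eq′))))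

  perms : ℕ → List ℕ
  perms zero    = π
  perms (suc s) = sweep s (perms s)

  perms-↭ : ∀ s → π ↭ perms s
  perms-↭ zero    = ↭-refl
  perms-↭ (suc s) = ↭-trans (perms-↭ s) (sweep-↭ s (perms s))

  perms-∈ : ∀ s → All (_∈ π) (perms s)
  perms-∈ s = All.tabulate (∈-resp-↭ (↭-sym (perms-↭ s)))

  perms-sorted : ∀ s → AllPairs (Ord s) (perms s)
  perms-sorted zero    = AllPairs.map (λ p → inj₁ (p , inj₂ z≤n)) (AllPairs-pos< unique)
  perms-sorted (suc s) = sweep-sorted s (perms s) (perms-∈ s) (perms-sorted s)

  Ord⇒pos< : ∀ {s x y} → x ∈ π → y ∈ π → Ord s x y → pos (perms s) x < pos (perms s) y
  Ord⇒pos< {s} x∈ y∈ = sorted⇒pos< Ord-asym (perms-sorted s) (∈-resp-↭ (perms-↭ s) x∈) (∈-resp-↭ (perms-↭ s) y∈)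

  pos<⇒Ord : ∀ {s x y} → x ∈ π → y ∈ π → pos (perms s) x < pos (perms s) y → Ord s x y
  pos<⇒Ord {s} x∈ y∈ p with Ord-total s (λ { refl → <-irrefl refl p })
  ... | inj₁ o = o
  ... | inj₂ o = ⊥-elim (<-asym p (Ord⇒pos< y∈ x∈ o))

  module _ (m : ℕ) (late : ∀ {a b} → Inv a b → t a b < m) where

    tangle : Tangle
    tangle = record { len = m ; perm = perms ; adj = λ s _ → inj₁ (Swaps⇒ObtainedBySwaps (proj₂ (sweep-Swaps s (perms s)))) }

    solves : Solves n tangle π
    solves = refl , increasing-unique (increase (perms-∈ m) (perms-sorted m)) (AllPairs-range n) (↭-trans (↭-sym (perms-↭ m)) π↭)
      where
      final : ∀ {x y} → y ∈ π → Ord m x y → x < y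
      final y∈ (inj₁ (_ , inj₁ x<y)) = x<y
      final {x} {y} y∈ (inj₁ (x⊲y , inj₂ m≤t)) with <-cmp x y
      ... | tri< x<y _ _ = x<y
      ... | tri≈ _ refl _ = ⊥-elim (<-irrefl refl x⊲y)
      ... | tri> _ _ y<x = ⊥-elim (<⇒≱ (late (inv x⊲y y<x y∈)) m≤t)
      final y∈ (inj₂ (_ , x<y , _)) = x<y
      increase : ∀ {xs} → All (_∈ π) xs → AllPairs (Ord m) xs → AllPairs _<_ xs
      increase [] [] = []
      increase (_ ∷ xs∈) (h ∷ hs) = All.zipWith (λ (y∈ , o) → final y∈ o) (xs∈ , h) ∷ increase xs∈ hs

    open TangleOf π unique tangle refl

    crosses : ∀ {s x y} → x ∈ π → y ∈ π → CrossesAt s x y → Inv x y × t x y ≡ s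
    crosses x∈ y∈ (p , p′) = Ord-cross x∈ y∈ (pos<⇒Ord x∈ y∈ p) (pos<⇒Ord y∈ x∈ p′)

    Before⇒ : ∀ {s x y} → s ≤ m → Before (perms s) x y → x ∈ π × y ∈ π × pos (perms s) x < pos (perms s) y
    Before⇒ {s} {x} {y} le b with x∈ , y∈ ← Before⇒∈ (perms s) {x} {y} b =
      ∈-back le x∈ , ∈-back le y∈ , Before⇒pos< {perms s} (unique-at le) b

    Before-cross : ∀ {s x y} → s < m → Before (perms s) x y → Before (perms (suc s)) y x → Inv x y × t x y ≡ s
    Before-cross {s} {x} {y} lt b b′ with x∈ , y∈ , p ← Before⇒ {s} {x} {y} (<⇒≤ lt) b | _ , _ , p′ ← Before⇒ {suc s} {y} {x} lt b′ =
      crosses x∈ y∈ (p , p′)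

    simple : Simple tangle
    simple x y s₁ s₂ s₁<s₂ s₂<m c₁ c₂ with at c₁ (<-trans s₁<s₂ s₂<m) | at c₂ s₂<m
      where
      at : ∀ {s} → CrossAt tangle s x y → s < m → Inv x y × t x y ≡ s ⊎ Inv y x × t y x ≡ s
      at (inj₁ (b , b′)) lt = inj₁ (Before-cross {x = x} {y} lt b b′)
      at (inj₂ (b , b′)) lt = inj₂ (Before-cross {x = y} {x} lt b b′)
    ... | inj₁ (_ , refl) | inj₁ (_ , refl) = <-irrefl refl s₁<s₂
    ... | inj₂ (_ , refl) | inj₂ (_ , refl) = <-irrefl refl s₁<s₂
    ... | inj₁ (inv p _ _ , _) | inj₂ (inv p′ _ _ , _) = <-asym p p′
    ... | inj₂ (inv p _ _ , _) | inj₁ (inv p′ _ _ , _) = <-asym p p′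

    cross-pos-p : ∀ {a b} → Inv a b → q (t a b) a ≡ p a b
    cross-pos-p {a} {b} i = pos-at-cross times (perms-↭ (t a b)) i (Ord⇒pos< {t a b})

    module _ (x y : ℕ → ℕ) (t-R : ∀ a b → t a b ≡ x a + p a b) (t-L : ∀ {a b} → Inv a b → t a b + p a b ≡ y b) where

      -- Every step to the right is a crossing with some `b`, at time `t a b` and position `p a b`;
      -- these lie on the line of `a` by construction.
      right-line : ∀ {a s} → a ∈ π → s < m → MovesRight tangle a s → q s a + x a ≡ s
      right-line {a} {s} a∈ lt mv with b , b∈ , c ← right⇒cross {s} {a} lt (MovesRight⇒ lt mv) with i , refl ← crosses {s} a∈ b∈ c =
        trans (cong (_+ x a) (cross-pos-p i)) (trans (+-comm (p a b) (x a)) (sym (t-R a b)))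

      -- Just before the crossing `b` stands one cell to the right of `a`, at `p a b + 1`; hence the
      -- `suc`.
      left-line : ∀ {b s} → b ∈ π → s < m → MovesLeft tangle b s → q s b + s ≡ suc (y b)
      left-line {b} {s} b∈ lt mv with a , a∈ , c ← left⇒cross {s} {b} lt (MovesLeft⇒ lt mv) with i , refl ← crosses {s} a∈ b∈ c =
        trans (cong (_+ t a b) (trans (proj₁ (proj₂ (cross-pos lt c))) (cong suc (cross-pos-p i))))
              (cong suc (trans (+-comm (p a b) (t a b)) (t-L i)))

      right-convex : ∀ a → Convex (MovesRight tangle a) m
      right-convex a {u} {v} {w} u≤w w≤v v<m mu mv with m≤n⇒m<n∨m≡n w≤v
      ... | inj₂ refl = mv
      ... | inj₁ w<v = ⇒MovesRight a∈ w<m (+-cancelʳ-< w _ _ (subst (q w a + w <_) (sym tight-w) (+-monoʳ-< (q w a) (n<1+n w))))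
        where
        w<m = <-trans w<v v<m
        a∈ = MovesRight-∈ v<m mv
        open Increments (λ s → q s a) (λ s → s) m (at-most-right a)
        same-line : q v a + u ≡ q u a + v
        same-line = begin
          q v a + u             ≡⟨ cong (q v a +_) (right-line a∈ (≤-<-trans u≤w w<m) mu) ⟨
          q v a + (q u a + x a) ≡⟨ swap-first (q v a) (q u a) (x a) ⟩
          q u a + (q v a + x a) ≡⟨ cong (q u a +_) (right-line a∈ v<m mv) ⟩
          q u a + v             ∎
          where
          open ≡-Reasoning
          swap-first : ∀ i j k → i + (j + k) ≡ j + (i + k)
          swap-first = solve-∀
        tight-w : q (suc w) a + w ≡ q w a + suc w
        tight-w = tight u≤w w<v (<⇒≤ v<m) same-line

      left-convex : ∀ b → Convex (MovesLeft tangle b) m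
      left-convex b {u} {v} {w} u≤w w≤v v<m mu mv with m≤n⇒m<n∨m≡n w≤v
      ... | inj₂ refl = mv
      ... | inj₁ w<v = ⇒MovesLeft b∈ w<m (+-cancelʳ-< w _ _ (subst (q (suc w) b + w <_) (sym tight-w) (+-monoʳ-< (q (suc w) b) (n<1+n w))))
        where
        w<m = <-trans w<v v<m
        b∈ = MovesLeft-∈ v<m mv
        -- With `f` constantly 0 the bound says that position + time never decreases, that is, a
        -- path moves left by at most one cell per step.
        open Increments (λ _ → 0) (λ s → q s b + s) m (at-most-left b)
        tight-w : q w b + w ≡ q (suc w) b + suc w
        tight-w = tight u≤w w<v (<⇒≤ v<m) (trans (left-line b∈ (≤-<-trans u≤w w<m) mu) (sym (left-line b∈ v<m mv)))

      perfect : Perfect n π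
      perfect = tangle , solves , simple , λ a →
        Runs.convex⇒one-run (MovesLeft tangle a) m (left-convex a) ,
        Runs.convex⇒one-run (MovesRight tangle a) m (right-convex a)

good-balanced⇒perfect : ∀ {n π} (π↭ : π ↭ range n) (unique : Unique π) (lr : ℕ → Bool) →
  Position.Marked.Balanced π lr → (∀ {w x y z} → ¬ Position.WithMarking.Bad π lr w x y z) → Perfect n π
good-balanced⇒perfect {n} {π} π↭ unique lr bal no-bad = Build.perfect n π π↭ unique lr t times
  -- A length beyond all crossings: `t a b` is at most `t a b + p a b`, which is `y b`, a summand of
  -- this sum.
  (suc (Σ⟨ π ⟩ y)) (λ {a} {b} i → s≤s (≤-trans (m≤m+n (t a b) (p a b))
    (≤-trans (≤-reflexive (t-L i)) (∈⇒≤Σ y (Inv.member i))))) x y (λ _ _ → refl) t-L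
  where
  open Position π
  open Marked lr
  open Potential π unique lr
  open Lines (lines (additive bal))
  open FromLines no-bad x y meet

-- From a tangle to a marking

-- Λ = Ρ says that the two sides of the rectangle cut out by the four segments are equally long.
module FromTangle (n : ℕ) (π : List ℕ) (π↭ : π ↭ range n) (unique : Unique π)
  (τ : Tangle) (start : perm τ 0 ≡ π) (finish : perm τ (len τ) ≡ range n) (perfect : PerfectTangle τ) where
  open Position π
  open TangleOf π unique τ start

  simple : Simple τ
  simple = proj₁ perfect

  m : ℕ
  m = len τ

  q₀ : ∀ x → q 0 x ≡ P x
  q₀ x = cong (λ σ → pos σ x) start

  q-cmp : ∀ s x y → Tri (q s x < q s y) (x ≡ y) (q s y < q s x)
  q-cmp s x y with <-cmp (q s x) (q s y)
  ... | tri< a b c = tri< a (b ∘ cong (q s)) c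
  ... | tri≈ a b c = tri≈ a (pos-injective (perm τ s) b) c
  ... | tri> a b c = tri> a (b ∘ cong (q s)) c

  finally : ∀ {x y} → x ∈ π → y ∈ π → x < y → q m x < q m y
  finally x∈ y∈ x<y rewrite finish = sorted⇒pos< <-asym (AllPairs-range n) (∈-resp-↭ π↭ x∈) (∈-resp-↭ π↭ y∈) x<y

  Cross⇒CrossAt : ∀ {s x y} → s < m → x ∈ π → y ∈ π → CrossesAt s x y → CrossAt τ s x y
  Cross⇒CrossAt {s} lt x∈ y∈ (p , p′) =
    inj₁ (pos<⇒Before (perm τ s) (∈-at (<⇒≤ lt) y∈) p , pos<⇒Before (perm τ (suc s)) (∈-at lt x∈) p′)

  CrossAt-sym : ∀ {s x y} → CrossAt τ s x y → CrossAt τ s y x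
  CrossAt-sym (inj₁ c) = inj₂ c
  CrossAt-sym (inj₂ c) = inj₁ c

  cross-between : ∀ k u {x y} → x ≢ y → q u x < q u y → q (u + k) y < q (u + k) x →
    ∃ λ s → u ≤ s × s < u + k × CrossesAt s x y
  cross-between zero u x≢y p p′ rewrite +-identityʳ u = ⊥-elim (<-asym p p′)
  cross-between (suc k) u {x} {y} x≢y p p′ with q-cmp (suc u) x y
  ... | tri≈ _ x≡y _ = ⊥-elim (x≢y x≡y)
  ... | tri> _ _ r = u , ≤-refl , m<m+n u (s≤s z≤n) , p , r
  ... | tri< r _ _ with s , u<s , s<v , c ← cross-between k (suc u) x≢y r (subst (λ v → q v y < q v x) (+-suc u k) p′) =
    s , <⇒≤ u<s , subst (s <_) (sym (+-suc u k)) s<v , c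

  crossing : ∀ {u v x y} → u ≤ v → x ≢ y → q u x < q u y → q v y < q v x →
    ∃ λ s → u ≤ s × s < v × CrossesAt s x y
  crossing {u} {v} {x} {y} u≤v x≢y p p′ =
    subst (λ z → ∃ λ s → u ≤ s × s < z × CrossesAt s x y) (m+[n∸m]≡n u≤v)
      (cross-between (v ∸ u) u x≢y p (subst (λ z → q z y < q z x) (sym (m+[n∸m]≡n u≤v)) p′))

  crossing-time : ∀ {a b} → Inv a b → ∃ λ s → s < m × CrossesAt s a b
  crossing-time {a} {b} (inv a⊲b b<a b∈)
    with s , _ , s<m , c ← crossing z≤n (⊲⇒≢ a⊲b) (subst₂ _<_ (sym (q₀ a)) (sym (q₀ b)) a⊲b) (finally b∈ (⊲⇒∈ a⊲b b∈) b<a) =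
      s , s<m , c

  inv? : ∀ a b → Dec (Inv a b)
  inv? a b = map′ (λ (p , r , b∈) → inv p r b∈) (λ (inv p r b∈) → p , r , b∈) ((P a <? P b) ×-dec (b <? a) ×-dec (b ∈? π))

  time : ∀ {a b} → Dec (Inv a b) → ℕ
  time (yes i) = proj₁ (crossing-time i)
  time (no _)  = 0

  abstract
    t : ℕ → ℕ → ℕ
    t a b = time (inv? a b)

    t-spec : ∀ {a b} → Inv a b → t a b < m × CrossesAt (t a b) a b
    t-spec {a} {b} i with inv? a b
    ... | yes j = proj₂ (crossing-time j)
    ... | no ¬i = ⊥-elim (¬i i)

  cross-once : ∀ {s s′ x y} → x ∈ π → y ∈ π → s < m → s′ < m → CrossesAt s x y → CrossesAt s′ x y ⊎ CrossesAt s′ y x → s ≡ s′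
  cross-once {s} {s′} {x} {y} x∈ y∈ lt lt′ c c′ with <-cmp s s′ | at c′
    where
    at : CrossesAt s′ x y ⊎ CrossesAt s′ y x → CrossAt τ s′ x y
    at (inj₁ c) = Cross⇒CrossAt lt′ x∈ y∈ c
    at (inj₂ c) = CrossAt-sym {s′} {y} {x} (Cross⇒CrossAt lt′ y∈ x∈ c)
  ... | tri≈ _ eq _ | _ = eq
  ... | tri< s<s′ _ _ | d = ⊥-elim (simple x y s s′ s<s′ lt′ (Cross⇒CrossAt lt x∈ y∈ c) d)
  ... | tri> _ _ s′<s | d = ⊥-elim (simple x y s′ s s′<s lt d (Cross⇒CrossAt lt x∈ y∈ c))

  -- The final order is increasing, so a crossing of this pair would have to be undone by a second
  -- one, against simplicity.
  stay : ∀ {s x y} → s ≤ m → x ∈ π → y ∈ π → x ⊲ y → x < y → q s x < q s y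
  stay {s} {x} {y} s≤m x∈ y∈ x⊲y x<y with q-cmp s x y
  ... | tri< p _ _ = p
  ... | tri≈ _ refl _ = ⊥-elim (<-irrefl refl x<y)
  ... | tri> _ _ p
    with s₁ , _ , s₁<s , c₁ ← crossing z≤n (<⇒≢ x<y) (subst₂ _<_ (sym (q₀ x)) (sym (q₀ y)) x⊲y) p
    with s₂ , s≤s₂ , s₂<m , c₂ ← crossing s≤m (≢-sym (<⇒≢ x<y)) p (finally x∈ y∈ x<y) =
      ⊥-elim (<⇒≢ (<-≤-trans s₁<s s≤s₂) (cross-once x∈ y∈ (<-≤-trans s₁<s s≤m) s₂<m c₁ (inj₂ c₂)))

  until-cross : ∀ {s a b} → Inv a b → s ≤ t a b → q s a < q s b
  until-cross {s} {a} {b} i@(inv a⊲b b<a b∈) s≤t with t<m , c ← t-spec i with q-cmp s a b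
  ... | tri< p _ _ = p
  ... | tri≈ _ refl _ = ⊥-elim (<-irrefl refl b<a)
  ... | tri> _ _ p with s₁ , _ , s₁<s , c₁ ← crossing z≤n (⊲⇒≢ a⊲b) (subst₂ _<_ (sym (q₀ a)) (sym (q₀ b)) a⊲b) p =
    ⊥-elim (<⇒≢ (<-≤-trans s₁<s s≤t) (cross-once (⊲⇒∈ a⊲b b∈) b∈ (<-trans (<-≤-trans s₁<s s≤t) t<m) t<m c₁ (inj₁ c)))

  since-cross : ∀ {s a b} → s ≤ m → Inv a b → t a b < s → q s b < q s a
  since-cross {s} {a} {b} s≤m i@(inv a⊲b b<a b∈) t<s with t<m , c ← t-spec i with q-cmp s a b
  ... | tri> _ _ p = p
  ... | tri≈ _ refl _ = ⊥-elim (<-irrefl refl b<a)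
  ... | tri< p _ _ with s₂ , s≤s₂ , s₂<m , c₂ ← crossing s≤m (⊲⇒≢ a⊲b) p (finally b∈ (⊲⇒∈ a⊲b b∈) b<a) =
    ⊥-elim (<⇒≢ (<-≤-trans t<s s≤s₂) (cross-once (⊲⇒∈ a⊲b b∈) b∈ t<m s₂<m c (inj₁ c₂)))

  crossed : ∀ {s a b} → Inv a b → q s b < q s a → t a b < s
  crossed {s} {a} {b} i p with <-≤-connex (t a b) s
  ... | inj₁ lt = lt
  ... | inj₂ le = ⊥-elim (<-asym p (until-cross i le))

  uncrossed : ∀ {s a b} → s ≤ m → Inv a b → q s a < q s b → s ≤ t a b
  uncrossed {s} {a} {b} s≤m i p with <-≤-connex (t a b) s
  ... | inj₁ lt = ⊥-elim (<-asym p (since-cross s≤m i lt))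
  ... | inj₂ le = le

  moving-right : ∀ {a b} → Inv a b → q (t a b) a < q (suc (t a b)) a
  moving-right i with lt , c ← t-spec i = cross⇒right lt c

  moving-left : ∀ {a b} → Inv a b → q (suc (t a b)) b < q (t a b) b
  moving-left i with lt , c ← t-spec i = cross⇒left lt c

  MovesR MovesL : ℕ → ℕ → Set
  MovesR x s = q s x < q (suc s) x
  MovesL x s = q (suc s) x < q s x

  right-convex : ∀ {x} → x ∈ π → Convex (MovesR x) m
  right-convex {x} x∈ u≤w w≤v v<m mu mv = MovesRight⇒ (≤-<-trans w≤v v<m)
    (Runs.one-run⇒convex (MovesRight τ x) m
      (λ {w} lt → map′ (⇒MovesRight x∈ lt) (MovesRight⇒ lt) (q w x <? q (suc w) x))
      (proj₂ (proj₂ perfect x)) u≤w w≤v v<m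
      (⇒MovesRight x∈ (≤-<-trans (≤-trans u≤w w≤v) v<m) mu) (⇒MovesRight x∈ v<m mv))

  left-convex : ∀ {x} → x ∈ π → Convex (MovesL x) m
  left-convex {x} x∈ u≤w w≤v v<m mu mv = MovesLeft⇒ (≤-<-trans w≤v v<m)
    (Runs.one-run⇒convex (MovesLeft τ x) m
      (λ {w} lt → map′ (⇒MovesLeft x∈ lt) (MovesLeft⇒ lt) (q (suc w) x <? q w x))
      (proj₁ (proj₂ perfect x)) u≤w w≤v v<m
      (⇒MovesLeft x∈ (≤-<-trans (≤-trans u≤w w≤v) v<m) mu) (⇒MovesLeft x∈ v<m mv))

  -- The path of `b` would have a right move between two left moves or a left move between two right
  -- moves, and it cannot move both ways in one step.
  left-then-right : ∀ {a a′ b c c′} → Inv a b → Inv b c → Inv a′ b → Inv b c′ → t a b < t b c → t b c′ < t a′ b → ⊥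
  left-then-right {a} {a′} {b} {c} {c′} iA iC iA′ iC′ A<C C′<A′
    with A<m , _ ← t-spec iA | C<m , _ ← t-spec iC | A′<m , _ ← t-spec iA′
    with b∈ ← Inv.member iA
    with <-≤-connex (t a b) (t a′ b) | <-≤-connex (t a′ b) (t b c)
  ... | inj₁ A<A′ | inj₂ C≤A′ = <-asym (moving-right iC) (left-convex b∈ (<⇒≤ A<C) C≤A′ A′<m (moving-left iA) (moving-left iA′))
  ... | inj₁ A<A′ | inj₁ A′<C = <-asym (moving-left iA′) (right-convex b∈ (<⇒≤ C′<A′) (<⇒≤ A′<C) C<m (moving-right iC′) (moving-right iC))
  ... | inj₂ A′≤A | _ = <-asym (moving-left iA) (right-convex b∈ (≤-trans (<⇒≤ C′<A′) A′≤A) (<⇒≤ A<C) C<m (moving-right iC′) (moving-right iC))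

  -- A single pair of witnesses suffices to define the mark, since `left-then-right` extends the
  -- order of their crossings to all pairs.
  LeftFirst : ℕ → Set
  LeftFirst b = ∃ λ a → a ∈ π × ∃ λ c → c ∈ π × Inv a b × Inv b c × t a b < t b c

  left-first? : ∀ b → Dec (LeftFirst b)
  left-first? b = any∈? (λ a → any∈? (λ c → inv? a b ×-dec inv? b c ×-dec (t a b <? t b c)) π) π

  abstract
    lr : ℕ → Bool
    lr b = isYes (left-first? b)

    lr-true : ∀ {a b c} → Inv a b → Inv b c → lr b ≡ true → t a b < t b c
    lr-true {a} {b} {c} i j eq with left-first? b
    ... | yes (a₀ , _ , c₀ , _ , i₀ , j₀ , lt) with <-cmp (t a b) (t b c)
    ...   | tri< p _ _ = p
    ...   | tri≈ _ p _ = ⊥-elim (cross-one-way (proj₁ (t-spec i)) (proj₂ (t-spec i)) (subst (λ s → CrossesAt s b c) (sym p) (proj₂ (t-spec j))))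
    ...   | tri> _ _ p = ⊥-elim (left-then-right i₀ j₀ i j lt p)

    lr-false : ∀ {a b c} → Inv a b → Inv b c → lr b ≡ false → t b c < t a b
    lr-false {a} {b} {c} i@(inv a⊲b _ b∈) j eq with left-first? b
    ... | no none with <-cmp (t a b) (t b c)
    ...   | tri< p _ _ = ⊥-elim (none (a , ⊲⇒∈ a⊲b b∈ , c , Inv.member j , i , j , p))
    ...   | tri≈ _ p _ = ⊥-elim (cross-one-way (proj₁ (t-spec i)) (proj₂ (t-spec i)) (subst (λ s → CrossesAt s b c) (sym p) (proj₂ (t-spec j))))
    ...   | tri> _ _ p = p

  open Marked lr hiding (additive)
  open Timing π unique lr t

  differʳ : ∀ {a b b′} → Inv a b → Inv a b′ → b ≢ b′ → t a b ≢ t a b′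
  differʳ {a} {b} {b′} i j b≢b′ eq with lt , c ← t-spec i | _ , c′ ← t-spec j =
    b≢b′ (cross-uniqueʳ lt c (subst (λ s → CrossesAt s a b′) (sym eq) c′))

  differˡ : ∀ {a a′ c} → Inv a c → Inv a′ c → a ≢ a′ → t a c ≢ t a′ c
  differˡ {a} {a′} {c} i j a≢a′ eq with lt , d ← t-spec i | _ , d′ ← t-spec j =
    a≢a′ (cross-uniqueˡ lt d (subst (λ s → CrossesAt s a′ c) (sym eq) d′))

  times : Times
  times = record { t312 = t312 ; t231 = t231 ; t321ˡ = t321ˡ ; t321ʳ = t321ʳ }
    where
    -- `b` stays left of `c`; so once `c` has passed to the left of `a`, `b` has done so too. The
    -- argument for `t231` is the mirror image.
    t312 : ∀ {a b c} → a ⊲ b → b ⊲ c → c ∈ π → b < c → c < a → t a b < t a c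
    t312 {a} {b} {c} a⊲b b⊲c c∈ b<c c<a with s<m , _ , c→a ← t-spec {a} {c} (inv (<-trans a⊲b b⊲c) c<a c∈) =
      ≤∧≢⇒< (≤-pred (crossed i (<-trans (stay s<m b∈ c∈ b⊲c b<c) c→a))) (differʳ i j (<⇒≢ b<c))
      where
      b∈ = ⊲⇒∈ b⊲c c∈
      i = inv a⊲b (<-trans b<c c<a) b∈
      j = inv (<-trans a⊲b b⊲c) c<a c∈
    t231 : ∀ {a b c} → a ⊲ b → b ⊲ c → c ∈ π → c < a → a < b → t b c < t a c
    t231 {a} {b} {c} a⊲b b⊲c c∈ c<a a<b with s<m , _ , c→a ← t-spec {a} {c} (inv (<-trans a⊲b b⊲c) c<a c∈) =
      ≤∧≢⇒< (≤-pred (crossed i (<-trans c→a (stay s<m (⊲⇒∈ a⊲b b∈) b∈ a⊲b a<b)))) (differˡ i j (≢-sym (<⇒≢ a<b)))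
      where
      b∈ = ⊲⇒∈ b⊲c c∈
      i = inv b⊲c (<-trans c<a a<b) c∈
      j = inv (<-trans a⊲b b⊲c) c<a c∈
    -- The place of `b` just after the crossing of `a` and `c` shows that one of them has met `b`
    -- already; its place just before shows that one has yet to meet it. So this crossing lies
    -- between the other two, and the mark of `b` tells in which order.
    module Triple {a b c} (a⊲b : a ⊲ b) (b⊲c : b ⊲ c) (c∈ : c ∈ π) (c<b : c < b) (b<a : b < a) where
      b∈ = ⊲⇒∈ b⊲c c∈
      ab = inv a⊲b b<a b∈
      bc = inv b⊲c c<b c∈
      ac = inv (<-trans a⊲b b⊲c) (<-trans c<b b<a) c∈
      s = t a c
      s<m = proj₁ (t-spec ac)
      a→c : q s a < q s c
      a→c = proj₁ (proj₂ (t-spec ac))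
      c→a : q (suc s) c < q (suc s) a
      c→a = proj₂ (proj₂ (t-spec ac))
      ab<ac : q (suc s) b < q (suc s) a → t a b < s
      ab<ac p = ≤∧≢⇒< (≤-pred (crossed ab p)) (differʳ ab ac (≢-sym (<⇒≢ c<b)))
      bc<ac : q (suc s) c < q (suc s) b → t b c < s
      bc<ac p = ≤∧≢⇒< (≤-pred (crossed bc p)) (differˡ bc ac (<⇒≢ b<a))
      ac<bc : q s b < q s c → s < t b c
      ac<bc p = ≤∧≢⇒< (uncrossed (<⇒≤ s<m) bc p) (differˡ ac bc (≢-sym (<⇒≢ b<a)))
      ac<ab : q s a < q s b → s < t a b
      ac<ab p = ≤∧≢⇒< (uncrossed (<⇒≤ s<m) ab p) (differʳ ac ab (<⇒≢ c<b))
      ab∨bc : t a b < s ⊎ t b c < s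
      ab∨bc with q-cmp (suc s) b a
      ... | tri< p _ _ = inj₁ (ab<ac p)
      ... | tri≈ _ refl _ = ⊥-elim (<-irrefl refl b<a)
      ... | tri> _ _ p = inj₂ (bc<ac (<-trans c→a p))
      bc∨ab : s < t b c ⊎ s < t a b
      bc∨ab with q-cmp s b c
      ... | tri< p _ _ = inj₁ (ac<bc p)
      ... | tri≈ _ refl _ = ⊥-elim (<-irrefl refl c<b)
      ... | tri> _ _ p = inj₂ (ac<ab (<-trans a→c p))
    t321ˡ : ∀ {a b c} → a ⊲ b → b ⊲ c → c ∈ π → c < b → b < a → lr b ≡ true → t a b < t a c × t a c < t b c
    t321ˡ a⊲b b⊲c c∈ c<b b<a l with lt ← lr-true (Triple.ab a⊲b b⊲c c∈ c<b b<a) (Triple.bc a⊲b b⊲c c∈ c<b b<a) l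
      with Triple.ab∨bc a⊲b b⊲c c∈ c<b b<a | Triple.bc∨ab a⊲b b⊲c c∈ c<b b<a
    ... | inj₁ p | inj₁ r = p , r
    ... | inj₁ p | inj₂ r = ⊥-elim (<-asym p r)
    ... | inj₂ p | inj₁ r = ⊥-elim (<-asym p r)
    ... | inj₂ p | inj₂ r = ⊥-elim (<-asym lt (<-trans p r))
    t321ʳ : ∀ {a b c} → a ⊲ b → b ⊲ c → c ∈ π → c < b → b < a → lr b ≡ false → t b c < t a c × t a c < t a b
    t321ʳ a⊲b b⊲c c∈ c<b b<a r with lt ← lr-false (Triple.ab a⊲b b⊲c c∈ c<b b<a) (Triple.bc a⊲b b⊲c c∈ c<b b<a) r
      with Triple.ab∨bc a⊲b b⊲c c∈ c<b b<a | Triple.bc∨ab a⊲b b⊲c c∈ c<b b<a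
    ... | inj₁ p | inj₁ r = ⊥-elim (<-asym lt (<-trans p r))
    ... | inj₁ p | inj₂ r = ⊥-elim (<-asym p r)
    ... | inj₂ p | inj₁ r = ⊥-elim (<-asym p r)
    ... | inj₂ p | inj₂ r = p , r

  Ord⇒q< : ∀ {s x y} → s ≤ m → x ∈ π → y ∈ π → Ord s x y → q s x < q s y
  Ord⇒q< le x∈ y∈ (inj₁ (x⊲y , inj₁ x<y)) = stay le x∈ y∈ x⊲y x<y
  Ord⇒q< {s} {x} {y} le x∈ y∈ (inj₁ (x⊲y , inj₂ s≤t)) with <-cmp x y
  ... | tri< x<y _ _ = stay le x∈ y∈ x⊲y x<y
  ... | tri≈ _ refl _ = ⊥-elim (<-irrefl refl x⊲y)
  ... | tri> _ _ y<x = until-cross (inv x⊲y y<x y∈) s≤t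
  Ord⇒q< le x∈ y∈ (inj₂ (y⊲x , x<y , t<s)) = since-cross le (inv y⊲x x<y x∈) t<s

  q-at-cross : ∀ {a b} → Inv a b → q (t a b) a ≡ p a b
  q-at-cross {a} {b} i = pos-at-cross times (perm-↭ _ le) i (Ord⇒q< le)
    where le = <⇒≤ (proj₁ (t-spec i))

  right-line : ∀ {a b b′} → Inv a b → Inv a b′ → t a b ≤ t a b′ → p a b′ + t a b ≡ p a b + t a b′
  right-line {a} {b} {b′} i@(inv a⊲b _ b∈) j le = subst₂ (λ u v → v + t a b ≡ u + t a b′) (q-at-cross i) (q-at-cross j)
    (subst (λ z → q z a + t a b ≡ q (t a b) a + z) (m+[n∸m]≡n le)
      (telescope (λ s → q s a) (λ s → s) (t a b′ ∸ t a b) (t a b) (λ w u≤w w<v →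
        let w<v′ = subst (w <_) (m+[n∸m]≡n le) w<v
            t<m = proj₁ (t-spec j)
        in right-step a (<-trans w<v′ t<m)
             (right-convex (⊲⇒∈ a⊲b b∈) u≤w (<⇒≤ w<v′) t<m (moving-right i) (moving-right j)))))

  q-at-crossˡ : ∀ {a b} → Inv a b → q (t a b) b ≡ suc (p a b)
  q-at-crossˡ i with lt , c ← t-spec i = trans (proj₁ (proj₂ (cross-pos lt c))) (cong suc (q-at-cross i))

  left-line : ∀ {a a′ c} → Inv a c → Inv a′ c → t a c ≤ t a′ c → p a c + t a c ≡ p a′ c + t a′ c
  left-line {a} {a′} {c} i@(inv _ _ c∈) j le = suc-injective (sym (subst₂ (λ u v → v + t a′ c ≡ u + t a c) (q-at-crossˡ i) (q-at-crossˡ j)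
    (sym (subst (λ z → q (t a c) c + t a c ≡ q z c + z) (m+[n∸m]≡n le)
      (telescope (λ _ → 0) (λ s → q s c + s) (t a′ c ∸ t a c) (t a c) (λ w u≤w w<v →
        let w<v′ = subst (w <_) (m+[n∸m]≡n le) w<v
            t<m = proj₁ (t-spec j)
        in left-step c (<-trans w<v′ t<m)
             (left-convex c∈ u≤w (<⇒≤ w<v′) t<m (moving-left i) (moving-left j))))))))

  lineʳ : ∀ {a b b′} → Inv a b → Inv a b′ → p a b′ + t a b ≡ p a b + t a b′
  lineʳ {a} {b} {b′} i j with ≤-total (t a b) (t a b′)
  ... | inj₁ le = right-line i j le
  ... | inj₂ le = sym (right-line j i le)

  lineˡ : ∀ {a a′ c} → Inv a c → Inv a′ c → p a c + t a c ≡ p a′ c + t a′ c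
  lineˡ {a} {a′} {c} i j with ≤-total (t a c) (t a′ c)
  ... | inj₁ le = left-line i j le
  ... | inj₂ le = sym (left-line j i le)

  -- The crossings are the corners of a rectangle whose sides are the two R-lines and the two
  -- L-lines. Adding the four line equations cancels all times and leaves twice the claim.
  additive : ∀ {a b c d} → Rect a b c d → p a c + p b d ≡ p a d + p b c
  additive {a} {b} {c} {d} (rect a∈ b∈ c∈ d∈ a⊲b b⊲c c⊲d c<a d<a c<b d<b) =
    *-cancelˡ-≡ _ _ 2 (+-cancelʳ-≡ (t a c + t b d + (t a d + t b c)) _ _ (begin
      2 * (p a c + p b d) + (t a c + t b d + (t a d + t b c))
        ≡⟨ regroup (p a c) (p b d) (t a c) (t b d) (t a d) (t b c) ⟩
      (p a c + t a d) + (p b d + t b c) + ((p a c + t a c) + (p b d + t b d))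
        ≡⟨ cong₂ _+_ (cong₂ _+_ (sym (lineʳ ac ad)) (lineʳ bc bd)) (cong₂ _+_ (lineˡ ac bc) (sym (lineˡ ad bd))) ⟩
      (p a d + t a c) + (p b c + t b d) + ((p b c + t b c) + (p a d + t a d))
        ≡⟨ regroup′ (p a d) (p b c) (t a c) (t b d) (t a d) (t b c) ⟩
      2 * (p a d + p b c) + (t a c + t b d + (t a d + t b c)) ∎))
    where
    open ≡-Reasoning
    a⊲c = <-trans a⊲b b⊲c
    ac = inv a⊲c c<a c∈
    ad = inv (<-trans a⊲c c⊲d) d<a d∈
    bc = inv b⊲c c<b c∈
    bd = inv (<-trans b⊲c c⊲d) d<b d∈
    regroup : ∀ u v i j k l → 2 * (u + v) + (i + j + (k + l)) ≡ (u + k) + (v + l) + ((u + i) + (v + j))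
    regroup = solve-∀
    regroup′ : ∀ u v i j k l → (u + i) + (v + j) + ((v + l) + (u + k)) ≡ 2 * (u + v) + (i + j + (k + l))
    regroup′ = solve-∀

  balanced-lengths : ∀ {a b c d} → Rect a b c d → Λ a b c d + Ρ c d b a ≡ Ρ c d a b + Λ a b d c
  balanced-lengths {a} {b} {c} {d} ρ = +-cancelˡ-≡ (p a c + p b d) _ _
    (trans (rec-identity ρ) (cong (_+ (Ρ c d a b + Λ a b d c)) (sym (additive ρ))))

  -- Both a > b and c > d: a left switchback e forces b to be marked RL, and a right switchback e′
  -- forces it to be marked LR.
  clash : ∀ {a b c d e e′} → Rect a b c d → b < a → d < c → e ∈ π → a ⊲ e → e ⊲ b → d < e → e < c → lr e ≡ false →
    e′ ∈ π → c ⊲ e′ → e′ ⊲ d → b < e′ → e′ < a → lr e′ ≡ true → ⊥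
  clash {b = b} (rect a∈ b∈ c∈ d∈ a⊲b b⊲c c⊲d c<a d<a c<b d<b) b<a d<c e∈ a⊲e e⊲b d<e e<c rl-e e′∈ c⊲e′ e′⊲d b<e′ e′<a lr-e′
    with true-or-false (lr b)
  ... | inj₁ lr-b = no-bad times (bad a∈ e∈ b∈ d∈ a⊲e e⊲b (<-trans b⊲c c⊲d) d<e (<-trans e<c c<b) b<a rl-e lr-b)
  ... | inj₂ rl-b = no-bad times (bad a∈ b∈ e′∈ d∈ a⊲b (<-trans b⊲c c⊲e′) e′⊲d d<b b<e′ e′<a rl-b lr-e′)

  Λ-zero⁻ : ∀ {a b c d e} → Λ a b c d ≡ 0 → e ∈ π → a ⊲ e → e ⊲ b → c < e → e < d → lr e ≡ true
  Λ-zero⁻ {a} {b} {c} {d} {e} zero-sum e∈ r s u v with lr e in eq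
  ... | true  = refl
  ... | false with () ← trans (sym (cong₂ (λ f g → ⟦ f ∧ not g ⟧) (T⇒≡ (sl⁺ {a} {b} {c} {d} r s u v)) eq)) (Σ-zero⁻ π zero-sum e e∈)

  Ρ-zero⁻ : ∀ {a b c d e} → Ρ a b c d ≡ 0 → e ∈ π → a ⊲ e → e ⊲ b → c < e → e < d → lr e ≡ false
  Ρ-zero⁻ {a} {b} {c} {d} {e} zero-sum e∈ r s u v with lr e in eq
  ... | false = refl
  ... | true with () ← trans (sym (cong₂ (λ f g → ⟦ f ∧ g ⟧) (T⇒≡ (sl⁺ {a} {b} {c} {d} r s u v)) eq)) (Σ-zero⁻ π zero-sum e e∈)

  balanced : Balanced
  balanced = record { regular = ascending ; emptyˡ = emptyˡ ; emptyʳ = emptyʳ }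
    where
    ascending : ∀ {a b c d} → Rect a b c d → a < b → c < d → Λ a b c d ≡ Ρ c d a b
    ascending {a} {b} {c} {d} ρ a<b c<d = subst₂ _≡_
      (trans (cong (Λ a b c d +_) (Ρ-descending {c} {d} (<⇒≤ a<b))) (+-identityʳ _))
      (trans (cong (Ρ c d a b +_) (Λ-descending {a} {b} (<⇒≤ c<d))) (+-identityʳ _)) (balanced-lengths ρ)
    down-up : ∀ {a b c d} → Rect a b c d → b < a → c < d → Λ a b c d + Ρ c d b a ≡ 0
    down-up {a} {b} {c} {d} ρ b<a c<d = trans (balanced-lengths ρ)
      (cong₂ _+_ (Ρ-descending {c} {d} (<⇒≤ b<a)) (Λ-descending {a} {b} (<⇒≤ c<d)))
    up-down : ∀ {a b c d} → Rect a b c d → a < b → d < c → Ρ c d a b + Λ a b d c ≡ 0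
    up-down {a} {b} {c} {d} ρ a<b d<c = trans (sym (balanced-lengths ρ))
      (cong₂ _+_ (Λ-descending {a} {b} (<⇒≤ d<c)) (Ρ-descending {c} {d} (<⇒≤ a<b)))
    down-down : ∀ {a b c d} → Rect a b c d → b < a → d < c → Ρ c d b a ≡ Λ a b d c
    down-down {a} {b} {c} {d} ρ b<a d<c = subst₂ _≡_
      (cong (_+ Ρ c d b a) (Λ-descending {a} {b} (<⇒≤ d<c)))
      (cong (_+ Λ a b d c) (Ρ-descending {c} {d} (<⇒≤ b<a))) (balanced-lengths ρ)
    down-downˡ : ∀ {a b c d e} → Rect a b c d → b < a → d < c → e ∈ π → a ⊲ e → e ⊲ b → d < e → e < c → lr e ≡ true
    down-downˡ {a} {b} {c} {d} {e} ρ b<a d<c e∈ r s u v with true-or-false (lr e)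
    ... | inj₁ l = l
    ... | inj₂ rl-e with Ρ c d b a ≟ 0
    ...   | yes zero-sum = ⊥-elim (true≢false (Λ-zero⁻ (trans (sym (down-down ρ b<a d<c)) zero-sum) e∈ r s u v) rl-e)
    -- The equal counts are positive, so a right switchback exists besides the left one, and the two
    -- are incompatible.
    ...   | no nonzero with e′ , e′∈ , h ← Σ-⟦⟧-witness _ π nonzero
            with h₁ , h₂ ← T-∧⁻ {sl c d b a e′} (≡⇒T h) with r′ , s′ , u′ , v′ ← sl⁻ {c} {d} {b} {a} h₁ =
              ⊥-elim (clash ρ b<a d<c e∈ r s u v rl-e e′∈ r′ s′ u′ v′ (T⇒≡ h₂))
    down-downʳ : ∀ {a b c d e} → Rect a b c d → b < a → d < c → e ∈ π → c ⊲ e → e ⊲ d → b < e → e < a → lr e ≡ false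
    down-downʳ {a} {b} {c} {d} {e} ρ b<a d<c e∈ r s u v with true-or-false (lr e)
    ... | inj₂ l = l
    ... | inj₁ lr-e with Λ a b d c ≟ 0
    ...   | yes zero-sum = ⊥-elim (true≢false lr-e (Ρ-zero⁻ (trans (down-down ρ b<a d<c) zero-sum) e∈ r s u v))
    ...   | no nonzero with e′ , e′∈ , h ← Σ-⟦⟧-witness _ π nonzero
            with h₁ , h₂ ← T-∧⁻ {sl a b d c e′} (≡⇒T h) with r′ , s′ , u′ , v′ ← sl⁻ {a} {b} {d} {c} h₁ =
              ⊥-elim (clash ρ b<a d<c e′∈ r′ s′ u′ v′ (not-true⇒ (T⇒≡ h₂)) e∈ r s u v lr-e)
    emptyˡ : ∀ {a b c d e} → Rect a b c d → Irregular a b c d → e ∈ π → Slot a b c d e → lr e ≡ true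
    emptyˡ {a} {b} {c} {d} ρ i e∈ (r , s , inj₁ (u , v)) with i
    ... | inj₁ b<a = Λ-zero⁻ (m+n≡0⇒m≡0 (Λ a b c d) (down-up ρ b<a (<-trans u v))) e∈ r s u v
    ... | inj₂ d<c = ⊥-elim (<-asym d<c (<-trans u v))
    emptyˡ {a} {b} {c} {d} ρ i e∈ (r , s , inj₂ (u , v)) with <-cmp a b
    ... | tri< a<b _ _ = Λ-zero⁻ (m+n≡0⇒n≡0 (Ρ c d a b) (up-down ρ a<b (<-trans u v))) e∈ r s u v
    ... | tri≈ _ refl _ = ⊥-elim (<-irrefl refl (Rect.a⊲b ρ))
    ... | tri> _ _ b<a = down-downˡ ρ b<a (<-trans u v) e∈ r s u v
    emptyʳ : ∀ {a b c d e} → Rect a b c d → Irregular a b c d → e ∈ π → Slot c d a b e → lr e ≡ false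
    emptyʳ {a} {b} {c} {d} ρ i e∈ (r , s , inj₁ (u , v)) with i
    ... | inj₁ b<a = ⊥-elim (<-asym b<a (<-trans u v))
    ... | inj₂ d<c = Ρ-zero⁻ (m+n≡0⇒m≡0 (Ρ c d a b) (up-down ρ (<-trans u v) d<c)) e∈ r s u v
    emptyʳ {a} {b} {c} {d} ρ i e∈ (r , s , inj₂ (u , v)) with <-cmp c d
    ... | tri< c<d _ _ = Ρ-zero⁻ (m+n≡0⇒n≡0 (Λ a b c d) (down-up ρ (<-trans u v) c<d)) e∈ r s u v
    ... | tri≈ _ refl _ = ⊥-elim (<-irrefl refl (Rect.c⊲d ρ))
    ... | tri> _ _ d<c = down-downʳ ρ (<-trans u v) d<c e∈ r s u v

-- Markings

module MarkingOf (n : ℕ) (π : List ℕ) (π↭ : π ↭ range n) (unique : Unique π) where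
  open Position π

  module _ (M : Marking) (lr : ℕ → Bool)
    (compatible : ∀ {e} → e ∈ π → IsLeft π e → IsRight π e → isLR (M e) ≡ lr e × isRL (M e) ≡ not (lr e)) where
    open Marked lr

    ⊲⇒Before : ∀ {x y} → y ∈ π → x ⊲ y → Before π x y
    ⊲⇒Before = pos<⇒Before π

    Before⇒⊲ : ∀ {x y} → Before π x y → x ⊲ y
    Before⇒⊲ = Before⇒pos< {π} unique

    -- The rec itself supplies the inversions of `e` on both sides. Thus `compatible`, which speaks
    -- of switchbacks, is enough to translate marks in slots.
    slotˡ-switchback : ∀ {a b c d e} → Rect a b c d → e ∈ π → Slot a b c d e → IsLeft π e × IsRight π e
    slotˡ-switchback ρ e∈ (a⊲e , e⊲b , inj₁ (c<e , e<d)) =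
      (_ , <-trans e<d (Rect.d≺a ρ) , ⊲⇒Before e∈ a⊲e) ,
      (_ , c<e , ⊲⇒Before (Rect.c∈ ρ) (<-trans e⊲b (Rect.b⊲c ρ)))
    slotˡ-switchback ρ e∈ (a⊲e , e⊲b , inj₂ (d<e , e<c)) =
      (_ , <-trans e<c (Rect.c≺a ρ) , ⊲⇒Before e∈ a⊲e) ,
      (_ , d<e , ⊲⇒Before (Rect.d∈ ρ) (<-trans e⊲b (<-trans (Rect.b⊲c ρ) (Rect.c⊲d ρ))))

    slotʳ-switchback : ∀ {a b c d e} → Rect a b c d → e ∈ π → Slot c d a b e → IsLeft π e × IsRight π e
    slotʳ-switchback ρ e∈ (c⊲e , e⊲d , inj₁ (a<e , e<b)) =
      (_ , e<b , ⊲⇒Before e∈ (<-trans (Rect.b⊲c ρ) c⊲e)) ,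
      (_ , <-trans (Rect.d≺a ρ) a<e , ⊲⇒Before (Rect.d∈ ρ) e⊲d)
    slotʳ-switchback ρ e∈ (c⊲e , e⊲d , inj₂ (b<e , e<a)) =
      (_ , e<a , ⊲⇒Before e∈ (<-trans (Rect.a⊲b ρ) (<-trans (Rect.b⊲c ρ) c⊲e))) ,
      (_ , <-trans (Rect.d≺b ρ) b<e , ⊲⇒Before (Rect.d∈ ρ) e⊲d)

    strictlyBetween⁻ : ∀ e u v → T (strictlyBetween e u v) → u < e × e < v ⊎ v < e × e < u
    strictlyBetween⁻ e u v h with T-∨⁻ {(u <ᵇ e) ∧ (e <ᵇ v)} h
    ... | inj₁ h₁ with r , s ← T-∧⁻ {u <ᵇ e} h₁ = inj₁ (<ᵇ⇒< u e r , <ᵇ⇒< e v s)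
    ... | inj₂ h₂ with r , s ← T-∧⁻ {v <ᵇ e} h₂ = inj₂ (<ᵇ⇒< v e r , <ᵇ⇒< e u s)

    strictlyBetween⁺ : ∀ e u v → u < e × e < v ⊎ v < e × e < u → T (strictlyBetween e u v)
    strictlyBetween⁺ e u v (inj₁ (r , s)) = T-∨ˡ {(u <ᵇ e) ∧ (e <ᵇ v)} (∧-T {u <ᵇ e} (<⇒<ᵇ r) (<⇒<ᵇ s))
    strictlyBetween⁺ e u v (inj₂ (r , s)) = T-∨ʳ {(u <ᵇ e) ∧ (e <ᵇ v)} (∧-T {v <ᵇ e} (<⇒<ᵇ r) (<⇒<ᵇ s))

    leftSB⁻ : ∀ {a b c d e} → Rect a b c d → T (leftSB π M a b c d e) → e ∈ π × Slot a b c d e × lr e ≡ false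
    leftSB⁻ {a} {b} {c} {d} {e} ρ h
      with h₁ , h′ ← T-∧⁻ {isRL (M e)} h
      with h₂ , h″ ← T-∧⁻ {before π a e} h′
      with h₃ , h₄ ← T-∧⁻ {before π e b} h″ = e∈ , slot ,
        not-true⇒ (trans (sym (let l , r = slotˡ-switchback ρ e∈ slot in proj₂ (compatible e∈ l r))) (T⇒≡ h₁))
      where
      e∈ = proj₂ (Before⇒∈ π {a} {e} h₂)
      slot : Slot a b c d e
      slot = Before⇒⊲ h₂ , Before⇒⊲ {e} {b} h₃ , strictlyBetween⁻ e c d h₄

    leftSB⁺ : ∀ {a b c d e} → Rect a b c d → e ∈ π → Slot a b c d e → lr e ≡ false → T (leftSB π M a b c d e)
    leftSB⁺ {a} {b} {c} {d} {e} ρ e∈ slot@(r , s , u) rl-e with l , r′ ← slotˡ-switchback ρ e∈ slot =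
      ∧-T {isRL (M e)} (≡⇒T (trans (proj₂ (compatible e∈ l r′)) (cong not rl-e)))
        (∧-T {before π a e} (⊲⇒Before {a} {e} e∈ r)
          (∧-T {before π e b} (⊲⇒Before {e} {b} (Rect.b∈ ρ) s) (strictlyBetween⁺ e c d u)))

    rightSB⁻ : ∀ {a b c d e} → Rect a b c d → T (rightSB π M a b c d e) → e ∈ π × Slot c d a b e × lr e ≡ true
    rightSB⁻ {a} {b} {c} {d} {e} ρ h
      with h₁ , h′ ← T-∧⁻ {isLR (M e)} h
      with h₂ , h″ ← T-∧⁻ {before π c e} h′
      with h₃ , h₄ ← T-∧⁻ {before π e d} h″ = e∈ , slot ,
        trans (sym (let l , r = slotʳ-switchback ρ e∈ slot in proj₁ (compatible e∈ l r))) (T⇒≡ h₁)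
      where
      e∈ = proj₂ (Before⇒∈ π {c} {e} h₂)
      slot : Slot c d a b e
      slot = Before⇒⊲ h₂ , Before⇒⊲ {e} {d} h₃ , strictlyBetween⁻ e a b h₄

    rightSB⁺ : ∀ {a b c d e} → Rect a b c d → e ∈ π → Slot c d a b e → lr e ≡ true → T (rightSB π M a b c d e)
    rightSB⁺ {a} {b} {c} {d} {e} ρ e∈ slot@(r , s , u) lr-e with l , r′ ← slotʳ-switchback ρ e∈ slot =
      ∧-T {isLR (M e)} (≡⇒T (trans (proj₁ (compatible e∈ l r′)) lr-e))
        (∧-T {before π c e} (⊲⇒Before {c} {e} e∈ r)
          (∧-T {before π e d} (⊲⇒Before {e} {d} (Rect.d∈ ρ) s) (strictlyBetween⁺ e a b u)))

    -- `leftSB` admits both value orders of `c` and `d`, while `Λ` counts the ascending one; `c < d`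
    -- makes them agree.
    count-left : ∀ {a b c d} → Rect a b c d → c < d → countB (leftSB π M a b c d) π ≡ Λ a b c d
    count-left {a} {b} {c} {d} ρ c<d = trans (countB-sum _ π) (Σ-cong π (λ e e∈ → cong ⟦_⟧ (T-bool-ext (fwd e) (bwd e e∈))))
      where
      fwd : ∀ e → T (leftSB π M a b c d e) → T (sl a b c d e ∧ not (lr e))
      fwd e h with leftSB⁻ ρ h
      ... | _ , (r , s , inj₁ (u , v)) , rl-e = ∧-T {sl a b c d e} (sl⁺ {a} {b} {c} {d} r s u v) (≡⇒T (cong not rl-e))
      ... | _ , (r , s , inj₂ (u , v)) , _ = ⊥-elim (<-asym c<d (<-trans u v))
      bwd : ∀ e → e ∈ π → T (sl a b c d e ∧ not (lr e)) → T (leftSB π M a b c d e)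
      bwd e e∈ h with h₁ , h₂ ← T-∧⁻ {sl a b c d e} h with r , s , u , v ← sl⁻ {a} {b} {c} {d} h₁ =
        leftSB⁺ ρ e∈ (r , s , inj₁ (u , v)) (not-true⇒ (T⇒≡ h₂))

    count-right : ∀ {a b c d} → Rect a b c d → a < b → countB (rightSB π M a b c d) π ≡ Ρ c d a b
    count-right {a} {b} {c} {d} ρ a<b = trans (countB-sum _ π) (Σ-cong π (λ e e∈ → cong ⟦_⟧ (T-bool-ext (fwd e) (bwd e e∈))))
      where
      fwd : ∀ e → T (rightSB π M a b c d e) → T (sl c d a b e ∧ lr e)
      fwd e h with rightSB⁻ ρ h
      ... | _ , (r , s , inj₁ (u , v)) , lr-e = ∧-T {sl c d a b e} (sl⁺ {c} {d} {a} {b} r s u v) (≡⇒T lr-e)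
      ... | _ , (r , s , inj₂ (u , v)) , _ = ⊥-elim (<-asym a<b (<-trans u v))
      bwd : ∀ e → e ∈ π → T (sl c d a b e ∧ lr e) → T (rightSB π M a b c d e)
      bwd e e∈ h with h₁ , h₂ ← T-∧⁻ {sl c d a b e} h with r , s , u , v ← sl⁻ {c} {d} {a} {b} h₁ =
        rightSB⁺ ρ e∈ (r , s , inj₁ (u , v)) (T⇒≡ h₂)

    Rec⇒Rect : ∀ {a b c d} → Rec π a b c d → Rect a b c d
    Rec⇒Rect {a} {b} {c} {d} (ab , bc , cd , lt) = rect
      (proj₁ (Before⇒∈ π {a} {b} ab)) (proj₂ (Before⇒∈ π {a} {b} ab)) (proj₁ (Before⇒∈ π {c} {d} cd)) (proj₂ (Before⇒∈ π {c} {d} cd))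
      (Before⇒⊲ ab) (Before⇒⊲ bc) (Before⇒⊲ cd)
      (<-≤-trans c< (m⊓n≤m a b)) (<-≤-trans d< (m⊓n≤m a b)) (<-≤-trans c< (m⊓n≤n a b)) (<-≤-trans d< (m⊓n≤n a b))
      where
      c< = ≤-<-trans (m≤m⊔n c d) lt
      d< = ≤-<-trans (m≤n⊔m c d) lt

    Rect⇒Rec : ∀ {a b c d} → Rect a b c d → Rec π a b c d
    Rect⇒Rec {a} {b} {c} {d} (rect a∈ b∈ c∈ d∈ a⊲b b⊲c c⊲d c<a d<a c<b d<b) =
      ⊲⇒Before b∈ a⊲b , ⊲⇒Before c∈ b⊲c , ⊲⇒Before d∈ c⊲d , ⊓-pres-m< (⊔-pres-<m c<a d<a) (⊔-pres-<m c<b d<b)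

    Balanced⇒BalancedMarking : Balanced → BalancedMarking π M
    Balanced⇒BalancedMarking bal a b c d rec = regular′ , irregular′
      where
      ρ = Rec⇒Rect rec
      regular′ : Regular a b c d → BalancedRec π M a b c d
      regular′ (a<b , c<d) = trans (count-left ρ c<d) (trans (Balanced.regular bal ρ a<b c<d) (sym (count-right ρ a<b)))
      irregular′ : ¬ Regular a b c d → EmptyRec π M a b c d
      irregular′ ¬reg e =
        (λ h → let e∈ , slot , rl = leftSB⁻ ρ h in true≢false (Balanced.emptyˡ bal ρ irr e∈ slot) rl) ,
        (λ h → let e∈ , slot , l = rightSB⁻ ρ h in true≢false l (Balanced.emptyʳ bal ρ irr e∈ slot))
        where
        irr : Irregular a b c d
        irr with <-cmp a b | <-cmp c d
        ... | tri≈ _ refl _ | _ = ⊥-elim (<-irrefl refl (Rect.a⊲b ρ))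
        ... | _ | tri≈ _ refl _ = ⊥-elim (<-irrefl refl (Rect.c⊲d ρ))
        ... | tri> _ _ b<a | _ = inj₁ b<a
        ... | _ | tri> _ _ d<c = inj₂ d<c
        ... | tri< a<b _ _ | tri< c<d _ _ = ⊥-elim (¬reg (a<b , c<d))

    BalancedMarking⇒Balanced : BalancedMarking π M → Balanced
    BalancedMarking⇒Balanced bal = record
      { regular = λ {a} {b} {c} {d} ρ a<b c<d →
          trans (sym (count-left ρ c<d)) (trans (proj₁ (bal a b c d (Rect⇒Rec ρ)) (a<b , c<d)) (count-right ρ a<b))
      ; emptyˡ = λ {a} {b} {c} {d} {e} ρ i e∈ slot → [ (λ l → l) , (λ rl →
          ⊥-elim (proj₁ (proj₂ (bal a b c d (Rect⇒Rec ρ)) (irregular i) e) (leftSB⁺ ρ e∈ slot rl))) ]′ (true-or-false (lr e))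
      ; emptyʳ = λ {a} {b} {c} {d} {e} ρ i e∈ slot → [ (λ l →
          ⊥-elim (proj₂ (proj₂ (bal a b c d (Rect⇒Rec ρ)) (irregular i) e) (rightSB⁺ ρ e∈ slot l))) , (λ rl → rl) ]′ (true-or-false (lr e))
      }
      where
      irregular : ∀ {a b c d} → Irregular a b c d → ¬ Regular a b c d
      irregular (inj₁ b<a) (a<b , _) = <-asym a<b b<a
      irregular (inj₂ d<c) (_ , c<d) = <-asym c<d d<c

  ∈π⇒bounds : ∀ {e} → e ∈ π → 1 ≤ e × e ≤ n
  ∈π⇒bounds e∈ with i , i∈ , refl ← ∈-map⁻ suc (∈-resp-↭ π↭ e∈) = s≤s z≤n , ∈-upTo⁻ i∈

  MarkingFor-compatible : ∀ {M} → MarkingFor n π M →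
    ∀ {e} → e ∈ π → IsLeft π e → IsRight π e → isLR (M e) ≡ isLR (M e) × isRL (M e) ≡ not (isLR (M e))
  MarkingFor-compatible {M} for {e} e∈ l r
    with 1≤e , e≤n ← ∈π⇒bounds e∈
    with proj₁ (proj₂ (proj₂ (for e 1≤e e≤n))) (l , r)
  ... | inj₁ eq rewrite eq = refl , refl
  ... | inj₂ eq rewrite eq = refl , refl

  left? : ∀ i → Dec (IsLeft π i)
  left? i = map′ (λ (j , _ , h) → j , h) (λ (j , lt , h) → j , proj₁ (Before⇒∈ π {j} {i} h) , lt , h)
    (any∈? (λ j → (i <? j) ×-dec T? (before π j i)) π)

  right? : ∀ i → Dec (IsRight π i)
  right? i = map′ (λ (j , _ , h) → j , h) (λ (j , lt , h) → j , proj₂ (Before⇒∈ π {i} {j} h) , lt , h)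
    (any∈? (λ j → (j <? i) ×-dec T? (before π i j)) π)

  letters : (ℕ → Bool) → ∀ {i} → Dec (IsLeft π i) → Dec (IsRight π i) → List Dir
  letters lr {i} (yes _) (yes _) with lr i
  ... | true  = L ∷ R ∷ []
  ... | false = R ∷ L ∷ []
  letters lr (yes _) (no _) = L ∷ []
  letters lr (no _) (yes _) = R ∷ []
  letters lr (no _) (no _)  = []

  marking : (ℕ → Bool) → Marking
  marking lr i = letters lr (left? i) (right? i)

  marking-for : ∀ lr → MarkingFor n π (marking lr)
  marking-for lr i _ _ with left? i | right? i
  ... | yes l | no ¬r = (λ _ → refl) , (λ (r , _) → ⊥-elim (¬r r)) , (λ (_ , r) → ⊥-elim (¬r r)) , (λ (¬l , _) → ⊥-elim (¬l l))
  ... | no ¬l | yes r = (λ (l , _) → ⊥-elim (¬l l)) , (λ _ → refl) , (λ (l , _) → ⊥-elim (¬l l)) , (λ (_ , ¬r) → ⊥-elim (¬r r))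
  ... | no ¬l | no ¬r = (λ (l , _) → ⊥-elim (¬l l)) , (λ (r , _) → ⊥-elim (¬r r)) , (λ (l , _) → ⊥-elim (¬l l)) , (λ _ → refl)
  ... | yes l | yes r = (λ (_ , ¬r) → ⊥-elim (¬r r)) , (λ (_ , ¬l) → ⊥-elim (¬l l)) , (λ _ → switchback) , (λ (¬l , _) → ⊥-elim (¬l l))
    where
    switchback : letters lr (yes l) (yes r) ≡ L ∷ R ∷ [] ⊎ letters lr (yes l) (yes r) ≡ R ∷ L ∷ []
    switchback with lr i
    ... | true  = inj₁ refl
    ... | false = inj₂ refl

  marking-compatible : ∀ lr {e} → e ∈ π → IsLeft π e → IsRight π e →
    isLR (marking lr e) ≡ lr e × isRL (marking lr e) ≡ not (lr e)
  marking-compatible lr {e} _ l r with left? e | right? e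
  ... | no ¬l | _ = ⊥-elim (¬l l)
  ... | yes _ | no ¬r = ⊥-elim (¬r r)
  ... | yes _ | yes _ with lr e
  ...   | true  = refl , refl
  ...   | false = refl , refl

theorem3 : (n : ℕ) (π : List ℕ) → π ↭ range n →
    Perfect n π ⇔ Σ Marking (λ M → MarkingFor n π M × BalancedMarking π M)
theorem3 n π π↭ = mk⇔ forwards backwards
  where
  unique : Unique π
  unique = Unique-resp-↭ (↭-sym π↭) (AllPairs.map <⇒≢ (AllPairs-range n))
  open MarkingOf n π π↭ unique
  forwards : Perfect n π → Σ Marking (λ M → MarkingFor n π M × BalancedMarking π M)
  forwards (τ , (start , finish) , perfect) =
    marking lr , marking-for lr , Balanced⇒BalancedMarking (marking lr) lr (marking-compatible lr) balanced
    where open FromTangle n π π↭ unique τ start finish perfect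
  backwards : Σ Marking (λ M → MarkingFor n π M × BalancedMarking π M) → Perfect n π
  backwards (M , for , bal)
    -- The tangle is built from the repaired marking, which may differ from `M`.
    with lr , bal′ , no-bad ← GoodMarking.good-marking π unique
      (BalancedMarking⇒Balanced M (λ e → isLR (M e)) (MarkingFor-compatible {M} for) bal) =
    good-balanced⇒perfect π↭ unique lr bal′ no-bad
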